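{- Let $p=p(n)\in(0,1)$ and let $K_{n,p}$ denote the number of edges in any unimodular triangulation $\Delta_{n,p}$ of the random symmetric edge polytope $P_{n,p}$. Then $$\mathbb{E}[K_{n,p}]=6\binom n4p^2(2-p^2)+6\binom n3p^2+2\binom n2(1-p)\Bigl(1-(1-p^2)^{n-2}\Bigr)+2\binom n2p .$$ As $n\to\infty$, this behaves like $\mathbb{E}[K_{n,p}]\simeq n^4p^2$.
   Context: For a finite simple graph $G=(V,E)$ (elements of $V$ are nodes, elements of $E\subseteq\binom V2$ are arcs), with $(\mathbf{e}_i)_{i\in V}$ the standard basis of $\mathbb{R}^V$, the symmetric edge polytope is $P_G:=\operatorname{conv}\{\pm(\mathbf{e}_i-\mathbf{e}_j):\{i,j\}\in E\}\subset\mathbb{R}^V$ (empty if $E=\emptyset$, in which case the number of edges of a triangulation is $0$). A (lattice) triangulation of a $d$-dimensional lattice polytope $P$ is a subdivision of $P$ into $d$-dimensional lattice simplices with union $P$, any two of which meet in a (possibly empty) common face. It is unimodular if every $d$-simplex in it has minimal possible volume among lattice simplices, equivalently is lattice equivalent (with respect to the lattice $\mathbb{Z}^V\cap\operatorname{aff}(P)$ in the case of $P=P_G$) to the standard simplex spanned by the origin and the standard unit vectors. The edges of a triangulation are the $1$-dimensional elements of the simplicial complex consisting of its simplices and all their faces. It is known that every $P_G$ has a unimodular triangulation, and that all unimodular triangulations of a given lattice polytope have the same number of edges, so $K_{n,p}$ is well defined. $G_{n,p}$ is the Erdős–Rényi random graph on node set $[n]=\{1,\dots,n\}$, each arc of the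 complete graph being retained independently with probability $p=p(n)\in(0,1)$, where $p$ may depend on $n$; $P_{n,p}:=P_{G_{n,p}}$. Asymptotic notation for sequences: $a_n\simeq b_n$ means $0<\liminf_{n\to\infty}|a_n/b_n|\le\limsup_{n\to\infty}|a_n/b_n|<\infty$.
   Formalization: The asymptotic claim E[K] ≃ n⁴p² is proved under the added (necessary and sufficient) condition liminf n²p > 0; without it the claim fails, e.g. for p = n⁻³. The exact formula is unconditional, and everything is over an arbitrary ordered field, of which the reals are an instance. -}

module Defs where

open import Algebra.Bundles using (CommutativeRing; Semiring)
import Algebra.Definitions.RawMonoid
import Algebra.Definitions.RawSemiring
open import Data.Bool.Base using (Bool; false; T; if_then_else_)
open import Data.Fin.Base using (Fin; zero; suc)
import Data.Fin.Properties as Fin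
open import Data.Fin.Subset using (Subset; inside; outside)
open import Data.Integer.Base as ℤ using (ℤ; +_; -[1+_])
import Data.Integer.Properties as ℤ
open import Data.List.Base as List
  using (List; []; _∷_; _++_; map; length; concatMap; deduplicate; allFin;
         cartesianProductWith)
open import Data.List.Membership.Propositional using (_∈_)
open import Data.List.Relation.Binary.Permutation.Propositional using (_↭_)
open import Data.List.Relation.Binary.Subset.Propositional using (_⊆_)
open import Data.Nat.Base as ℕ using (ℕ; zero; suc)
open import Data.Product.Base using (Σ; ∃-syntax; _×_; _,_)
open import Data.Sum.Base using (_⊎_)
open import Data.Vec.Base as Vec using (Vec; []; _∷_)
open import Data.Vec.Functional using (Vector)
open import Data.Vec.Properties using (≡-dec)
open import Function.Base using (_∘_)
open import Function.Bundles using (_⇔_)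
open import Level using (Level; _⊔_) renaming (suc to lsuc)
open import Relation.Binary.Core using (Rel)
open import Relation.Binary.Definitions using (Decidable)
open import Relation.Binary.PropositionalEquality.Core using (_≡_; refl)
open import Relation.Binary.Structures using (IsStrictTotalOrder)
open import Relation.Nullary.Decidable.Core using (⌊_⌋; _×-dec_; _⊎-dec_)
open import Relation.Nullary.Negation.Core using (¬_)
open import Relation.Unary using (Pred)

------------------------------------------------------------------------
-- Scalars

-- The library has no real numbers. Everything below is over an arbitrary
-- totally ordered field; ℝ with its usual (classical) order is an
-- instance, and so is ℚ. As usual for a total inverse, the value of
-- 0# ⁻¹ is unspecified.
record OrderedField (c ℓ₁ ℓ₂ : Level) : Set (lsuc (c ⊔ ℓ₁ ⊔ ℓ₂)) where
  field
    commutativeRing : CommutativeRing c ℓ₁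
  open CommutativeRing commutativeRing public
  infix 4 _<_ _≤_
  infix 8 _⁻¹
  field
    _<_                : Rel Carrier ℓ₂
    isStrictTotalOrder : IsStrictTotalOrder _≈_ _<_
    +-monoˡ-<          : ∀ z {x y} → x < y → x + z < y + z
    *-positive         : ∀ {x y} → 0# < x → 0# < y → 0# < x * y
    0≉1                : ¬ 0# ≈ 1#
    _⁻¹                : Carrier → Carrier
    ⁻¹-inverseʳ        : ∀ {x} → ¬ x ≈ 0# → x * x ⁻¹ ≈ 1#
  open IsStrictTotalOrder isStrictTotalOrder public
    using (compare; _<?_; _≟_)

  _≤_ : Rel Carrier (ℓ₁ ⊔ ℓ₂)
  x ≤ y = x < y ⊎ x ≈ y

  ∣_∣ : Carrier → Carrier
  ∣ x ∣ = if ⌊ x <? 0# ⌋ then - x else x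

------------------------------------------------------------------------
-- Unordered pairs of distinct positions of a list

pairs : ∀ {a} {A : Set a} → List A → List (A × A)
pairs []       = []
pairs (x ∷ xs) = map (x ,_) xs ++ pairs xs

------------------------------------------------------------------------
-- Simple graphs on Fin n

-- S ∷ G adds to G (whose nodes are renumbered by suc) a new node zero
-- with set of neighbours S. Every simple graph on Fin n arises exactly
-- once.
data Graph : ℕ → Set where
  []  : Graph 0
  _∷_ : ∀ {n} → Subset n → Graph n → Graph (suc n)

adj : ∀ {n} → Graph n → Fin n → Fin n → Bool
adj (S ∷ G) zero    zero    = false
adj (S ∷ G) zero    (suc j) = Vec.lookup S j
adj (S ∷ G) (suc i) zero    = Vec.lookup S i
adj (S ∷ G) (suc i) (suc j) = adj G i j

adj-irrefl : ∀ {n} (G : Graph n) i → adj G i i ≡ false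
adj-irrefl (S ∷ G) zero    = refl
adj-irrefl (S ∷ G) (suc i) = adj-irrefl G i

adj-sym : ∀ {n} (G : Graph n) i j → adj G i j ≡ adj G j i
adj-sym (S ∷ G) zero    zero    = refl
adj-sym (S ∷ G) zero    (suc j) = refl
adj-sym (S ∷ G) (suc i) zero    = refl
adj-sym (S ∷ G) (suc i) (suc j) = adj-sym G i j

allSubsets : ∀ n → List (Subset n)
allSubsets zero    = [] ∷ []
allSubsets (suc n) =
  cartesianProductWith _∷_ (inside ∷ outside ∷ []) (allSubsets n)

allGraphs : ∀ n → List (Graph n)
allGraphs zero    = [] ∷ []
allGraphs (suc n) = cartesianProductWith _∷_ (allSubsets n) (allGraphs n)

------------------------------------------------------------------------
-- Lattice points

LatticePoint : ℕ → Set
LatticePoint n = Vec ℤ n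

infixl 6 _-ᴸ_
_-ᴸ_ : ∀ {n} → LatticePoint n → LatticePoint n → LatticePoint n
_-ᴸ_ = Vec.zipWith ℤ._-_

e : ∀ {n} → Fin n → LatticePoint n
e i = Vec.tabulate λ k → if ⌊ i Fin.≟ k ⌋ then + 1 else + 0

-- The points ±(e i - e j) with {i , j} an arc of G: both signs occur,
-- since (i , j) ranges over ordered pairs of adjacent nodes.
generators : ∀ {n} → Graph n → List (LatticePoint n)
generators {n} G =
  concatMap (λ i → concatMap (λ j → if adj G i j then (e i -ᴸ e j) ∷ [] else [])
                             (allFin n))
            (allFin n)

-- Lattice simplices are given by the lists of their vertices.

standardSimplex : ∀ d → List (LatticePoint d)
standardSimplex d = Vec.replicate d (+ 0) ∷ map e (allFin d)

record IntegralAffineMap (d n : ℕ) : Set where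
  field
    translation : LatticePoint n
    columns     : Fin d → LatticePoint n

  open Algebra.Definitions.RawMonoid ℤ.+-0-rawMonoid using (sum)

  apply : LatticePoint d → LatticePoint n
  apply x = Vec.tabulate λ k →
    Vec.lookup translation k ℤ.+
    sum (λ i → Vec.lookup x i ℤ.* Vec.lookup (columns i) k)

------------------------------------------------------------------------
-- Edges of the simplicial complex generated by a list of simplices

SameEdge : ∀ {n} → Rel (LatticePoint n × LatticePoint n) _
SameEdge (u , v) (u′ , v′) = (u ≡ u′ × v ≡ v′) ⊎ (u ≡ v′ × v ≡ u′)

sameEdge? : ∀ {n} → Decidable (SameEdge {n})
sameEdge? (u , v) (u′ , v′) =
  ((u ≟ᴸ u′) ×-dec (v ≟ᴸ v′)) ⊎-dec ((u ≟ᴸ v′) ×-dec (v ≟ᴸ u′))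
  where _≟ᴸ_ = ≡-dec ℤ._≟_

edges : ∀ {n} → List (List (LatticePoint n)) → List (LatticePoint n × LatticePoint n)
edges σs = deduplicate sameEdge? (concatMap pairs σs)

------------------------------------------------------------------------

module Over {c ℓ₁ ℓ₂} (F : OrderedField c ℓ₁ ℓ₂) where
  open OrderedField F
  open Algebra.Definitions.RawSemiring (Semiring.rawSemiring semiring) public
    using (_^_; sum) renaming (_×_ to _·_)

  fromℕ : ℕ → Carrier
  fromℕ m = m · 1#

  fromℤ : ℤ → Carrier
  fromℤ (+ m)    = fromℕ m
  fromℤ -[1+ m ] = - fromℕ (suc m)

  ----------------------------------------------------------------------
  -- Polytopes and triangulations

  Point : ℕ → Set c
  Point n = Fin n → Carrier

  infix 4 _≈ᴾ_
  _≈ᴾ_ : ∀ {n} → Rel (Point n) ℓ₁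
  x ≈ᴾ y = ∀ k → x k ≈ y k

  ι : ∀ {n} → LatticePoint n → Point n
  ι v k = fromℤ (Vec.lookup v k)

  vertices : ∀ {n} (vs : List (LatticePoint n)) → Vector (Point n) (length vs)
  vertices vs i = ι (List.lookup vs i)

  combination : ∀ {m n} → Vector Carrier m → Vector (Point n) m → Point n
  combination w v k = sum (λ i → w i * v i k)

  -- The convex hull of no points is empty, since 0# ≉ 1#.
  Conv : ∀ {n} → List (LatticePoint n) → Pred (Point n) (c ⊔ ℓ₁ ⊔ ℓ₂)
  Conv vs x = ∃[ w ] (∀ i → 0# ≤ w i) × sum w ≈ 1# × combination w (vertices vs) ≈ᴾ x

  Aff : ∀ {n ℓ} → Pred (Point n) ℓ → Pred (Point n) (c ⊔ ℓ₁ ⊔ ℓ)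
  Aff {n} P x = ∃[ m ] Σ (Vector (Point n) m) λ v → ∃[ w ]
    (∀ i → P (v i)) × sum w ≈ 1# × combination w v ≈ᴾ x

  AffinelyIndependent : ∀ {m n} → Vector (Point n) m → Set (c ⊔ ℓ₁)
  AffinelyIndependent v = ∀ w → sum w ≈ 0# → combination w v ≈ᴾ (λ _ → 0#) →
                          ∀ i → w i ≈ 0#

  record HasDimension {n ℓ} (P : Pred (Point n) ℓ) (d : ℕ) : Set (c ⊔ ℓ₁ ⊔ ℓ) where
    field
      attained : Σ (Vector (Point n) (suc d)) λ v → (∀ i → P (v i)) × AffinelyIndependent v
      maximal  : ∀ {m} (v : Vector (Point n) m) → (∀ i → P (v i)) →
                 AffinelyIndependent v → m ℕ.≤ suc d

  record IsTriangulation {n ℓ} (P : Pred (Point n) ℓ) (d : ℕ)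
                         (cells : List (List (LatticePoint n)))
                         : Set (c ⊔ ℓ₁ ⊔ ℓ₂ ⊔ ℓ) where
    field
      dimension   : HasDimension P d
      size        : ∀ {σ} → σ ∈ cells → length σ ≡ suc d
      independent : ∀ {σ} → σ ∈ cells → AffinelyIndependent (vertices σ)
      union       : ∀ x → P x ⇔ (∃[ σ ] σ ∈ cells × Conv σ x)
      meet        : ∀ {σ τ} → σ ∈ cells → τ ∈ cells →
                    ∃[ ρ ] ρ ⊆ σ × ρ ⊆ τ × (∀ x → (Conv σ x × Conv τ x) ⇔ Conv ρ x)

  -- σ is the image of the standard d-simplex under an affine isomorphism
  -- of the lattice ℤᵈ onto the lattice ℤⁿ ∩ aff P.
  record IsUnimodular {n ℓ} (P : Pred (Point n) ℓ) (d : ℕ)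
                      (σ : List (LatticePoint n)) : Set (c ⊔ ℓ₁ ⊔ ℓ) where
    field
      φ : IntegralAffineMap d n
    open IntegralAffineMap φ
    field
      into       : ∀ x → Aff P (ι (apply x))
      injective  : ∀ {x y} → apply x ≡ apply y → x ≡ y
      surjective : ∀ y → Aff P (ι y) → ∃[ x ] apply x ≡ y
      image      : map apply (standardSimplex d) ↭ σ

  record UnimodularTriangulation {n ℓ} (P : Pred (Point n) ℓ)
                                 : Set (c ⊔ ℓ₁ ⊔ ℓ₂ ⊔ ℓ) where
    field
      dim             : ℕ
      cells           : List (List (LatticePoint n))
      isTriangulation : IsTriangulation P dim cells
      isUnimodular    : ∀ {σ} → σ ∈ cells → IsUnimodular P dim σ

    numberOfEdges : ℕ
    numberOfEdges = length (edges cells)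

  SymmetricEdgePolytope : ∀ {n} → Graph n → Pred (Point n) (c ⊔ ℓ₁ ⊔ ℓ₂)
  SymmetricEdgePolytope G = Conv (generators G)

  -- k is the number of edges of some unimodular triangulation of the
  -- symmetric edge polytope of G, or k is 0 if G has no arcs. (In the
  -- latter case the polytope is empty, so it has no dimension d : ℕ and
  -- the second constructor does not apply.)
  data EdgeNumber {n} (G : Graph n) : ℕ → Set (c ⊔ ℓ₁ ⊔ ℓ₂) where
    arcless      : (∀ i j → ¬ T (adj G i j)) → EdgeNumber G 0
    triangulated : (Δ : UnimodularTriangulation (SymmetricEdgePolytope G)) →
                   EdgeNumber G (UnimodularTriangulation.numberOfEdges Δ)

  ----------------------------------------------------------------------
  -- Erdős–Rényi random graphs

  sumOver productOver : ∀ {a} {A : Set a} → List A → (A → Carrier) → Carrier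
  sumOver     xs f = List.foldr (λ x s → f x + s) 0# xs
  productOver xs f = List.foldr (λ x s → f x * s) 1# xs

  probability : ∀ n → Carrier → Graph n → Carrier
  probability n p G =
    productOver (pairs (allFin n)) λ (i , j) → if adj G i j then p else 1# - p

  𝔼 : ∀ n → Carrier → (Graph n → ℕ) → Carrier
  𝔼 n p X = sumOver (allGraphs n) λ G → probability n p G * fromℕ (X G)

  ----------------------------------------------------------------------
  -- Asymptotics

  -- 0 < sup_N inf_{n ≥ N} x n and inf_N sup_{n ≥ N} x n < ∞, with the
  -- suprema and infima spelled out, as they need not exist in the field.

  0<liminf : (ℕ → Carrier) → Set (c ⊔ ℓ₁ ⊔ ℓ₂)
  0<liminf x = ∃[ b ] 0# < b × (∃[ N ] ∀ n → N ℕ.≤ n → b ≤ x n)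

  limsup<∞ : (ℕ → Carrier) → Set (c ⊔ ℓ₁ ⊔ ℓ₂)
  limsup<∞ x = ∃[ b ] ∃[ N ] ∀ n → N ℕ.≤ n → x n ≤ b

  infix 4 _≃_
  _≃_ : Rel (ℕ → Carrier) (c ⊔ ℓ₁ ⊔ ℓ₂)
  a ≃ b = (∃[ N ] ∀ n → N ℕ.≤ n → ¬ b n ≈ 0#) × 0<liminf ratio × limsup<∞ ratio
    where
    ratio : ℕ → Carrier
    ratio n = ∣ a n * b n ⁻¹ ∣

{-# OPTIONS --safe #-}

-- Let A consist of 0 and the points ±(eᵢ - eⱼ) with {i , j} an arc; these are the
-- lattice points of the polytope. If a, b ∈ A, then (a + b) / 2 lies in a cell σ of
-- a unimodular triangulation, and in the integral barycentric coordinates of σ the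
-- point a + b has nonnegative coordinates with sum 2, so a + b = v + w for vertices
-- v, w of σ. Conversely, since cells meet in common faces, v + w determines the pair
-- {v , w}. Hence edges correspond to the points of A + A that are not in 2A, whatever
-- the triangulation. These points are
--   eᵢ - eⱼ               (ij is an arc, or i and j have a common neighbour),
--   ±(2eᵢ - eⱼ - eₖ)      (ij and ik are arcs),
--   eₛ + eᵤ - eₜ - e_w    (st and uw are arcs, or sw and ut are arcs),
-- for distinct indices, and the expectation is the sum of their probabilities.

module Submission where

open import Defs
open import Algebra.Bundles using (CommutativeRing; RawRing)
import Algebra.Definitions.RawMonoid
import Algebra.Properties.AbelianGroup
import Algebra.Properties.Ring
import Algebra.Properties.Semiring.Mult
import Algebra.Properties.Semiring.Sum
import Algebra.Solver.Ring
open import Algebra.Solver.Ring.AlmostCommutativeRing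
  using (fromCommutativeRing; _-Raw-AlmostCommutative⟶_)
open import Data.Bool.Base using (Bool; true; false; if_then_else_; T; _∧_; _∨_)
open import Data.Bool.ListAction using (any)
import Data.Bool.Properties as Bool
open import Data.Empty using (⊥)
open import Data.Fin.Base as Fin using (Fin; zero; suc)
import Data.Fin.Properties as Fin
open import Data.Fin.Subset using (Subset; inside; outside)
open import Data.Integer.Base as ℤ using (ℤ; +_; -[1+_])
import Data.Integer.Properties as ℤ
open import Data.Integer.Solver using (module +-*-Solver)
open import Data.List.Base as List
  using (List; []; _∷_; _++_; map; length; allFin; replicate; concatMap; filter;
         deduplicate; cartesianProductWith)
import Data.List.Membership.DecPropositional as DecMembership
open import Data.List.Membership.Propositional using (_∈_; _∉_; lose; find)
open import Data.List.Membership.Propositional.Properties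
  using (∈-lookup; ∈-map⁺; ∈-allFin; ∈-map⁻; ∈-++⁺ˡ; ∈-++⁺ʳ; ∈-++⁻; ∈-filter⁺;
         ∈-filter⁻; ∈-concatMap⁺; ∈-concatMap⁻; ∈-deduplicate⁻; ∈-AllPairs₂)
open import Data.List.Membership.Propositional.Properties.WithK using (unique∧set⇒bag)
import Data.List.Properties as List
open import Data.List.Relation.Binary.BagAndSetEquality using (∼bag⇒↭)
open import Data.List.Relation.Binary.Permutation.Propositional.Properties
  using (∈-resp-↭; ↭-length)
open import Data.List.Relation.Binary.Subset.Propositional using (_⊆_)
open import Data.List.Relation.Unary.All as All using ([]; _∷_)
import Data.List.Relation.Unary.All.Properties as All
open import Data.List.Relation.Unary.AllPairs as AllPairs using (AllPairs; []; _∷_)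
import Data.List.Relation.Unary.AllPairs.Properties as AllPairs
open import Data.List.Relation.Unary.Any as Any using (here; there; Any)
open import Data.List.Relation.Unary.Any.Properties as Any using (lookup-index)
open import Data.List.Relation.Unary.Unique.Propositional using (Unique)
import Data.List.Relation.Unary.Unique.Propositional.Properties as Unique
open import Data.Maybe.Base using (Maybe; just; nothing)
open import Data.Nat using (_∸_; ℕ)
open import Data.Nat.Base as ℕ using (ℕ; zero; suc)
open import Data.Nat.Combinatorics using (_C_; nCk+nC[k+1]≡[n+1]C[k+1]; nC1≡n)
import Data.Nat.Properties as ℕ
open import Data.Nat.Tactic.RingSolver using (solve-∀)
open import Data.Product using (_×_)
open import Data.Product.Base using (∃-syntax; _,_; proj₁; proj₂)
open import Data.Sum.Base using (_⊎_; inj₁; inj₂)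
open import Data.Vec.Base as Vec using (Vec; []; _∷_; _[_]≔_)
import Data.Vec.Properties as Vec
open import Function.Base using (_∘_; id; case_of_)
open import Function.Bundles using (module Equivalence; mk⇔)
open import Relation.Binary.Definitions as B using (DecidableEquality; tri<; tri≈; tri>)
open import Relation.Binary.PropositionalEquality as ≡ using (_≡_; _≢_)
import Relation.Binary.Reasoning.Setoid
open import Relation.Binary.Structures using (IsStrictTotalOrder)
open import Relation.Nullary using (¬_; yes; no; contradiction)
open import Relation.Nullary.Decidable using (⌊_⌋; ¬?; T?)
open import Relation.Unary using (Pred)

-- Ordered fields

-- Two kinds of coordinates meet through affine independence. Unimodularity gives a and b integral
-- coordinates in σ, possibly negative, since neither point need lie in σ; membership in the cell
-- gives their midpoint nonnegative ones. Coordinates of a point are unique, so half the sum of the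
-- former is the latter. A nonzero double is recognised by its signs, but the sum 0 needs its own
-- argument: the origin is a vertex of some cell, so 0 = 0 + 0 competes with v + w, and no edge
-- joins opposite points. The other sums get a normal form that their signs determine. The resulting
-- list of candidates depends on n alone and the graph only selects from it, which makes the
-- expectation linear over a fixed list. In the asymptotic statement n² p is bounded away from 0.
-- The last term of the expectation has order n² p, and where n² p tends to 0 along a subsequence it
-- outgrows every multiple of n⁴ p².

module OrderedFieldProperties {c ℓ₁ ℓ₂} (F : OrderedField c ℓ₁ ℓ₂) where
  open OrderedField F hiding (zero)
  open Over F
  open Algebra.Properties.Ring ring
    using (-‿involutive; -‿distribˡ-*; -0#≈0#; -‿+-comm)
  open Algebra.Properties.Semiring.Mult semiring
    using (×-homo-+; ×1-homo-*; ×-homo-1)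
  private
    module S = IsStrictTotalOrder isStrictTotalOrder
    module ≈-Reasoning = Relation.Binary.Reasoning.Setoid setoid

  fromℤ-⊖ : ∀ m n → fromℤ (m ℤ.⊖ n) ≈ fromℕ m - fromℕ n
  fromℤ-⊖ m zero = sym (trans (+-congˡ -0#≈0#) (+-identityʳ _))
  fromℤ-⊖ zero (suc n) = sym (+-identityˡ _)
  fromℤ-⊖ (suc m) (suc n) = begin
    fromℤ (suc m ℤ.⊖ suc n)                 ≡⟨ ≡.cong fromℤ (ℤ.[1+m]⊖[1+n]≡m⊖n m n) ⟩
    fromℤ (m ℤ.⊖ n)                         ≈⟨ fromℤ-⊖ m n ⟩
    fromℕ m - fromℕ n                       ≈⟨ +-congʳ (+-identityʳ _) ⟨
    fromℕ m + 0# - fromℕ n                  ≈⟨ +-congʳ (+-congˡ (-‿inverseʳ 1#)) ⟨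
    fromℕ m + (1# - 1#) - fromℕ n           ≈⟨ +-congʳ (+-assoc _ _ _) ⟨
    fromℕ m + 1# - 1# - fromℕ n             ≈⟨ +-assoc _ _ _ ⟩
    fromℕ m + 1# + (- 1# - fromℕ n)         ≈⟨ +-cong (+-comm _ _) (-‿+-comm _ _) ⟩
    fromℕ (suc m) - fromℕ (suc n)           ∎
    where open ≈-Reasoning

  fromℤ-neg : ∀ i → fromℤ (ℤ.- i) ≈ - fromℤ i
  fromℤ-neg (+ zero)  = sym -0#≈0#
  fromℤ-neg (+ suc n) = refl
  fromℤ-neg -[1+ n ]  = sym (-‿involutive _)

  fromℤ-+ : ∀ i j → fromℤ (i ℤ.+ j) ≈ fromℤ i + fromℤ j
  fromℤ-+ (+ m) (+ n) = ×-homo-+ 1# m n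
  fromℤ-+ (+ m) -[1+ n ] = fromℤ-⊖ m (suc n)
  fromℤ-+ -[1+ m ] (+ n) = trans (fromℤ-⊖ n (suc m)) (+-comm _ _)
  fromℤ-+ -[1+ m ] -[1+ n ] = begin
    - fromℕ (suc (suc (m ℕ.+ n)))         ≡⟨ ≡.cong (λ k → - fromℕ (suc k)) (ℕ.+-suc m n) ⟨
    - fromℕ (suc m ℕ.+ suc n)             ≈⟨ -‿cong (×-homo-+ 1# (suc m) (suc n)) ⟩
    - (fromℕ (suc m) + fromℕ (suc n))     ≈⟨ -‿+-comm _ _ ⟨
    - fromℕ (suc m) - fromℕ (suc n)       ∎
    where open ≈-Reasoning

  fromℤ-- : ∀ i j → fromℤ (i ℤ.- j) ≈ fromℤ i - fromℤ j
  fromℤ-- i j = trans (fromℤ-+ i (ℤ.- j)) (+-congˡ (fromℤ-neg j))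

  private
    fromℤ-+* : ∀ m i → fromℤ (+ m ℤ.* i) ≈ fromℕ m * fromℤ i
    fromℤ-+* zero i = sym (zeroˡ _)
    fromℤ-+* (suc m) i = begin
      fromℤ (+ suc m ℤ.* i)               ≡⟨ ≡.cong fromℤ (ℤ.suc-* (+ m) i) ⟩
      fromℤ (i ℤ.+ + m ℤ.* i)             ≈⟨ fromℤ-+ i _ ⟩
      fromℤ i + fromℤ (+ m ℤ.* i)         ≈⟨ +-cong (sym (*-identityˡ _)) (fromℤ-+* m i) ⟩
      1# * fromℤ i + fromℕ m * fromℤ i    ≈⟨ distribʳ _ _ _ ⟨
      fromℕ (suc m) * fromℤ i             ∎
      where open ≈-Reasoning

  fromℤ-* : ∀ i j → fromℤ (i ℤ.* j) ≈ fromℤ i * fromℤ j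
  fromℤ-* (+ m) j = fromℤ-+* m j
  fromℤ-* -[1+ m ] j = begin
    fromℤ (-[1+ m ] ℤ.* j)              ≡⟨ ≡.cong fromℤ (ℤ.neg-distribˡ-* (+ suc m) j) ⟨
    fromℤ (ℤ.- (+ suc m ℤ.* j))         ≈⟨ fromℤ-neg (+ suc m ℤ.* j) ⟩
    - fromℤ (+ suc m ℤ.* j)             ≈⟨ -‿cong (fromℤ-+* (suc m) j) ⟩
    - (fromℕ (suc m) * fromℤ j)         ≈⟨ -‿distribˡ-* _ _ ⟩
    - fromℕ (suc m) * fromℤ j           ∎
    where open ≈-Reasoning

  -- fromℤ, except that 1 is sent to 1# on the nose, so that the solver
  -- recognises both 1# and numerals.
  coefficient : ℤ → Carrier
  coefficient (+ 1) = 1#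
  coefficient i     = fromℤ i

  coefficient≈fromℤ : ∀ i → coefficient i ≈ fromℤ i
  coefficient≈fromℤ (+ 0)           = refl
  coefficient≈fromℤ (+ 1)           = sym (+-identityʳ 1#)
  coefficient≈fromℤ (+ suc (suc n)) = refl
  coefficient≈fromℤ -[1+ n ]        = refl

  private
    ℤ-rawRing : RawRing _ _
    ℤ-rawRing = CommutativeRing.rawRing ℤ.+-*-commutativeRing

    homomorphism : ℤ-rawRing -Raw-AlmostCommutative⟶ fromCommutativeRing commutativeRing
    homomorphism = record
      { ⟦_⟧    = coefficient
      ; +-homo = λ i j → via (i ℤ.+ j) (trans (fromℤ-+ i j) (+-cong (via′ i) (via′ j)))
      ; *-homo = λ i j → via (i ℤ.* j) (trans (fromℤ-* i j) (*-cong (via′ i) (via′ j)))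
      ; -‿homo = λ i → via (ℤ.- i) (trans (fromℤ-neg i) (-‿cong (via′ i)))
      ; 0-homo = refl
      ; 1-homo = refl
      }
      where
      via : ∀ i {x} → fromℤ i ≈ x → coefficient i ≈ x
      via i = trans (coefficient≈fromℤ i)
      via′ : ∀ i → fromℤ i ≈ coefficient i
      via′ i = sym (coefficient≈fromℤ i)

    coefficient≟ : ∀ i j → Maybe (coefficient i ≈ coefficient j)
    coefficient≟ i j with i ℤ.≟ j
    ... | yes i≡j = just (reflexive (≡.cong coefficient i≡j))
    ... | no  _   = nothing

  module Solver =
    Algebra.Solver.Ring ℤ-rawRing (fromCommutativeRing commutativeRing) homomorphism coefficient≟

  open Solver

  -≈0⇒≈ : ∀ {x y} → x - y ≈ 0# → x ≈ y
  -≈0⇒≈ {x} {y} eq = trans (solve 2 (λ x y → x := x :- y :+ y) refl x y)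
    (trans (+-congʳ eq) (+-identityˡ y))

  +-monoʳ-< : ∀ z {x y} → x < y → z + x < z + y
  +-monoʳ-< z x<y = S.<-respʳ-≈ (+-comm _ z) (S.<-respˡ-≈ (+-comm _ z) (+-monoˡ-< z x<y))

  <⇒0<- : ∀ {x y} → x < y → 0# < y - x
  <⇒0<- {x} x<y = S.<-respˡ-≈ (-‿inverseʳ x) (+-monoˡ-< (- x) x<y)

  0<-⇒< : ∀ {x y} → 0# < y - x → x < y
  0<-⇒< {x} {y} 0<y-x =
    S.<-respʳ-≈ (solve 2 (λ x y → y :- x :+ x := y) refl x y)
      (S.<-respˡ-≈ (+-identityˡ x) (+-monoˡ-< x 0<y-x))

  ≤⇒0≤- : ∀ {x y} → x ≤ y → 0# ≤ y - x
  ≤⇒0≤- (inj₁ x<y) = inj₁ (<⇒0<- x<y)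
  ≤⇒0≤- {x} (inj₂ x≈y) = inj₂ (sym (trans (+-congʳ (sym x≈y)) (-‿inverseʳ x)))

  0≤-⇒≤ : ∀ {x y} → 0# ≤ y - x → x ≤ y
  0≤-⇒≤ (inj₁ lt) = inj₁ (0<-⇒< lt)
  0≤-⇒≤ (inj₂ eq) = inj₂ (sym (-≈0⇒≈ (sym eq)))

  ≤-respʳ : ∀ {x y z} → y ≈ z → x ≤ y → x ≤ z
  ≤-respʳ y≈z (inj₁ x<y) = inj₁ (S.<-respʳ-≈ y≈z x<y)
  ≤-respʳ y≈z (inj₂ x≈y) = inj₂ (trans x≈y y≈z)

  ≤-respˡ : ∀ {x y z} → x ≈ z → x ≤ y → z ≤ y
  ≤-respˡ x≈z (inj₁ x<y) = inj₁ (S.<-respˡ-≈ x≈z x<y)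
  ≤-respˡ x≈z (inj₂ x≈y) = inj₂ (trans (sym x≈z) x≈y)

  ≤-refl : ∀ {x} → x ≤ x
  ≤-refl = inj₂ refl

  ≤-trans : ∀ {x y z} → x ≤ y → y ≤ z → x ≤ z
  ≤-trans x≤y (inj₂ y≈z) = ≤-respʳ y≈z x≤y
  ≤-trans (inj₁ x<y) (inj₁ y<z) = inj₁ (S.trans x<y y<z)
  ≤-trans (inj₂ x≈y) y≤z = ≤-respˡ (sym x≈y) y≤z

  <-≤-trans : ∀ {x y z} → x < y → y ≤ z → x < z
  <-≤-trans x<y (inj₁ y<z) = S.trans x<y y<z
  <-≤-trans x<y (inj₂ y≈z) = S.<-respʳ-≈ y≈z x<y

  <⇒≱ : ∀ {x y} → x < y → ¬ y ≤ x
  <⇒≱ x<y y≤x = S.irrefl refl (<-≤-trans x<y y≤x)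

  ≮⇒≥ : ∀ {x y} → ¬ x < y → y ≤ x
  ≮⇒≥ {x} {y} x≮y with compare x y
  ... | tri< x<y _ _ = contradiction x<y x≮y
  ... | tri≈ _ x≈y _ = inj₂ (sym x≈y)
  ... | tri> _ _ y<x = inj₁ y<x

  +-monoˡ-≤ : ∀ z {x y} → x ≤ y → x + z ≤ y + z
  +-monoˡ-≤ z (inj₁ x<y) = inj₁ (+-monoˡ-< z x<y)
  +-monoˡ-≤ z (inj₂ x≈y) = inj₂ (+-congʳ x≈y)

  +-monoʳ-≤ : ∀ z {x y} → x ≤ y → z + x ≤ z + y
  +-monoʳ-≤ z (inj₁ x<y) = inj₁ (+-monoʳ-< z x<y)
  +-monoʳ-≤ z (inj₂ x≈y) = inj₂ (+-congˡ x≈y)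

  +-mono-≤ : ∀ {x y u v} → x ≤ y → u ≤ v → x + u ≤ y + v
  +-mono-≤ x≤y u≤v = ≤-trans (+-monoˡ-≤ _ x≤y) (+-monoʳ-≤ _ u≤v)

  +-nonneg : ∀ {x y} → 0# ≤ x → 0# ≤ y → 0# ≤ x + y
  +-nonneg 0≤x 0≤y = ≤-respˡ (+-identityˡ 0#) (+-mono-≤ 0≤x 0≤y)

  +-pos-nonneg : ∀ {x y} → 0# < x → 0# ≤ y → 0# < x + y
  +-pos-nonneg 0<x 0≤y = <-≤-trans 0<x (≤-respˡ (+-identityʳ _) (+-monoʳ-≤ _ 0≤y))

  +-nonneg-pos : ∀ {x y} → 0# ≤ x → 0# < y → 0# < x + y
  +-nonneg-pos 0≤x 0<y = S.<-respʳ-≈ (+-comm _ _) (+-pos-nonneg 0<y 0≤x)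

  *-nonneg : ∀ {x y} → 0# ≤ x → 0# ≤ y → 0# ≤ x * y
  *-nonneg (inj₁ 0<x) (inj₁ 0<y) = inj₁ (*-positive 0<x 0<y)
  *-nonneg (inj₁ 0<x) (inj₂ 0≈y) = inj₂ (sym (trans (*-congˡ (sym 0≈y)) (zeroʳ _)))
  *-nonneg (inj₂ 0≈x) _ = inj₂ (sym (trans (*-congʳ (sym 0≈x)) (zeroˡ _)))

  *-monoʳ-≤ : ∀ {z x y} → 0# ≤ z → x ≤ y → z * x ≤ z * y
  *-monoʳ-≤ {z} {x} {y} 0≤z x≤y = 0≤-⇒≤
    (≤-respʳ (solve 3 (λ z x y → z :* (y :- x) := z :* y :- z :* x) refl z x y)
      (*-nonneg 0≤z (≤⇒0≤- x≤y)))

  *-monoˡ-≤ : ∀ {z x y} → 0# ≤ z → x ≤ y → x * z ≤ y * z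
  *-monoˡ-≤ 0≤z x≤y = ≤-respˡ (*-comm _ _) (≤-respʳ (*-comm _ _) (*-monoʳ-≤ 0≤z x≤y))

  *-monoʳ-< : ∀ {z x y} → 0# < z → x < y → z * x < z * y
  *-monoʳ-< {z} {x} {y} 0<z x<y = 0<-⇒<
    (S.<-respʳ-≈ (solve 3 (λ z x y → z :* (y :- x) := z :* y :- z :* x) refl z x y)
      (*-positive 0<z (<⇒0<- x<y)))

  0<1 : 0# < 1#
  0<1 with compare 0# 1#
  ... | tri< 0<1 _ _ = 0<1
  ... | tri≈ _ 0≈1 _ = contradiction 0≈1 0≉1
  -- If 1 is negative, then 0 - 1 is positive and its square is 1.
  ... | tri> _ _ 1<0 = S.<-respʳ-≈
          (solve 0 ((con (+ 0) :- con (+ 1)) :* (con (+ 0) :- con (+ 1)) := con (+ 1)) refl)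
          (*-positive (<⇒0<- 1<0) (<⇒0<- 1<0))

  fromℕ-nonneg : ∀ m → 0# ≤ fromℕ m
  fromℕ-nonneg zero    = ≤-refl
  fromℕ-nonneg (suc m) = +-nonneg (inj₁ 0<1) (fromℕ-nonneg m)

  fromℕ-positive : ∀ m → 0# < fromℕ (suc m)
  fromℕ-positive m = +-pos-nonneg 0<1 (fromℕ-nonneg m)

  fromℕ-* : ∀ m n → fromℕ (m ℕ.* n) ≈ fromℕ m * fromℕ n
  fromℕ-* = ×1-homo-*

  fromℕ-^ : ∀ m k → fromℕ (m ℕ.^ k) ≈ fromℕ m ^ k
  fromℕ-^ m zero    = ×-homo-1 1#
  fromℕ-^ m (suc k) = trans (fromℕ-* m (m ℕ.^ k)) (*-congˡ (fromℕ-^ m k))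

  fromℕ-mono-≤ : ∀ {m n} → m ℕ.≤ n → fromℕ m ≤ fromℕ n
  fromℕ-mono-≤ {n = n} ℕ.z≤n = fromℕ-nonneg n
  fromℕ-mono-≤ (ℕ.s≤s m≤n)   = +-monoʳ-≤ 1# (fromℕ-mono-≤ m≤n)

  fromℤ-negative : ∀ m → fromℤ -[1+ m ] < 0#
  fromℤ-negative m = 0<-⇒< (S.<-respʳ-≈
    (solve 1 (λ x → x := con (+ 0) :- (:- x)) refl (fromℕ (suc m))) (fromℕ-positive m))

  -- Characteristic zero: a nonzero integer keeps its sign in the field. Hence identities between
  -- lattice points can be verified on their images.
  fromℤ-≈0 : ∀ i → fromℤ i ≈ 0# → i ≡ + 0
  fromℤ-≈0 (+ zero)  _  = ≡.refl
  fromℤ-≈0 (+ suc n) eq = contradiction (fromℕ-positive n) (S.irrefl (sym eq))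
  fromℤ-≈0 -[1+ n ]  eq = contradiction (fromℤ-negative n) (S.irrefl eq)

  fromℤ-injective : ∀ {i j} → fromℤ i ≈ fromℤ j → i ≡ j
  fromℤ-injective {i} {j} eq = ℤ.i-j≡0⇒i≡j i j (fromℤ-≈0 (i ℤ.- j)
    (trans (fromℤ-- i j) (trans (+-congʳ eq) (-‿inverseʳ _))))

  ⁻¹-positive : ∀ {x} → 0# < x → 0# < x ⁻¹
  ⁻¹-positive {x} 0<x with compare 0# (x ⁻¹)
  ... | tri< lt _ _ = lt
  ... | tri≈ _ eq _ = contradiction
          (trans (sym (trans (*-congˡ (sym eq)) (zeroʳ x))) (⁻¹-inverseʳ (S.irrefl refl ∘ λ x≈0 → S.<-respʳ-≈ x≈0 0<x)))
          0≉1
  ... | tri> _ _ gt = contradiction (S.trans 0<1 (S.<-respˡ-≈ (⁻¹-inverseʳ x≉0)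
          (S.<-respʳ-≈ (zeroʳ x) (*-monoʳ-< 0<x gt)))) (S.irrefl refl)
    where
    x≉0 : ¬ x ≈ 0#
    x≉0 x≈0 = S.irrefl refl (S.<-respʳ-≈ x≈0 0<x)

-- Finite sums

module Sums {c ℓ₁ ℓ₂} (F : OrderedField c ℓ₁ ℓ₂) where
  open OrderedField F hiding (zero)
  open Over F
  open OrderedFieldProperties F
  open Solver
  open Algebra.Properties.Semiring.Sum semiring
    using (sum-cong-≋; *-distribˡ-sum)
  private
    module ≈-Reasoning = Relation.Binary.Reasoning.Setoid setoid

  module _ {a} {A : Set a} where

    sumOver-cong : ∀ xs {f g : A → Carrier} → (∀ {x} → x ∈ xs → f x ≈ g x) →
                   sumOver xs f ≈ sumOver xs g
    sumOver-cong []       f≈g = refl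
    sumOver-cong (x ∷ xs) f≈g = +-cong (f≈g (here ≡.refl)) (sumOver-cong xs (f≈g ∘ there))

    sumOver-+ : ∀ xs (f g : A → Carrier) →
                sumOver xs (λ x → f x + g x) ≈ sumOver xs f + sumOver xs g
    sumOver-+ [] f g = sym (+-identityˡ 0#)
    sumOver-+ (x ∷ xs) f g = trans (+-congˡ (sumOver-+ xs f g))
      (solve 4 (λ a b c d → a :+ b :+ (c :+ d) := a :+ c :+ (b :+ d)) refl _ _ _ _)

    sumOver-*ˡ : ∀ xs z (f : A → Carrier) → sumOver xs (λ x → z * f x) ≈ z * sumOver xs f
    sumOver-*ˡ [] z f = sym (zeroʳ z)
    sumOver-*ˡ (x ∷ xs) z f = trans (+-congˡ (sumOver-*ˡ xs z f)) (sym (distribˡ z _ _))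

    sumOver-0 : ∀ xs {f : A → Carrier} → (∀ {x} → x ∈ xs → f x ≈ 0#) → sumOver xs f ≈ 0#
    sumOver-0 []       f≈0 = refl
    sumOver-0 (x ∷ xs) f≈0 =
      trans (+-cong (f≈0 (here ≡.refl)) (sumOver-0 xs (f≈0 ∘ there))) (+-identityˡ 0#)

    sumOver-++ : ∀ xs ys (f : A → Carrier) →
                 sumOver (xs ++ ys) f ≈ sumOver xs f + sumOver ys f
    sumOver-++ [] ys f = sym (+-identityˡ _)
    sumOver-++ (x ∷ xs) ys f = trans (+-congˡ (sumOver-++ xs ys f)) (sym (+-assoc _ _ _))

    sumOver-const : ∀ xs {f : A → Carrier} {z} → (∀ {x} → x ∈ xs → f x ≈ z) →
                    sumOver xs f ≈ fromℕ (length xs) * z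
    sumOver-const [] f≈z = sym (zeroˡ _)
    sumOver-const (x ∷ xs) {f} {z} f≈z = begin
      f x + sumOver xs f              ≈⟨ +-cong (f≈z (here ≡.refl)) (sumOver-const xs (f≈z ∘ there)) ⟩
      z + fromℕ (length xs) * z       ≈⟨ solve 2 (λ z l → z :+ l :* z := (con (+ 1) :+ l) :* z) refl z _ ⟩
      fromℕ (suc (length xs)) * z     ∎
      where open ≈-Reasoning

    sum-lookup : ∀ xs (f : A → Carrier) → sum (λ i → f (List.lookup xs i)) ≡ sumOver xs f
    sum-lookup []       f = ≡.refl
    sum-lookup (x ∷ xs) f = ≡.cong (_+_ (f x)) (sum-lookup xs f)

  sumOver-comm : ∀ {a b} {A : Set a} {B : Set b} xs ys (f : A → B → Carrier) →
    sumOver xs (λ x → sumOver ys (f x)) ≈ sumOver ys (λ y → sumOver xs (λ x → f x y))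
  sumOver-comm [] ys f = sym (sumOver-0 ys (λ _ → refl))
  sumOver-comm (x ∷ xs) ys f =
    trans (+-congˡ (sumOver-comm xs ys f)) (sym (sumOver-+ ys (f x) _))

  sumOver-map : ∀ {a b} {A : Set a} {B : Set b} (g : A → B) xs (f : B → Carrier) →
                sumOver (map g xs) f ≡ sumOver xs (f ∘ g)
  sumOver-map g []       f = ≡.refl
  sumOver-map g (x ∷ xs) f = ≡.cong (_+_ (f (g x))) (sumOver-map g xs f)

  fromℤ-sum : ∀ {m} (x : Fin m → ℤ) →
              fromℤ (Algebra.Definitions.RawMonoid.sum ℤ.+-0-rawMonoid x) ≈ sum (fromℤ ∘ x)
  fromℤ-sum {zero}  x = refl
  fromℤ-sum {suc m} x = trans (fromℤ-+ (x zero) _) (+-congˡ (fromℤ-sum (x ∘ suc)))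

  -- The delta is the image of an integer because the coordinates of `e i` have this form. The same
  -- family also serves as the weights concentrated on a single position.
  sum-δ : ∀ {m} (i : Fin m) (f : Fin m → Carrier) →
          sum (λ j → fromℤ (if ⌊ i Fin.≟ j ⌋ then + 1 else + 0) * f j) ≈ f i
  sum-δ zero f = begin
    fromℤ (+ 1) * f zero + sum (λ j → 0# * f (suc j))
      ≈⟨ +-congˡ (*-distribˡ-sum 0# (f ∘ suc)) ⟨
    fromℤ (+ 1) * f zero + 0# * sum (λ j → f (suc j))
      ≈⟨ solve 2 (λ x y → (con (+ 1) :+ con (+ 0)) :* x :+ con (+ 0) :* y := x) refl _ _ ⟩
    f zero ∎
    where open ≈-Reasoning
  sum-δ (suc i) f = begin
    0# * f zero + sum (λ j → fromℤ (if ⌊ suc i Fin.≟ suc j ⌋ then + 1 else + 0) * f (suc j))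
      ≈⟨ +-cong (zeroˡ _) (sum-cong-≋ (λ j → *-congʳ (reflexive (≡.cong fromℤ (≡.cong (λ b → if b then + 1 else + 0) (shift j)))))) ⟩
    0# + sum (λ j → fromℤ (if ⌊ i Fin.≟ j ⌋ then + 1 else + 0) * f (suc j))
      ≈⟨ trans (+-identityˡ _) (sum-δ i (f ∘ suc)) ⟩
    f (suc i) ∎
    where
    open ≈-Reasoning
    shift : ∀ j → ⌊ suc i Fin.≟ suc j ⌋ ≡ ⌊ i Fin.≟ j ⌋
    shift j with i Fin.≟ j
    ... | yes _ = ≡.refl
    ... | no  _ = ≡.refl

  Integral : Carrier → Set ℓ₁
  Integral x = ∃[ i ] x ≈ fromℤ i

  Integral-+ : ∀ {x y} → Integral x → Integral y → Integral (x + y)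
  Integral-+ (i , x≈i) (j , y≈j) = i ℤ.+ j , trans (+-cong x≈i y≈j) (sym (fromℤ-+ i j))

  Integral-- : ∀ {x y} → Integral x → Integral y → Integral (x - y)
  Integral-- (i , x≈i) (j , y≈j) = i ℤ.- j , trans (+-cong x≈i (-‿cong y≈j)) (sym (fromℤ-- i j))

  Integral-sum : ∀ {m} (w : Fin m → Carrier) → (∀ i → Integral (w i)) → Integral (sum w)
  Integral-sum {zero}  w int = + 0 , refl
  Integral-sum {suc m} w int = Integral-+ (int zero) (Integral-sum (w ∘ suc) (int ∘ suc))

  nonneg-Integral : ∀ {x} → 0# ≤ x → Integral x → ∃[ m ] x ≈ fromℕ m
  nonneg-Integral 0≤x (+ m , x≈m) = m , x≈m
  nonneg-Integral 0≤x (-[1+ m ] , x≈m) =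
    contradiction (≤-respʳ x≈m 0≤x) (<⇒≱ (fromℤ-negative m))

  -- Each x is repeated as often as its weight says. One list `ys` works for all f at once: constant
  -- f gives its length, coordinate functions give the sum of its points.
  natural-weights : ∀ {a} {A : Set a} (ω : A → Carrier) xs →
    (∀ {x} → x ∈ xs → ∃[ m ] ω x ≈ fromℕ m) →
    ∃[ ys ] ys ⊆ xs × (∀ f → sumOver xs (λ x → ω x * f x) ≈ sumOver ys f)
  natural-weights ω [] nat = [] , id , λ _ → refl
  natural-weights {A = A} ω (x ∷ xs) nat
    with natural-weights ω xs (nat ∘ there) | nat (here ≡.refl)
  ... | ys , ys⊆xs , eq | m , ωx≈m = replicate m x ++ ys , sub m , λ f →
    trans (+-cong (*-congʳ ωx≈m) (eq f)) (sym (trans (sumOver-++ (replicate m x) ys f) (+-congʳ (rep m f))))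
    where
    sub : ∀ m → replicate m x ++ ys ⊆ x ∷ xs
    sub zero    p           = there (ys⊆xs p)
    sub (suc m) (here eq)   = here eq
    sub (suc m) (there p)   = sub m p
    rep : ∀ m (f : A → Carrier) → sumOver (replicate m x) f ≈ fromℕ m * f x
    rep zero    f = sym (zeroˡ _)
    rep (suc m) f = trans (+-congˡ (rep m f))
      (solve 2 (λ z l → z :+ l :* z := (con (+ 1) :+ l) :* z) refl (f x) (fromℕ m))

  module Weights {a} {A : Set a} (_≟ᴬ_ : DecidableEquality A) where

    δ : A → A → Carrier
    δ y x = if ⌊ x ≟ᴬ y ⌋ then 1# else 0#

    δ-diag : ∀ x → δ x x ≡ 1#
    δ-diag x with x ≟ᴬ x
    ... | yes _   = ≡.refl
    ... | no x≢x = contradiction ≡.refl x≢x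

    δ-off : ∀ {x y} → x ≢ y → δ y x ≡ 0#
    δ-off {x} {y} x≢y with x ≟ᴬ y
    ... | yes x≡y = contradiction x≡y x≢y
    ... | no _    = ≡.refl

    δ-nonneg : ∀ y x → 0# ≤ δ y x
    δ-nonneg y x with x ≟ᴬ y
    ... | yes _ = inj₁ 0<1
    ... | no _  = ≤-refl

    sumOver-δ : ∀ {xs y} (f : A → Carrier) → Unique xs → y ∈ xs →
                sumOver xs (λ x → δ y x * f x) ≈ f y
    sumOver-δ {x ∷ xs} f (x∉ ∷ _) (here ≡.refl) = trans
      (+-cong (trans (*-congʳ (reflexive (δ-diag x))) (*-identityˡ _))
        (sumOver-0 xs λ z∈xs → trans (*-congʳ (reflexive (δ-off (All.lookup x∉ z∈xs ∘ ≡.sym)))) (zeroˡ _)))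
      (+-identityʳ _)
    sumOver-δ {x ∷ xs} {y} f (x∉ ∷ u) (there y∈xs) = trans
      (+-cong (trans (*-congʳ (reflexive (δ-off (All.lookup x∉ y∈xs)))) (zeroˡ _)) (sumOver-δ f u y∈xs))
      (+-identityˡ _)

    -- The push-forward of weights along ρ, from positions to elements. It makes weights on
    -- differently listed vertices (a cell, a common face, the image of the standard simplex)
    -- comparable as functions on points.
    gather : ∀ {m} → (Fin m → Carrier) → (Fin m → A) → A → Carrier
    gather {zero}  w ρ x = 0#
    gather {suc m} w ρ x = w zero * δ (ρ zero) x + gather (w ∘ suc) (ρ ∘ suc) x

    gather-sum : ∀ {m} (w : Fin m → Carrier) ρ {xs} (f : A → Carrier) → Unique xs → (∀ i → ρ i ∈ xs) →
                 sumOver xs (λ x → gather w ρ x * f x) ≈ sum (λ i → w i * f (ρ i))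
    gather-sum {zero} w ρ {xs} f u ρ∈ = sumOver-0 xs (λ _ → zeroˡ _)
    gather-sum {suc m} w ρ {xs} f u ρ∈ = begin
      sumOver xs (λ x → (w zero * δ (ρ zero) x + g x) * f x)
        ≈⟨ sumOver-cong xs (λ _ → solve 4 (λ a b c d → (a :* b :+ c) :* d := a :* (b :* d) :+ c :* d) refl _ _ _ _) ⟩
      sumOver xs (λ x → w zero * (δ (ρ zero) x * f x) + g x * f x)
        ≈⟨ sumOver-+ xs _ _ ⟩
      sumOver xs (λ x → w zero * (δ (ρ zero) x * f x)) + sumOver xs (λ x → g x * f x)
        ≈⟨ +-cong (sumOver-*ˡ xs (w zero) _) (gather-sum (w ∘ suc) (ρ ∘ suc) f u (ρ∈ ∘ suc)) ⟩
      w zero * sumOver xs (λ x → δ (ρ zero) x * f x) + sum (λ i → w (suc i) * f (ρ (suc i)))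
        ≈⟨ +-congʳ (*-congˡ (sumOver-δ f u (ρ∈ zero))) ⟩
      sum (λ i → w i * f (ρ i)) ∎
      where
      open ≈-Reasoning
      g = gather (w ∘ suc) (ρ ∘ suc)

    gather-total : ∀ {m} (w : Fin m → Carrier) ρ {xs} → Unique xs → (∀ i → ρ i ∈ xs) →
                   sumOver xs (gather w ρ) ≈ sum w
    gather-total w ρ {xs} u ρ∈ = trans (sumOver-cong xs (λ _ → sym (*-identityʳ _)))
      (trans (gather-sum w ρ (λ _ → 1#) u ρ∈) (sum-cong-≋ (λ i → *-identityʳ (w i))))

    gather-nonneg : ∀ {m} (w : Fin m → Carrier) ρ → (∀ i → 0# ≤ w i) → ∀ x → 0# ≤ gather w ρ x
    gather-nonneg {zero}  w ρ 0≤w x = ≤-refl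
    gather-nonneg {suc m} w ρ 0≤w x = +-nonneg (*-nonneg (0≤w zero) (δ-nonneg _ x))
      (gather-nonneg (w ∘ suc) (ρ ∘ suc) (0≤w ∘ suc) x)

    gather-∉ : ∀ {m} (w : Fin m → Carrier) ρ x → (∀ i → x ≢ ρ i) → gather w ρ x ≈ 0#
    gather-∉ {zero}  w ρ x x∉ = refl
    gather-∉ {suc m} w ρ x x∉ = trans
      (+-cong (trans (*-congˡ (reflexive (δ-off (x∉ zero)))) (zeroʳ _)) (gather-∉ _ _ x (x∉ ∘ suc)))
      (+-identityˡ 0#)

    gather-Integral : ∀ {m} (w : Fin m → Carrier) ρ → (∀ i → Integral (w i)) →
                      ∀ x → Integral (gather w ρ x)
    gather-Integral {zero}  w ρ int x = + 0 , refl
    gather-Integral {suc m} w ρ int x =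
      Integral-+ head (gather-Integral (w ∘ suc) (ρ ∘ suc) (int ∘ suc) x)
      where
      head : Integral (w zero * δ (ρ zero) x)
      head with x ≟ᴬ ρ zero
      ... | yes _ = proj₁ (int zero) , trans (*-identityʳ _) (proj₂ (int zero))
      ... | no  _ = + 0 , zeroʳ _

-- Addition of lattice points

private
  module ℤ-+ = Algebra.Properties.AbelianGroup ℤ.+-0-abelianGroup

infixl 6 _+ᴸ_
_+ᴸ_ : ∀ {n} → LatticePoint n → LatticePoint n → LatticePoint n
_+ᴸ_ = Vec.zipWith ℤ._+_

_≟ᴸ_ : ∀ {n} → DecidableEquality (LatticePoint n)
_≟ᴸ_ = Vec.≡-dec ℤ._≟_

+ᴸ-comm : ∀ {n} (v w : LatticePoint n) → v +ᴸ w ≡ w +ᴸ v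
+ᴸ-comm = Vec.zipWith-comm ℤ.+-comm

+ᴸ-cancelˡ : ∀ {n} (u v w : LatticePoint n) → u +ᴸ v ≡ u +ᴸ w → v ≡ w
+ᴸ-cancelˡ [] [] [] _ = ≡.refl
+ᴸ-cancelˡ (a ∷ u) (b ∷ v) (c ∷ w) eq = ≡.cong₂ _∷_
  (ℤ-+.∙-cancelˡ a b c (Vec.∷-injectiveˡ eq)) (+ᴸ-cancelˡ u v w (Vec.∷-injectiveʳ eq))

lookup-injective : ∀ {a} {A : Set a} {n} {v w : Vec A n} →
                   (∀ k → Vec.lookup v k ≡ Vec.lookup w k) → v ≡ w
lookup-injective {v = v} {w} eq =
  ≡.trans (≡.sym (Vec.tabulate∘lookup v)) (≡.trans (Vec.tabulate-cong eq) (Vec.tabulate∘lookup w))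

-- Triangulations

module _ {c ℓ₁ ℓ₂} (F : OrderedField c ℓ₁ ℓ₂) where
  open OrderedField F hiding (zero)
  open Over F
  open OrderedFieldProperties F
  open Solver
  open Sums F
  open Algebra.Properties.Semiring.Sum semiring
    using (sum-cong-≋; *-distribˡ-sum; *-distribʳ-sum; ∑-distrib-+)
  private
    module S = IsStrictTotalOrder isStrictTotalOrder
    module ≈-Reasoning = Relation.Binary.Reasoning.Setoid setoid

  private
    sub-distribʳ : ∀ x y z → (x - y) * z ≈ x * z + - 1# * (y * z)
    sub-distribʳ = solve 3 (λ a b c → (a :- b) :* c := a :* c :+ (:- con (+ 1)) :* (b :* c)) refl

    +-1* : ∀ x y → x + - 1# * y ≈ x - y
    +-1* = solve 2 (λ a b → a :+ (:- con (+ 1)) :* b := a :- b) refl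

    half-distribʳ : ∀ h x y z → h * (x + y) * z ≈ h * (x * z + y * z)
    half-distribʳ = solve 4 (λ h a b c → h :* (a :+ b) :* c := h :* (a :* c :+ b :* c)) refl

    complement : ∀ s → 1# - s + s ≈ 1#
    complement = solve 1 (λ s → con (+ 1) :- s :+ s := con (+ 1)) refl

    affine : ∀ s t u → (1# - s) * t + (s * t + u) ≈ t + u
    affine = solve 3 (λ s t u → (con (+ 1) :- s) :* t :+ (s :* t :+ u) := t :+ u) refl

  ½ : Carrier
  ½ = fromℕ 2 ⁻¹

  0<½ : 0# < ½
  0<½ = ⁻¹-positive (fromℕ-positive 1)

  2½≈1 : ½ + ½ ≈ 1#
  2½≈1 = trans (solve 1 (λ h → h :+ h := con (+ 2) :* h) refl ½)
    (⁻¹-inverseʳ (λ 2≈0 → S.irrefl (sym 2≈0) (fromℕ-positive 1)))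

  ι-+ᴸ : ∀ {n} (v w : LatticePoint n) k → ι (v +ᴸ w) k ≈ ι v k + ι w k
  ι-+ᴸ v w k = trans (reflexive (≡.cong fromℤ (Vec.lookup-zipWith ℤ._+_ k v w)))
    (fromℤ-+ (Vec.lookup v k) (Vec.lookup w k))

  ι-injective : ∀ {n} {v w : LatticePoint n} → (∀ k → ι v k ≈ ι w k) → v ≡ w
  ι-injective eq = lookup-injective (λ k → fromℤ-injective (eq k))

  -- Convexity of P enters through midpoints: they place (a + b) / 2 in P, hence in a cell.
  module UnimodularTriangulationProperties
    {n ℓ} {P : Pred (Point n) ℓ}
    (midpoint-closed : ∀ {x y z} → P x → P y → (∀ k → z k ≈ ½ * (x k + y k)) → P z)
    (Δ : UnimodularTriangulation P) where

    open UnimodularTriangulation Δ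
    open IsTriangulation isTriangulation
    open Weights (_≟ᴸ_ {n})

    -- If two positions carried the same vertex, weight 1 on one and -1 on the other would be an
    -- affine dependence.
    independent⇒unique : ∀ (σ : List (LatticePoint n)) → AffinelyIndependent (vertices σ) → Unique σ
    independent⇒unique σ ind = ≡.subst Unique (List.tabulate-lookup σ) (Unique.tabulate⁺ injective)
      where
      injective : ∀ {i j} → List.lookup σ i ≡ List.lookup σ j → i ≡ j
      injective {i} {j} eq with i Fin.≟ j
      ... | yes i≡j = i≡j
      ... | no i≢j = contradiction (trans (sym (ind w sum-w comb-w i)) w-i) 0≉1
        where
        m = length σ
        d : Fin m → Fin (length σ) → Carrier
        d i j = fromℤ (if ⌊ i Fin.≟ j ⌋ then + 1 else + 0)
        w : Fin (length σ) → Carrier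
        w k = d i k - d j k
        diff : ∀ f → sum (λ k → w k * f k) ≈ f i - f j
        diff f = begin
          sum (λ k → w k * f k)
            ≈⟨ sum-cong-≋ {m} (λ k → sub-distribʳ _ _ _) ⟩
          sum (λ k → d i k * f k + - 1# * (d j k * f k))
            ≈⟨ ∑-distrib-+ {m} _ _ ⟩
          sum (λ k → d i k * f k) + sum (λ k → - 1# * (d j k * f k))
            ≈⟨ +-cong (sum-δ {m} i f) (trans (sym (*-distribˡ-sum {m} (- 1#) _)) (*-congˡ (sum-δ {m} j f))) ⟩
          f i + - 1# * f j
            ≈⟨ +-1* _ _ ⟩
          f i - f j ∎
          where open ≈-Reasoning
        sum-w : sum w ≈ 0#
        sum-w = trans (sum-cong-≋ {m} (λ k → sym (*-identityʳ (w k)))) (trans (diff (λ _ → 1#)) (-‿inverseʳ 1#))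
        comb-w : combination w (vertices σ) ≈ᴾ (λ _ → 0#)
        comb-w k = trans (diff (λ l → vertices σ l k))
          (trans (+-congˡ (-‿cong (reflexive (≡.cong (λ v → ι v k) (≡.sym eq))))) (-‿inverseʳ _))
        w-i : w i ≈ 1#
        w-i with i Fin.≟ i | j Fin.≟ i
        ... | yes _  | no _    = solve 0 (con (+ 1) :+ con (+ 0) :- con (+ 0) := con (+ 1)) refl
        ... | yes _  | yes j≡i = contradiction (≡.sym j≡i) i≢j
        ... | no i≢i | _       = contradiction ≡.refl i≢i

    unique : ∀ {σ} → σ ∈ cells → Unique σ
    unique {σ} σ∈ = independent⇒unique σ (independent σ∈)

    -- Barycentric coordinates without a sign condition and with free total s: integral coordinates
    -- may be negative, and the sum of two lattice points has total 2.
    IsWeighting : List (LatticePoint n) → Carrier → Point n → (LatticePoint n → Carrier) → Set ℓ₁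
    IsWeighting σ s x ω = sumOver σ ω ≈ s × (∀ k → sumOver σ (λ v → ω v * ι v k) ≈ x k)

    -- The difference of the two weightings has total 0 and combination 0, so affine independence
    -- makes it vanish on σ.
    weighting-unique : ∀ {σ s x ω ω′} → σ ∈ cells → IsWeighting σ s x ω → IsWeighting σ s x ω′ →
                       ∀ {v} → v ∈ σ → ω v ≈ ω′ v
    weighting-unique {σ} {ω = ω} {ω′} σ∈ (tot , comb) (tot′ , comb′) {v} v∈ = -≈0⇒≈ (begin
      ω v - ω′ v           ≡⟨ ≡.cong diff (lookup-index v∈) ⟩
      diff (List.lookup σ (Any.index v∈))  ≈⟨ independent σ∈ (diff ∘ List.lookup σ) total combo (Any.index v∈) ⟩
      0#                   ∎)
      where
      open ≈-Reasoning
      diff : LatticePoint n → Carrier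
      diff v = ω v - ω′ v
      subtract : ∀ (f : LatticePoint n → Carrier) →
                 sumOver σ (λ v → diff v * f v) ≈ sumOver σ (λ v → ω v * f v) - sumOver σ (λ v → ω′ v * f v)
      subtract f = begin
        sumOver σ (λ v → diff v * f v)
          ≈⟨ sumOver-cong σ (λ _ → sub-distribʳ _ _ _) ⟩
        sumOver σ (λ v → ω v * f v + - 1# * (ω′ v * f v))
          ≈⟨ sumOver-+ σ _ _ ⟩
        sumOver σ (λ v → ω v * f v) + sumOver σ (λ v → - 1# * (ω′ v * f v))
          ≈⟨ +-congˡ (sumOver-*ˡ σ (- 1#) _) ⟩
        sumOver σ (λ v → ω v * f v) + - 1# * sumOver σ (λ v → ω′ v * f v)
          ≈⟨ +-1* _ _ ⟩
        sumOver σ (λ v → ω v * f v) - sumOver σ (λ v → ω′ v * f v) ∎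
      ones : ∀ (g : LatticePoint n → Carrier) → sumOver σ g ≈ sumOver σ (λ v → g v * 1#)
      ones g = sumOver-cong σ (λ _ → sym (*-identityʳ _))
      total : sum (diff ∘ List.lookup σ) ≈ 0#
      total = begin
        sum (diff ∘ List.lookup σ)  ≡⟨ sum-lookup σ diff ⟩
        sumOver σ diff              ≈⟨ trans (ones diff) (subtract (λ _ → 1#)) ⟩
        sumOver σ (λ v → ω v * 1#) - sumOver σ (λ v → ω′ v * 1#)
          ≈⟨ +-cong (trans (sym (ones ω)) tot) (-‿cong (trans (sym (ones ω′)) tot′)) ⟩
        _ - _                       ≈⟨ -‿inverseʳ _ ⟩
        0# ∎
      combo : combination (diff ∘ List.lookup σ) (vertices σ) ≈ᴾ (λ _ → 0#)
      combo k = begin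
        combination (diff ∘ List.lookup σ) (vertices σ) k  ≡⟨ sum-lookup σ (λ v → diff v * ι v k) ⟩
        sumOver σ (λ v → diff v * ι v k)                   ≈⟨ subtract (λ v → ι v k) ⟩
        _                                                  ≈⟨ +-cong (comb k) (-‿cong (comb′ k)) ⟩
        _ - _                                              ≈⟨ -‿inverseʳ _ ⟩
        0# ∎

    -- The weights are spread over all of σ so that they can be compared with other weightings of σ;
    -- their vanishing outside ρ records that x lies in the face ρ.
    Conv⇒weighting : ∀ σ ρ {x} → Unique σ → ρ ⊆ σ → Conv ρ x →
      ∃[ ω ] (∀ v → 0# ≤ ω v) × (∀ v → v ∉ ρ → ω v ≈ 0#) × IsWeighting σ 1# x ω
    Conv⇒weighting σ ρ u ρ⊆σ (w , 0≤w , tot , comb) =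
        gather {length ρ} w lk , gather-nonneg {length ρ} w lk 0≤w
      , (λ v v∉ → gather-∉ {length ρ} w lk v (λ i v≡ → v∉ (≡.subst (_∈ ρ) (≡.sym v≡) (∈-lookup i))))
      , trans (gather-total {length ρ} w lk u lk∈) tot
      , (λ k → trans (gather-sum {length ρ} w lk (λ v → ι v k) u lk∈) (comb k))
      where
      lk = List.lookup ρ
      lk∈ : ∀ i → lk i ∈ σ
      lk∈ i = ρ⊆σ (∈-lookup i)

    weighting⇒Conv : ∀ σ {x} ω → (∀ v → 0# ≤ ω v) → IsWeighting σ 1# x ω → Conv σ x
    weighting⇒Conv σ ω 0≤ω (tot , comb) = ω ∘ List.lookup σ , (λ _ → 0≤ω _)
      , trans (reflexive (sum-lookup σ ω)) tot
      , λ k → trans (reflexive (sum-lookup σ (λ v → ω v * ι v k))) (comb k)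

    -- Barycentric coordinates of the midpoint of v and w. For v ≡ w this is the point mass at v, so
    -- degenerate pairs such as 0 = 0 + 0 need no separate treatment.
    pairWeight : LatticePoint n → LatticePoint n → LatticePoint n → Carrier
    pairWeight v w x = ½ * (δ v x + δ w x)

    pairWeight-nonneg : ∀ v w x → 0# ≤ pairWeight v w x
    pairWeight-nonneg v w x = *-nonneg (inj₁ 0<½) (+-nonneg (δ-nonneg v x) (δ-nonneg w x))

    pairWeight-positiveˡ : ∀ v w → 0# < pairWeight v w v
    pairWeight-positiveˡ v w = *-positive 0<½ (+-pos-nonneg
      (S.<-respʳ-≈ (reflexive (≡.sym (δ-diag v))) 0<1) (δ-nonneg w v))

    pairWeight-positiveʳ : ∀ v w → 0# < pairWeight v w w
    pairWeight-positiveʳ v w = S.<-respʳ-≈ (*-congˡ (+-comm _ _)) (pairWeight-positiveˡ w v)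

    pairWeight-weighting : ∀ {σ v w} → Unique σ → v ∈ σ → w ∈ σ →
      IsWeighting σ 1# (λ k → ½ * ι (v +ᴸ w) k) (pairWeight v w)
    pairWeight-weighting {σ} {v} {w} u v∈ w∈ =
        trans (trans (sumOver-cong σ (λ _ → sym (*-identityʳ _))) (eval (λ _ → 1#)))
          (trans (distribˡ ½ 1# 1#) (trans (+-cong (*-identityʳ ½) (*-identityʳ ½)) 2½≈1))
      , λ k → trans (eval (λ x → ι x k)) (*-congˡ (sym (ι-+ᴸ v w k)))
      where
      open ≈-Reasoning
      eval : ∀ f → sumOver σ (λ x → pairWeight v w x * f x) ≈ ½ * (f v + f w)
      eval f = begin
        sumOver σ (λ x → pairWeight v w x * f x)
          ≈⟨ sumOver-cong σ (λ _ → half-distribʳ _ _ _ _) ⟩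
        sumOver σ (λ x → ½ * (δ v x * f x + δ w x * f x))
          ≈⟨ trans (sumOver-*ˡ σ ½ _) (*-congˡ (sumOver-+ σ _ _)) ⟩
        ½ * (sumOver σ (λ x → δ v x * f x) + sumOver σ (λ x → δ w x * f x))
          ≈⟨ *-congˡ (+-cong (sumOver-δ f u v∈) (sumOver-δ f u w∈)) ⟩
        ½ * (f v + f w) ∎

    pairWeight-support : ∀ {v w x} → 0# < pairWeight v w x → x ≡ v ⊎ x ≡ w
    pairWeight-support {v} {w} {x} pos with x ≟ᴸ v | x ≟ᴸ w
    ... | yes x≡v | _       = inj₁ x≡v
    ... | no _    | yes x≡w = inj₂ x≡w
    ... | no _    | no _    = contradiction pos
      (S.irrefl (sym (trans (*-congˡ (+-identityˡ 0#)) (zeroʳ ½))))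

    midpoint-in-cell : ∀ {σ v w} → σ ∈ cells → v ∈ σ → w ∈ σ → Conv σ (λ k → ½ * ι (v +ᴸ w) k)
    midpoint-in-cell {σ} {v} {w} σ∈ v∈ w∈ = weighting⇒Conv σ _ (pairWeight-nonneg v w)
      (pairWeight-weighting (unique σ∈) v∈ w∈)

    -- The midpoint lies in the common face ρ of σ and τ; being in the relative
    -- interior of vw, it forces v and w into ρ, hence into τ.
    sum-determines-edge : ∀ {σ τ v w v′ w′} → σ ∈ cells → τ ∈ cells →
      v ∈ σ → w ∈ σ → v′ ∈ τ → w′ ∈ τ → v +ᴸ w ≡ v′ +ᴸ w′ → SameEdge (v , w) (v′ , w′)
    sum-determines-edge {σ} {τ} {v} {w} {v′} {w′} σ∈ τ∈ v∈σ w∈σ v′∈τ w′∈τ eq =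
      match (pairWeight-support (S.<-respʳ-≈ pw≈ (pairWeight-positiveˡ v w)))
      where
      open DecMembership (_≟ᴸ_ {n}) using (_∈?_)
      mid : Point n
      mid k = ½ * ι (v +ᴸ w) k
      face = meet σ∈ τ∈
      ρ = proj₁ face
      ρ⊆σ : ρ ⊆ σ
      ρ⊆σ = proj₁ (proj₂ face)
      ρ⊆τ : ρ ⊆ τ
      ρ⊆τ = proj₁ (proj₂ (proj₂ face))
      mid∈τ : Conv τ mid
      mid∈τ = ≡.subst (λ z → Conv τ (λ k → ½ * ι z k)) (≡.sym eq) (midpoint-in-cell τ∈ v′∈τ w′∈τ)
      mid∈ρ : Conv ρ mid
      mid∈ρ = Equivalence.to (proj₂ (proj₂ (proj₂ face)) mid) (midpoint-in-cell σ∈ v∈σ w∈σ , mid∈τ)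
      weighting = Conv⇒weighting σ ρ {mid} (unique σ∈) ρ⊆σ mid∈ρ
      ω = proj₁ weighting
      ω-support = proj₁ (proj₂ (proj₂ weighting))
      ω-weighting : IsWeighting σ 1# mid ω
      ω-weighting = proj₂ (proj₂ (proj₂ weighting))
      ω≈ : ∀ {x} → x ∈ σ → pairWeight v w x ≈ ω x
      ω≈ = weighting-unique σ∈ (pairWeight-weighting (unique σ∈) v∈σ w∈σ) ω-weighting
      in-ρ : ∀ {x} → x ∈ σ → 0# < pairWeight v w x → x ∈ ρ
      in-ρ {x} x∈σ pos with x ∈? ρ
      ... | yes x∈ρ = x∈ρ
      ... | no  x∉ρ = contradiction pos (S.irrefl (sym (trans (ω≈ x∈σ) (ω-support x x∉ρ))))
      v∈τ : v ∈ τ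
      v∈τ = ρ⊆τ (in-ρ v∈σ (pairWeight-positiveˡ v w))
      w∈τ : w ∈ τ
      w∈τ = ρ⊆τ (in-ρ w∈σ (pairWeight-positiveʳ v w))
      -- All four points now lie in τ and the two midpoints agree, so uniqueness in τ puts v into
      -- the support of the other weighting. Cancelling v from the sums then identifies w.
      pw≈ : pairWeight v w v ≈ pairWeight v′ w′ v
      pw≈ = weighting-unique τ∈ (pairWeight-weighting (unique τ∈) v∈τ w∈τ)
        (≡.subst (λ z → IsWeighting τ 1# (λ k → ½ * ι z k) _) (≡.sym eq)
          (pairWeight-weighting (unique τ∈) v′∈τ w′∈τ)) v∈τ
      match : v ≡ v′ ⊎ v ≡ w′ → SameEdge (v , w) (v′ , w′)
      match (inj₁ ≡.refl) = inj₁ (≡.refl , +ᴸ-cancelˡ v w w′ eq)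
      match (inj₂ ≡.refl) = inj₂ (≡.refl , +ᴸ-cancelˡ v w v′ (≡.trans eq (+ᴸ-comm v′ v)))

    vertex∈P : ∀ {σ v} → σ ∈ cells → v ∈ σ → P (ι v)
    vertex∈P {σ} {v} σ∈ v∈ = Equivalence.from (union (ι v)) (σ , σ∈ ,
      weighting⇒Conv σ (δ v) (δ-nonneg v)
        ( trans (sumOver-cong σ (λ _ → sym (*-identityʳ _))) (sumOver-δ (λ _ → 1#) (unique σ∈) v∈)
        , λ k → sumOver-δ (λ x → ι x k) (unique σ∈) v∈))

    -- Write y as `apply x` with x integral. The entries of x, together with 1 minus their sum, are
    -- the coordinates of y in the images of the standard vertices e i and 0. They may be negative,
    -- since y need not lie in σ.
    integral-weighting : ∀ {σ} → σ ∈ cells → ∀ y → P (ι y) →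
      ∃[ α ] (∀ v → Integral (α v)) × IsWeighting σ 1# (ι y) α
    integral-weighting {σ} σ∈ y Py =
        gather {suc dim} w ρ , gather-Integral {suc dim} w ρ w-integral
      , trans (gather-total {suc dim} w ρ (unique σ∈) ρ∈) (complement _)
      , λ k → trans (gather-sum {suc dim} w ρ (λ v → ι v k) (unique σ∈) ρ∈) (combine k)
      where
      open IsUnimodular (isUnimodular σ∈)
      open IntegralAffineMap φ
      pre : ∃[ x ] apply x ≡ y
      -- A point of P lies in the affine hull of P as a one-term affine combination.
      pre = surjective y (1 , (λ _ → ι y) , (λ _ → 1#) , (λ _ → Py) , +-identityʳ 1#
                         , λ k → trans (+-identityʳ _) (*-identityˡ _))
      x = proj₁ pre
      xᶠ : Fin dim → Carrier
      xᶠ i = fromℤ (Vec.lookup x i)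
      w : Fin (suc dim) → Carrier
      w zero    = 1# - sum xᶠ
      w (suc i) = xᶠ i
      ρ : Fin (suc dim) → LatticePoint n
      ρ zero    = apply (Vec.replicate dim (+ 0))
      ρ (suc i) = apply (e i)
      ρ∈ : ∀ i → ρ i ∈ σ
      ρ∈ zero    = ∈-resp-↭ image (here ≡.refl)
      ρ∈ (suc i) = ∈-resp-↭ image (there (∈-map⁺ apply (∈-map⁺ e (∈-allFin i))))
      w-integral : ∀ i → Integral (w i)
      w-integral zero    = Integral-- (+ 1 , sym (+-identityʳ 1#)) (Integral-sum {dim} xᶠ (λ i → Vec.lookup x i , refl))
      w-integral (suc i) = Vec.lookup x i , refl
      t : Fin n → Carrier
      t k = fromℤ (Vec.lookup translation k)
      col : Fin dim → Fin n → Carrier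
      col i k = fromℤ (Vec.lookup (columns i) k)
      apply-coordinate : ∀ z k → ι (apply z) k ≈ t k + sum (λ i → fromℤ (Vec.lookup z i) * col i k)
      apply-coordinate z k = trans (reflexive (≡.cong fromℤ (Vec.lookup∘tabulate _ k)))
        (trans (fromℤ-+ (Vec.lookup translation k) _) (+-congˡ (trans (fromℤ-sum {dim} _)
          (sum-cong-≋ {dim} (λ i → fromℤ-* (Vec.lookup z i) (Vec.lookup (columns i) k))))))
      apply-0 : ∀ k → ι (ρ zero) k ≈ t k
      apply-0 k = trans (apply-coordinate (Vec.replicate dim (+ 0)) k) (trans (+-congˡ (trans
        (sum-cong-≋ {dim} (λ i → *-congʳ (reflexive (≡.cong fromℤ (Vec.lookup-replicate i (+ 0))))))
        (trans (sym (*-distribˡ-sum {dim} 0# (λ i → col i k))) (zeroˡ _)))) (+-identityʳ _))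
      apply-e : ∀ i k → ι (ρ (suc i)) k ≈ t k + col i k
      apply-e i k = trans (apply-coordinate (e i) k) (+-congˡ (trans
        (sum-cong-≋ {dim} (λ j → *-congʳ {y = fromℤ (if ⌊ i Fin.≟ j ⌋ then + 1 else + 0)} (reflexive (≡.cong fromℤ (Vec.lookup∘tabulate _ j)))))
        (sum-δ {dim} i (λ j → col j k))))
      combine : ∀ k → sum (λ i → w i * ι (ρ i) k) ≈ ι y k
      combine k = begin
        (1# - sum xᶠ) * ι (ρ zero) k + sum (λ i → xᶠ i * ι (ρ (suc i)) k)
          ≈⟨ +-cong (*-congˡ (apply-0 k)) (sum-cong-≋ {dim} (λ i → trans (*-congˡ (apply-e i k)) (distribˡ _ _ _))) ⟩
        (1# - sum xᶠ) * t k + sum (λ i → xᶠ i * t k + xᶠ i * col i k)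
          ≈⟨ +-congˡ (trans (∑-distrib-+ {dim} (λ i → xᶠ i * t k) (λ i → xᶠ i * col i k)) (+-congʳ (sym (*-distribʳ-sum {dim} (t k) xᶠ)))) ⟩
        (1# - sum xᶠ) * t k + (sum xᶠ * t k + sum (λ i → xᶠ i * col i k))
          ≈⟨ affine _ _ _ ⟩
        t k + sum (λ i → xᶠ i * col i k)
          ≈⟨ apply-coordinate x k ⟨
        ι (apply x) k
          ≡⟨ ≡.cong (λ z → ι z k) (proj₂ pre) ⟩
        ι y k ∎
        where open ≈-Reasoning

    -- Nonnegative integral coordinates are multiplicities, so z is a sum of m vertices counted with
    -- repetition. Used for m = 1 (lattice points) and m = 2 (sums of two lattice points).
    vertices-of-natural-weighting : ∀ {σ α m z} → (∀ {v} → v ∈ σ → 0# ≤ α v) →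
      (∀ v → Integral (α v)) → IsWeighting σ (fromℕ m) z α →
      ∃[ vs ] vs ⊆ σ × length vs ≡ m × (∀ k → z k ≈ sumOver vs (λ v → ι v k))
    vertices-of-natural-weighting {σ} {α} {m} 0≤α int (tot , comb)
      with natural-weights α σ (λ v∈ → nonneg-Integral (0≤α v∈) (int _))
    ... | vs , vs⊆σ , eq = vs , vs⊆σ , ℤ.+-injective (fromℤ-injective (begin
        fromℕ (length vs)             ≈⟨ *-identityʳ _ ⟨
        fromℕ (length vs) * 1#        ≈⟨ sumOver-const vs (λ _ → refl) ⟨
        sumOver vs (λ _ → 1#)         ≈⟨ eq (λ _ → 1#) ⟨
        sumOver σ (λ v → α v * 1#)    ≈⟨ sumOver-cong σ (λ _ → *-identityʳ _) ⟩
        sumOver σ α                   ≈⟨ tot ⟩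
        fromℕ m                       ∎))
      , λ k → trans (sym (comb k)) (eq (λ v → ι v k))
      where open ≈-Reasoning

    -- In a cell containing a, its coordinates are nonnegative by membership and integral by
    -- unimodularity; with total 1 they single out one vertex.
    lattice-point-is-vertex : ∀ {a} → P (ι a) → ∃[ σ ] σ ∈ cells × a ∈ σ
    lattice-point-is-vertex {a} Pa = σ , σ∈ , a∈σ vertex
      where
      cell = Equivalence.to (union (ι a)) Pa
      σ = proj₁ cell
      σ∈ : σ ∈ cells
      σ∈ = proj₁ (proj₂ cell)
      real = Conv⇒weighting σ σ {ι a} (unique σ∈) id (proj₂ (proj₂ cell))
      ω = proj₁ real
      integral = integral-weighting σ∈ a Pa
      α = proj₁ integral
      α-weighting : IsWeighting σ 1# (ι a) α
      α-weighting = proj₂ (proj₂ integral)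
      ω≈α : ∀ {v} → v ∈ σ → ω v ≈ α v
      ω≈α = weighting-unique σ∈ (proj₂ (proj₂ (proj₂ real))) α-weighting
      vertex : ∃[ vs ] vs ⊆ σ × length vs ≡ 1 × (∀ k → ι a k ≈ sumOver vs (λ v → ι v k))
      vertex = vertices-of-natural-weighting
        (λ v∈ → ≤-respʳ (ω≈α v∈) (proj₁ (proj₂ real) _)) (proj₁ (proj₂ integral))
        (trans (proj₁ α-weighting) (sym (+-identityʳ 1#)) , proj₂ α-weighting)
      a∈σ : (∃[ vs ] vs ⊆ σ × length vs ≡ 1 × (∀ k → ι a k ≈ sumOver vs (λ v → ι v k))) → a ∈ σ
      a∈σ (v ∷ [] , vs⊆σ , ≡.refl , eq) = ≡.subst (_∈ σ)
        (ι-injective {v = v} {a} (λ k → sym (trans (eq k) (+-identityʳ _)))) (vs⊆σ (here ≡.refl))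

    -- In the integral barycentric coordinates of a cell σ containing (a + b) / 2,
    -- the point a + b has nonnegative coordinates with sum 2.
    sum-of-lattice-points : ∀ {a b} → P (ι a) → P (ι b) →
      ∃[ σ ] σ ∈ cells × (∃[ v ] ∃[ w ] v ∈ σ × w ∈ σ × a +ᴸ b ≡ v +ᴸ w)
    sum-of-lattice-points {a} {b} Pa Pb = σ , σ∈ , endpoints edge
      where
      open ≈-Reasoning
      mid : Point n
      mid k = ½ * ι (a +ᴸ b) k
      cell = Equivalence.to (union mid) (midpoint-closed Pa Pb λ k → *-congˡ (ι-+ᴸ a b k))
      σ = proj₁ cell
      σ∈ : σ ∈ cells
      σ∈ = proj₁ (proj₂ cell)
      real = Conv⇒weighting σ σ {mid} (unique σ∈) id (proj₂ (proj₂ cell))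
      ω = proj₁ real
      0≤ω : ∀ v → 0# ≤ ω v
      0≤ω = proj₁ (proj₂ real)
      integralᵃ = integral-weighting σ∈ a Pa
      integralᵇ = integral-weighting σ∈ b Pb
      α = proj₁ integralᵃ
      β = proj₁ integralᵇ
      α-weighting : IsWeighting σ 1# (ι a) α
      α-weighting = proj₂ (proj₂ integralᵃ)
      β-weighting : IsWeighting σ 1# (ι b) β
      β-weighting = proj₂ (proj₂ integralᵇ)
      γ : LatticePoint n → Carrier
      γ v = α v + β v
      γ-total : sumOver σ γ ≈ 1# + 1#
      γ-total = trans (sumOver-+ σ α β) (+-cong (proj₁ α-weighting) (proj₁ β-weighting))
      γ-comb : ∀ k → sumOver σ (λ v → γ v * ι v k) ≈ ι (a +ᴸ b) k
      γ-comb k = begin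
        sumOver σ (λ v → γ v * ι v k)
          ≈⟨ sumOver-cong σ (λ {v} _ → distribʳ (ι v k) (α v) (β v)) ⟩
        sumOver σ (λ v → α v * ι v k + β v * ι v k)
          ≈⟨ sumOver-+ σ (λ v → α v * ι v k) (λ v → β v * ι v k) ⟩
        sumOver σ (λ v → α v * ι v k) + sumOver σ (λ v → β v * ι v k)
          ≈⟨ +-cong (proj₂ α-weighting k) (proj₂ β-weighting k) ⟩
        ι a k + ι b k
          ≈⟨ ι-+ᴸ a b k ⟨
        ι (a +ᴸ b) k ∎
      -- α and β may each take negative values; only half their sum is a weighting of the midpoint,
      -- and there it can be compared with the nonnegative ω.
      half : IsWeighting σ 1# mid (λ v → ½ * γ v)
      half = trans (sumOver-*ˡ σ ½ γ) (trans (*-congˡ γ-total)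
               (trans (distribˡ ½ 1# 1#) (trans (+-cong (*-identityʳ ½) (*-identityʳ ½)) 2½≈1)))
           , λ k → trans (sumOver-cong σ (λ {v} _ → *-assoc ½ (γ v) (ι v k)))
               (trans (sumOver-*ˡ σ ½ (λ v → γ v * ι v k)) (*-congˡ (γ-comb k)))
      ω≈ : ∀ {v} → v ∈ σ → ω v ≈ ½ * γ v
      ω≈ = weighting-unique σ∈ (proj₂ (proj₂ (proj₂ real))) half
      double : ∀ {v} → v ∈ σ → ω v + ω v ≈ γ v
      double {v} v∈ = begin
        ω v + ω v           ≈⟨ +-cong (ω≈ v∈) (ω≈ v∈) ⟩
        ½ * γ v + ½ * γ v   ≈⟨ distribʳ (γ v) ½ ½ ⟨
        (½ + ½) * γ v       ≈⟨ trans (*-congʳ 2½≈1) (*-identityˡ (γ v)) ⟩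
        γ v                 ∎
      edge : ∃[ vs ] vs ⊆ σ × length vs ≡ 2 × (∀ k → ι (a +ᴸ b) k ≈ sumOver vs (λ v → ι v k))
      edge = vertices-of-natural-weighting {α = γ}
        (λ {v} v∈ → ≤-respʳ (double v∈) (+-nonneg (0≤ω v) (0≤ω v)))
        (λ v → Integral-+ (proj₁ (proj₂ integralᵃ) v) (proj₁ (proj₂ integralᵇ) v))
        (trans γ-total (+-congˡ (sym (+-identityʳ 1#))) , γ-comb)
      endpoints : (∃[ vs ] vs ⊆ σ × length vs ≡ 2 × (∀ k → ι (a +ᴸ b) k ≈ sumOver vs (λ v → ι v k))) →
        ∃[ v ] ∃[ w ] v ∈ σ × w ∈ σ × a +ᴸ b ≡ v +ᴸ w
      endpoints (v ∷ w ∷ [] , vs⊆σ , ≡.refl , eq) = v , w , vs⊆σ (here ≡.refl) , vs⊆σ (there (here ≡.refl))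
        , ι-injective {v = a +ᴸ b} {v +ᴸ w} (λ k → trans (eq k) (trans (+-congˡ (+-identityʳ _)) (sym (ι-+ᴸ v w k))))

-- Lists

module _ {a b} {A : Set a} {B : Set b} where

  unique-map-on : ∀ {xs} (f : A → B) → Unique xs →
    (∀ {x y} → x ∈ xs → y ∈ xs → f x ≡ f y → x ≡ y) → Unique (map f xs)
  unique-map-on f [] inj = []
  unique-map-on f (x∉ ∷ u) inj =
    All.map⁺ (All.tabulate λ y∈ eq → All.lookup x∉ y∈ (inj (here ≡.refl) (there y∈) eq))
      ∷ unique-map-on f u (λ x∈ y∈ → inj (there x∈) (there y∈))

  -- The key recovers from an entry the index of its sublist, so different sublists are disjoint.
  unique-concatMap : ∀ {xs} (f : A → List B) (key : B → A) → Unique xs →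
    (∀ x → Unique (f x)) → (∀ {x y} → y ∈ f x → key y ≡ x) → Unique (concatMap f xs)
  unique-concatMap f key [] uf keyed = []
  unique-concatMap {x ∷ xs} f key (x∉ ∷ u) uf keyed =
    Unique.++⁺ (uf x) (unique-concatMap f key u uf keyed) λ (y∈fx , y∈rest) →
      let z∈xs , y∈fz = ∈-find xs y∈rest
      in All.lookup x∉ z∈xs (≡.trans (≡.sym (keyed y∈fx)) (keyed y∈fz))
    where
    ∈-find : ∀ zs {y} → y ∈ concatMap f zs → key y ∈ zs × y ∈ f (key y)
    ∈-find (z ∷ zs) y∈ with ∈-++⁻ (f z) y∈
    ... | inj₁ y∈fz = here (keyed y∈fz) , ≡.subst (λ w → _ ∈ f w) (≡.sym (keyed y∈fz)) y∈fz
    ... | inj₂ y∈r  = let p , q = ∈-find zs y∈r in there p , q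

  length-concatMap : ∀ xs (f : A → List B) {m} → (∀ {x} → x ∈ xs → length (f x) ≡ m) →
                     length (concatMap f xs) ≡ length xs ℕ.* m
  length-concatMap [] f eq = ≡.refl
  length-concatMap (x ∷ xs) f eq = ≡.trans (List.length-++ (f x))
    (≡.cong₂ ℕ._+_ (eq (here ≡.refl)) (length-concatMap xs f (eq ∘ there)))

-- Without duplicates, equality as sets is equality as bags, so the lists are permutations of each
-- other.
unique-set⇒length : ∀ {a} {A : Set a} {xs ys : List A} → Unique xs → Unique ys →
  (∀ {z} → z ∈ xs → z ∈ ys) → (∀ {z} → z ∈ ys → z ∈ xs) → length xs ≡ length ys
unique-set⇒length u v to from = ↭-length (∼bag⇒↭ (unique∧set⇒bag u v (mk⇔ to from)))

module _ {a} {A : Set a} where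

  ∈-pairs⁻ : ∀ (xs : List A) {x y} → (x , y) ∈ pairs xs → x ∈ xs × y ∈ xs
  ∈-pairs⁻ (z ∷ xs) p with ∈-++⁻ (map (z ,_) xs) p
  ... | inj₂ q = let x∈ , y∈ = ∈-pairs⁻ xs q in there x∈ , there y∈
  ... | inj₁ q with ∈-map⁻ (z ,_) q
  ...   | y , y∈ , ≡.refl = here ≡.refl , there y∈

  ∈-pairs⁺ : ∀ {xs : List A} {x y} → x ∈ xs → y ∈ xs → x ≢ y →
             (x , y) ∈ pairs xs ⊎ (y , x) ∈ pairs xs
  ∈-pairs⁺ (here ≡.refl) (here ≡.refl) x≢y = contradiction ≡.refl x≢y
  ∈-pairs⁺ (here ≡.refl) (there y∈)    _   = inj₁ (∈-++⁺ˡ (∈-map⁺ _ y∈))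
  ∈-pairs⁺ (there x∈)    (here ≡.refl) _   = inj₂ (∈-++⁺ˡ (∈-map⁺ _ x∈))
  ∈-pairs⁺ {z ∷ xs} (there x∈) (there y∈) x≢y with ∈-pairs⁺ x∈ y∈ x≢y
  ... | inj₁ p = inj₁ (∈-++⁺ʳ (map (z ,_) xs) p)
  ... | inj₂ p = inj₂ (∈-++⁺ʳ (map (z ,_) xs) p)

  pairs-related : ∀ {ℓ} {R : A → A → Set ℓ} xs {x y} → AllPairs R xs → (x , y) ∈ pairs xs → R x y
  pairs-related (z ∷ xs) (Rz ∷ Rxs) p with ∈-++⁻ (map (z ,_) xs) p
  ... | inj₂ q = pairs-related xs Rxs q
  ... | inj₁ q with ∈-map⁻ (z ,_) q
  ...   | y , y∈ , ≡.refl = All.lookup Rz y∈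

  unique-pairs : ∀ {xs : List A} → Unique xs → Unique (pairs xs)
  unique-pairs [] = []
  unique-pairs {x ∷ xs} (x∉ ∷ u) =
    Unique.++⁺ (Unique.map⁺ (≡.cong proj₂) u) (unique-pairs u) λ (p , q) → disjoint p q
    where
    disjoint : ∀ {yz} → yz ∈ map (x ,_) xs → yz ∉ pairs xs
    disjoint p q with ∈-map⁻ (x ,_) p
    ... | y , y∈ , ≡.refl = All.lookup x∉ (proj₁ (∈-pairs⁻ xs q)) ≡.refl

  length-pairs : ∀ (xs : List A) → length (pairs xs) ≡ length xs C 2
  length-pairs []       = ≡.refl
  length-pairs (x ∷ xs) = begin
    length (map (x ,_) xs ++ pairs xs)              ≡⟨ List.length-++ (map (x ,_) xs) ⟩
    length (map (x ,_) xs) ℕ.+ length (pairs xs)    ≡⟨ ≡.cong₂ ℕ._+_ (List.length-map _ xs) (length-pairs xs) ⟩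
    length xs ℕ.+ length xs C 2                     ≡⟨ ≡.cong (ℕ._+ length xs C 2) (nC1≡n (length xs)) ⟨
    length xs C 1 ℕ.+ length xs C 2                 ≡⟨ nCk+nC[k+1]≡[n+1]C[k+1] (length xs) 1 ⟩
    suc (length xs) C 2                             ∎
    where open ≡.≡-Reasoning

module _ {n : ℕ} where

  _without_ : List (Fin n) → Fin n → List (Fin n)
  xs without i = filter (λ k → ¬? (k Fin.≟ i)) xs

  length-without : ∀ {xs i} → Unique xs → i ∈ xs → suc (length (xs without i)) ≡ length xs
  length-without {x ∷ xs} {i} (x∉ ∷ u) i∈ with x Fin.≟ i | i∈
  ... | yes ≡.refl | _         = ≡.cong (suc ∘ length)
        (List.filter-all (λ k → ¬? (k Fin.≟ i)) (All.map (λ x≢k k≡x → x≢k (≡.sym k≡x)) x∉))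
  ... | no x≢i     | here i≡x  = contradiction (≡.sym i≡x) x≢i
  ... | no _       | there i∈′ = ≡.cong suc (length-without u i∈′)

  ∈-without⁺ : ∀ {xs i k} → k ∈ xs → k ≢ i → k ∈ xs without i
  ∈-without⁺ = ∈-filter⁺ _

  ∈-without⁻ : ∀ xs {i k} → k ∈ xs without i → k ∈ xs × k ≢ i
  ∈-without⁻ xs {i} = ∈-filter⁻ (λ k → ¬? (k Fin.≟ i))

  allPairs-without : ∀ {ℓ} {R : Fin n → Fin n → Set ℓ} {xs} i → AllPairs R xs → AllPairs R (xs without i)
  allPairs-without i = AllPairs.filter⁺ _

  allFin-< : AllPairs Fin._<_ (allFin n)
  allFin-< = AllPairs.tabulate⁺-< id

  -- `pairs` keeps the order of the list, so an increasing list rules out the other orientation.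
  <⇒pair : ∀ {xs} → AllPairs Fin._<_ xs → ∀ {i j : Fin n} → i ∈ xs → j ∈ xs → i Fin.< j → (i , j) ∈ pairs xs
  <⇒pair <xs i∈ j∈ i<j with ∈-pairs⁺ i∈ j∈ (Fin.<⇒≢ i<j)
  ... | inj₁ p = p
  ... | inj₂ p = contradiction (pairs-related _ <xs p) (Fin.<-asym i<j)

-- Differences of basis vectors and their sums

module _ {n : ℕ} where

  private
    b : Fin n → Fin n → ℤ
    b i k = if ⌊ i Fin.≟ k ⌋ then + 1 else + 0

  _⊖_ : Fin n → Fin n → LatticePoint n
  s ⊖ t = e s -ᴸ e t

  ⟨_-_+_-_⟩ : Fin n → Fin n → Fin n → Fin n → LatticePoint n
  ⟨ s - t + u - w ⟩ = (s ⊖ t) +ᴸ (u ⊖ w)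

  lookup-⊖ : ∀ s t k → Vec.lookup (s ⊖ t) k ≡ b s k ℤ.- b t k
  lookup-⊖ s t k = ≡.trans (Vec.lookup-zipWith ℤ._-_ k (e s) (e t))
    (≡.cong₂ ℤ._-_ (Vec.lookup∘tabulate (b s) k) (Vec.lookup∘tabulate (b t) k))

  lookup-⟨⟩ : ∀ s t u w k →
    Vec.lookup ⟨ s - t + u - w ⟩ k ≡ (b s k ℤ.- b t k) ℤ.+ (b u k ℤ.- b w k)
  lookup-⟨⟩ s t u w k = ≡.trans (Vec.lookup-zipWith ℤ._+_ k (s ⊖ t) (u ⊖ w))
    (≡.cong₂ ℤ._+_ (lookup-⊖ s t k) (lookup-⊖ u w k))

  private
    swap-subtrahends : ∀ a c d f → (a ℤ.- c) ℤ.+ (d ℤ.- f) ≡ (a ℤ.- f) ℤ.+ (d ℤ.- c)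
    swap-subtrahends = solve 4 (λ a c d f → (a :- c) :+ (d :- f) := (a :- f) :+ (d :- c)) ≡.refl
      where open +-*-Solver

  -- A sum does not remember which head was matched with which tail. This is why `present` has two
  -- alternatives for `quad`.
  ⟨⟩-swap : ∀ s t u w → ⟨ s - t + u - w ⟩ ≡ ⟨ s - w + u - t ⟩
  ⟨⟩-swap s t u w = lookup-injective λ k → begin
    Vec.lookup ⟨ s - t + u - w ⟩ k              ≡⟨ lookup-⟨⟩ s t u w k ⟩
    (b s k ℤ.- b t k) ℤ.+ (b u k ℤ.- b w k)     ≡⟨ swap-subtrahends (b s k) (b t k) (b u k) (b w k) ⟩
    (b s k ℤ.- b w k) ℤ.+ (b u k ℤ.- b t k)     ≡⟨ lookup-⟨⟩ s w u t k ⟨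
    Vec.lookup ⟨ s - w + u - t ⟩ k              ∎
    where open ≡.≡-Reasoning

  ⟨⟩-comm : ∀ s t u w → ⟨ s - t + u - w ⟩ ≡ ⟨ u - w + s - t ⟩
  ⟨⟩-comm s t u w = +ᴸ-comm (s ⊖ t) (u ⊖ w)

  ⟨⟩-refl : ∀ s t u → ⟨ s - t + u - u ⟩ ≡ s ⊖ t
  ⟨⟩-refl s t u = lookup-injective λ k → begin
    Vec.lookup ⟨ s - t + u - u ⟩ k              ≡⟨ lookup-⟨⟩ s t u u k ⟩
    (b s k ℤ.- b t k) ℤ.+ (b u k ℤ.- b u k)     ≡⟨ ≡.cong (λ z → (b s k ℤ.- b t k) ℤ.+ z) (ℤ.+-inverseʳ (b u k)) ⟩
    (b s k ℤ.- b t k) ℤ.+ + 0                   ≡⟨ ℤ.+-identityʳ _ ⟩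
    b s k ℤ.- b t k                             ≡⟨ lookup-⊖ s t k ⟨
    Vec.lookup (s ⊖ t) k                        ∎
    where open ≡.≡-Reasoning

  ⟨⟩-cancel : ∀ s t u → ⟨ s - t + t - u ⟩ ≡ s ⊖ u
  ⟨⟩-cancel s t u = ≡.trans (⟨⟩-swap s t t u) (⟨⟩-refl s u t)

  ⊖-self : ∀ s t → s ⊖ s ≡ t ⊖ t
  ⊖-self s t = lookup-injective λ k → ≡.trans (lookup-⊖ s s k) (≡.trans (ℤ.+-inverseʳ (b s k))
    (≡.sym (≡.trans (lookup-⊖ t t k) (ℤ.+-inverseʳ (b t k)))))

  ⊖-positive : ∀ s t {k} → + 0 ℤ.< Vec.lookup (s ⊖ t) k → k ≡ s
  ⊖-positive s t {k} pos rewrite lookup-⊖ s t k with s Fin.≟ k | t Fin.≟ k | pos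
  ... | yes s≡k | _     | _ = ≡.sym s≡k
  ... | no _    | yes _ | ()
  ... | no _    | no _  | ℤ.+<+ ()

  ⊖-negative : ∀ s t {k} → Vec.lookup (s ⊖ t) k ℤ.< + 0 → k ≡ t
  ⊖-negative s t {k} neg rewrite lookup-⊖ s t k with s Fin.≟ k | t Fin.≟ k | neg
  ... | _     | yes t≡k | _        = ≡.sym t≡k
  ... | yes _ | no _    | ℤ.+<+ ()
  ... | no _  | no _    | ℤ.+<+ ()

  ⟨⟩-positive : ∀ s t u w {k} → + 0 ℤ.< Vec.lookup ⟨ s - t + u - w ⟩ k → k ≡ s ⊎ k ≡ u
  ⟨⟩-positive s t u w {k} pos
    rewrite lookup-⟨⟩ s t u w k with s Fin.≟ k | u Fin.≟ k | t Fin.≟ k | w Fin.≟ k | pos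
  ... | yes s≡k | _       | _     | _     | _ = inj₁ (≡.sym s≡k)
  ... | no _    | yes u≡k | _     | _     | _ = inj₂ (≡.sym u≡k)
  ... | no _    | no _    | yes _ | yes _ | ()
  ... | no _    | no _    | yes _ | no _  | ()
  ... | no _    | no _    | no _  | yes _ | ()
  ... | no _    | no _    | no _  | no _  | ℤ.+<+ ()

  ⟨⟩-negative : ∀ s t u w {k} → Vec.lookup ⟨ s - t + u - w ⟩ k ℤ.< + 0 → k ≡ t ⊎ k ≡ w
  ⟨⟩-negative s t u w {k} neg
    rewrite lookup-⟨⟩ s t u w k with s Fin.≟ k | u Fin.≟ k | t Fin.≟ k | w Fin.≟ k | neg
  ... | _     | _     | yes t≡k | _       | _        = inj₁ (≡.sym t≡k)
  ... | _     | _     | no _    | yes w≡k | _        = inj₂ (≡.sym w≡k)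
  ... | yes _ | yes _ | no _    | no _    | ℤ.+<+ ()
  ... | yes _ | no _  | no _    | no _    | ℤ.+<+ ()
  ... | no _  | yes _ | no _    | no _    | ℤ.+<+ ()
  ... | no _  | no _  | no _    | no _    | ℤ.+<+ ()

  lookup-⊖-head : ∀ {s t} → s ≢ t → Vec.lookup (s ⊖ t) s ≡ + 1
  lookup-⊖-head {s} {t} s≢t rewrite lookup-⊖ s t s with s Fin.≟ s | t Fin.≟ s
  ... | yes _  | no _    = ≡.refl
  ... | yes _  | yes t≡s = contradiction (≡.sym t≡s) s≢t
  ... | no s≢s | _       = contradiction ≡.refl s≢s

  lookup-⊖-tail : ∀ {s t} → s ≢ t → Vec.lookup (s ⊖ t) t ≡ -[1+ 0 ]
  lookup-⊖-tail {s} {t} s≢t rewrite lookup-⊖ s t t with s Fin.≟ t | t Fin.≟ t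
  ... | no _    | yes _  = ≡.refl
  ... | yes s≡t | _      = contradiction s≡t s≢t
  ... | _       | no t≢t = contradiction ≡.refl t≢t

  lookup-⟨⟩-head : ∀ {s t u w} → s ≢ t → s ≢ w →
    Vec.lookup ⟨ s - t + u - w ⟩ s ≡ (if ⌊ u Fin.≟ s ⌋ then + 2 else + 1)
  lookup-⟨⟩-head {s} {t} {u} {w} s≢t s≢w
    rewrite lookup-⟨⟩ s t u w s with s Fin.≟ s | t Fin.≟ s | u Fin.≟ s | w Fin.≟ s
  ... | no s≢s | _       | _     | _       = contradiction ≡.refl s≢s
  ... | yes _  | yes t≡s | _     | _       = contradiction (≡.sym t≡s) s≢t
  ... | yes _  | no _    | _     | yes w≡s = contradiction (≡.sym w≡s) s≢w
  ... | yes _  | no _    | yes _ | no _    = ≡.refl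
  ... | yes _  | no _    | no _  | no _    = ≡.refl

  lookup-⟨⟩-tail : ∀ {s t u w} → s ≢ t → u ≢ t →
    Vec.lookup ⟨ s - t + u - w ⟩ t ≡ (if ⌊ w Fin.≟ t ⌋ then -[1+ 1 ] else -[1+ 0 ])
  lookup-⟨⟩-tail {s} {t} {u} {w} s≢t u≢t
    rewrite lookup-⟨⟩ s t u w t with s Fin.≟ t | t Fin.≟ t | u Fin.≟ t | w Fin.≟ t
  ... | yes s≡t | _      | _       | _     = contradiction s≡t s≢t
  ... | _       | no t≢t | _       | _     = contradiction ≡.refl t≢t
  ... | _       | _      | yes u≡t | _     = contradiction u≡t u≢t
  ... | no _    | yes _  | no _    | yes _ = ≡.refl
  ... | no _    | yes _  | no _    | no _  = ≡.refl

-- Candidates for the sum of the endpoints of an edge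

-- `difference` collects the sums in which a head cancels a tail or one summand is 0. `quad`
-- collects those without cancellation, including s ≡ u and t ≡ w, where a coefficient 2 or -2
-- arises.
data Candidate (n : ℕ) : Set where
  difference : Fin n → Fin n → Candidate n
  quad       : Fin n → Fin n → Fin n → Fin n → Candidate n

module _ {n : ℕ} where

  value : Candidate n → LatticePoint n
  value (difference i j) = i ⊖ j
  value (quad s t u w)   = ⟨ s - t + u - w ⟩

  Disjoint : Fin n → Fin n → Fin n → Fin n → Set
  Disjoint s t u w = (s ≢ t × s ≢ w) × (u ≢ t × u ≢ w)

  -- A normal form on which `value` is injective: heads and tails do not cancel, and each of the
  -- unordered pairs of heads and of tails is listed in order. The last clause removes the doubles
  -- 2(eₛ - eₜ).
  Reduced : Candidate n → Set
  Reduced (difference i j) = i ≢ j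
  Reduced (quad s t u w)   = Disjoint s t u w × s Fin.≤ u × t Fin.≤ w × ¬ (s ≡ u × t ≡ w)

  private
    head-positive : ∀ (s t u w : Fin n) → s ≢ t → s ≢ w → + 0 ℤ.< Vec.lookup ⟨ s - t + u - w ⟩ s
    head-positive s t u w s≢t s≢w rewrite lookup-⟨⟩-head {u = u} s≢t s≢w with u Fin.≟ s
    ... | yes _ = ℤ.+<+ (ℕ.s≤s ℕ.z≤n)
    ... | no _  = ℤ.+<+ (ℕ.s≤s ℕ.z≤n)

    tail-negative : ∀ (s t u w : Fin n) → s ≢ t → u ≢ t → Vec.lookup ⟨ s - t + u - w ⟩ t ℤ.< + 0
    tail-negative s t u w s≢t u≢t rewrite lookup-⟨⟩-tail {w = w} s≢t u≢t with w Fin.≟ t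
    ... | yes _ = ℤ.-<+
    ... | no _  = ℤ.-<+

  disjoint-signs : ∀ s t u w → Disjoint s t u w →
    let v = ⟨ s - t + u - w ⟩ in
    (+ 0 ℤ.< Vec.lookup v s × + 0 ℤ.< Vec.lookup v u) × (Vec.lookup v t ℤ.< + 0 × Vec.lookup v w ℤ.< + 0)
  disjoint-signs s t u w ((s≢t , s≢w) , u≢t , u≢w) =
    ( head-positive s t u w s≢t s≢w
    , ≡.subst (λ (v : LatticePoint n) → + 0 ℤ.< Vec.lookup v u) (⟨⟩-comm u w s t) (head-positive u w s t u≢w u≢t))
    , ( tail-negative s t u w s≢t u≢t
      , ≡.subst (λ (v : LatticePoint n) → Vec.lookup v w ℤ.< + 0) (⟨⟩-comm u w s t) (tail-negative u w s t u≢w s≢w))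

  private
    -- The set of entries determines a sorted pair, as its minimum and maximum.
    minmax : ∀ {s u s′ u′ : Fin n} → s Fin.≤ u → s′ Fin.≤ u′ →
      s ≡ s′ ⊎ s ≡ u′ → u ≡ s′ ⊎ u ≡ u′ → s′ ≡ s ⊎ s′ ≡ u → u′ ≡ s ⊎ u′ ≡ u → s ≡ s′ × u ≡ u′
    minmax s≤u s′≤u′ s∈ u∈ s′∈ u′∈ =
        Fin.≤-antisym (lower s≤u s′∈) (lower s′≤u′ s∈)
      , Fin.≤-antisym (upper s′≤u′ u∈) (upper s≤u u′∈)
      where
      lower : ∀ {x y z : Fin n} → x Fin.≤ y → z ≡ x ⊎ z ≡ y → x Fin.≤ z
      lower x≤y (inj₁ ≡.refl) = Fin.≤-refl
      lower x≤y (inj₂ ≡.refl) = x≤y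
      upper : ∀ {x y z : Fin n} → x Fin.≤ y → z ≡ x ⊎ z ≡ y → z Fin.≤ y
      upper x≤y (inj₁ ≡.refl) = x≤y
      upper x≤y (inj₂ ≡.refl) = Fin.≤-refl

    -- A difference has at most one positive and one negative coordinate. Equality would merge both
    -- heads and both tails of the `quad`, making it a double.
    difference≢quad : ∀ i j s t u w → Reduced (quad s t u w) → ⟨ s - t + u - w ⟩ ≢ i ⊖ j
    difference≢quad i j s t u w (disjoint , _ , _ , not-double) eq with disjoint-signs s t u w disjoint
    ... | signs rewrite eq with signs
    ... | (0<s , 0<u) , t<0 , w<0 = not-double
      ( ≡.trans (⊖-positive i j 0<s) (≡.sym (⊖-positive i j 0<u))
      , ≡.trans (⊖-negative i j t<0) (≡.sym (⊖-negative i j w<0)))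

    quad-support : ∀ s t u w s′ t′ u′ w′ → Disjoint s t u w → ⟨ s - t + u - w ⟩ ≡ ⟨ s′ - t′ + u′ - w′ ⟩ →
      ((s ≡ s′ ⊎ s ≡ u′) × (u ≡ s′ ⊎ u ≡ u′)) × ((t ≡ t′ ⊎ t ≡ w′) × (w ≡ t′ ⊎ w ≡ w′))
    quad-support s t u w s′ t′ u′ w′ disjoint eq with disjoint-signs s t u w disjoint
    ... | signs rewrite eq with signs
    ... | (0<s , 0<u) , t<0 , w<0 =
        (⟨⟩-positive s′ t′ u′ w′ 0<s , ⟨⟩-positive s′ t′ u′ w′ 0<u)
      , (⟨⟩-negative s′ t′ u′ w′ t<0 , ⟨⟩-negative s′ t′ u′ w′ w<0)

  -- The positive coordinates of a value are its heads and the negative ones its tails; the sorting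
  -- then recovers the candidate from these two sets.
  value-injective : ∀ c d → Reduced c → Reduced d → value c ≡ value d → c ≡ d
  value-injective (difference i j) (difference i′ j′) i≢j _ eq = ≡.cong₂ difference
    (⊖-positive i′ j′ (≡.subst (+ 0 ℤ.<_) (≡.trans (≡.sym (lookup-⊖-head i≢j)) (≡.cong (λ (v : LatticePoint n) → Vec.lookup v i) eq)) (ℤ.+<+ (ℕ.s≤s ℕ.z≤n))))
    (⊖-negative i′ j′ (≡.subst (ℤ._< + 0) (≡.trans (≡.sym (lookup-⊖-tail i≢j)) (≡.cong (λ (v : LatticePoint n) → Vec.lookup v j) eq)) ℤ.-<+))
  value-injective (difference i j) (quad s t u w) _ red eq = contradiction (≡.sym eq) (difference≢quad i j s t u w red)
  value-injective (quad s t u w) (difference i j) red _ eq = contradiction eq (difference≢quad i j s t u w red)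
  value-injective (quad s t u w) (quad s′ t′ u′ w′) (dis , s≤u , t≤w , _) (dis′ , s≤u′ , t≤w′ , _) eq
    with quad-support s t u w s′ t′ u′ w′ dis eq | quad-support s′ t′ u′ w′ s t u w dis′ (≡.sym eq)
  ... | (s∈ , u∈) , t∈ , w∈ | (s′∈ , u′∈) , t′∈ , w′∈
    with minmax s≤u s≤u′ s∈ u∈ s′∈ u′∈ | minmax t≤w t≤w′ t∈ w∈ t′∈ w′∈
  ... | ≡.refl , ≡.refl | ≡.refl , ≡.refl = ≡.refl

  private
    double-abs : ∀ i → ℤ.∣ i ℤ.+ i ∣ ≢ 1
    double-abs (+ suc m) eq = contradiction (≡.trans (≡.sym (ℕ.+-suc m m)) (ℕ.suc-injective eq)) λ ()

  private
    -- A parity witness against doubles. The coordinate of a `quad` at s is 1 unless u ≡ s, and at t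
    -- it is -1 unless w ≡ t; both exceptions together are excluded by `Reduced`.
    odd-coordinate : ∀ c → Reduced c → ∃[ k ] ℤ.∣ Vec.lookup (value c) k ∣ ≡ 1
    odd-coordinate (difference i j) i≢j = i , ≡.cong ℤ.∣_∣ (lookup-⊖-head i≢j)
    odd-coordinate (quad s t u w) (((s≢t , s≢w) , u≢t , u≢w) , _ , _ , not-double)
      with u Fin.≟ s in eq₁ | w Fin.≟ t in eq₂
    ... | no _ | _ = s , ≡.trans (≡.cong ℤ.∣_∣ (lookup-⟨⟩-head {u = u} s≢t s≢w))
          (≡.cong (λ d → ℤ.∣ if ⌊ d ⌋ then + 2 else + 1 ∣) eq₁)
    ... | yes _ | no _ = t , ≡.trans (≡.cong ℤ.∣_∣ (lookup-⟨⟩-tail {w = w} s≢t u≢t))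
          (≡.cong (λ d → ℤ.∣ if ⌊ d ⌋ then -[1+ 1 ] else -[1+ 0 ] ∣) eq₂)
    ... | yes u≡s | yes w≡t = contradiction (≡.sym u≡s , ≡.sym w≡t) not-double

  reduced-not-double : ∀ {c} → Reduced c → ∀ v → value c ≢ v +ᴸ v
  reduced-not-double {c} red v eq =
    let k , odd = odd-coordinate c red in
    double-abs (Vec.lookup v k) (≡.trans (≡.cong ℤ.∣_∣ (≡.trans
      (≡.sym (Vec.lookup-zipWith ℤ._+_ k v v)) (≡.cong (λ (z : LatticePoint n) → Vec.lookup z k) (≡.sym eq)))) odd)

-- The number of candidates

-- The absorption identity, by induction through Pascal's rule. The constants 3 and 6 of the block
-- sizes and the bounds on binomials all come from it.
absorption : ∀ m k → suc m ℕ.* (m C k) ≡ suc k ℕ.* (suc m C suc k)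
absorption zero zero = ≡.refl
absorption zero (suc k) = ≡.sym (ℕ.*-zeroʳ (suc (suc k)))
absorption (suc m) zero = begin
  suc (suc m) ℕ.* 1                  ≡⟨ ℕ.*-identityʳ _ ⟩
  suc (suc m)                        ≡⟨ nC1≡n (suc (suc m)) ⟨
  suc (suc m) C 1                    ≡⟨ ℕ.*-identityˡ _ ⟨
  1 ℕ.* (suc (suc m) C 1)            ∎
  where open ≡.≡-Reasoning
absorption (suc m) (suc k) = begin
  suc (suc m) ℕ.* (suc m C suc k)
    ≡⟨ ≡.cong (suc m C suc k ℕ.+_) (≡.cong (suc m ℕ.*_) (nCk+nC[k+1]≡[n+1]C[k+1] m k)) ⟨
  suc m C suc k ℕ.+ suc m ℕ.* (m C k ℕ.+ m C suc k)
    ≡⟨ ≡.cong (suc m C suc k ℕ.+_) (ℕ.*-distribˡ-+ (suc m) (m C k) (m C suc k)) ⟩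
  suc m C suc k ℕ.+ (suc m ℕ.* (m C k) ℕ.+ suc m ℕ.* (m C suc k))
    ≡⟨ ≡.cong (suc m C suc k ℕ.+_) (≡.cong₂ ℕ._+_ (absorption m k) (absorption m (suc k))) ⟩
  suc m C suc k ℕ.+ (suc k ℕ.* (suc m C suc k) ℕ.+ suc (suc k) ℕ.* (suc m C suc (suc k)))
    ≡⟨ ℕ.+-assoc (suc m C suc k) (suc k ℕ.* (suc m C suc k)) _ ⟨
  suc (suc k) ℕ.* (suc m C suc k) ℕ.+ suc (suc k) ℕ.* (suc m C suc (suc k))
    ≡⟨ ℕ.*-distribˡ-+ (suc (suc k)) (suc m C suc k) (suc m C suc (suc k)) ⟨
  suc (suc k) ℕ.* (suc m C suc k ℕ.+ suc m C suc (suc k))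
    ≡⟨ ≡.cong (suc (suc k) ℕ.*_) (nCk+nC[k+1]≡[n+1]C[k+1] (suc m) (suc k)) ⟩
  suc (suc k) ℕ.* (suc (suc m) C suc (suc k)) ∎
  where open ≡.≡-Reasoning

-- A set of three nodes has three choices of the distinguished node.
n*[n-1]C2 : ∀ n → n ℕ.* ((n ∸ 1) C 2) ≡ 3 ℕ.* (n C 3)
n*[n-1]C2 zero    = ≡.refl
n*[n-1]C2 (suc m) = absorption m 2

-- A set of four nodes splits into two heads and two tails in six ways. Truncated subtraction is
-- harmless, since n C 2 vanishes for n < 2.
nC2*[n-2]C2 : ∀ n → (n C 2) ℕ.* ((n ∸ 2) C 2) ≡ 6 ℕ.* (n C 4)
nC2*[n-2]C2 zero = ≡.refl
nC2*[n-2]C2 (suc zero) = ≡.refl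
nC2*[n-2]C2 (suc (suc m)) = ℕ.*-cancelˡ-≡ _ _ 2 (begin
  2 ℕ.* ((n C 2) ℕ.* (m C 2))             ≡⟨ ℕ.*-assoc 2 (n C 2) (m C 2) ⟨
  2 ℕ.* (n C 2) ℕ.* (m C 2)               ≡⟨ ≡.cong (ℕ._* (m C 2)) (absorption (suc m) 1) ⟨
  n ℕ.* (suc m C 1) ℕ.* (m C 2)           ≡⟨ ≡.cong (λ x → n ℕ.* x ℕ.* (m C 2)) (nC1≡n (suc m)) ⟩
  n ℕ.* suc m ℕ.* (m C 2)                 ≡⟨ ℕ.*-assoc n (suc m) (m C 2) ⟩
  n ℕ.* (suc m ℕ.* (m C 2))               ≡⟨ ≡.cong (n ℕ.*_) (absorption m 2) ⟩
  n ℕ.* (3 ℕ.* (suc m C 3))               ≡⟨ shuffle n (suc m C 3) ⟩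
  3 ℕ.* (n ℕ.* (suc m C 3))               ≡⟨ ≡.cong (3 ℕ.*_) (absorption (suc m) 3) ⟩
  3 ℕ.* (4 ℕ.* (n C 4))                   ≡⟨ regroup (n C 4) ⟩
  2 ℕ.* (6 ℕ.* (n C 4))                   ∎)
  where
  open ≡.≡-Reasoning
  n = suc (suc m)
  shuffle : ∀ a b → a ℕ.* (3 ℕ.* b) ≡ 3 ℕ.* (a ℕ.* b)
  shuffle = solve-∀
  regroup : ∀ a → 3 ℕ.* (4 ℕ.* a) ≡ 2 ℕ.* (6 ℕ.* a)
  regroup = solve-∀

-- `forward` and `backward` are the differences, by the order of head and tail; `peak` has
-- coefficient 2 and `valley` coefficient -2 at the shared node; `cross` has four distinct nodes.
data Kind : Set where
  forward backward peak valley cross : Kind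

kinds : List Kind
kinds = forward ∷ backward ∷ peak ∷ valley ∷ cross ∷ []

module _ (n : ℕ) where

  block : Kind → List (Candidate n)
  block forward  = map (λ (i , j) → difference i j) (pairs (allFin n))
  block backward = map (λ (i , j) → difference j i) (pairs (allFin n))
  block peak     = concatMap (λ i → map (λ (j , k) → quad i j i k) (pairs (allFin n without i))) (allFin n)
  block valley   = concatMap (λ i → map (λ (j , k) → quad j i k i) (pairs (allFin n without i))) (allFin n)
  -- The two heads come first and the tails are taken from the n - 2 remaining nodes, so the block
  -- has product size.
  block cross    = concatMap (λ (i , j) → map (λ (k , l) → quad i k j l)
                                              (pairs ((allFin n without i) without j)))
                             (pairs (allFin n))

  candidates : List (Candidate n)
  candidates = concatMap block kinds

  -- A description of the blocks free of their enumeration; reducedness, the kind and the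
  -- probability of a candidate are read off from it.
  data Shape : Kind → Candidate n → Set where
    forward  : ∀ {i j} → i Fin.< j → Shape forward (difference i j)
    backward : ∀ {i j} → j Fin.< i → Shape backward (difference i j)
    peak     : ∀ {i j k} → i ≢ j → i ≢ k → j Fin.< k → Shape peak (quad i j i k)
    valley   : ∀ {i j k} → i ≢ j → i ≢ k → j Fin.< k → Shape valley (quad j i k i)
    cross    : ∀ {s t u w} → s Fin.< u → t Fin.< w → Disjoint s t u w → Shape cross (quad s t u w)

  private
    without-< : ∀ i → AllPairs Fin._<_ (allFin n without i)
    without-< i = allPairs-without i allFin-<

    without²-< : ∀ i j → AllPairs Fin._<_ ((allFin n without i) without j)
    without²-< i j = allPairs-without j (without-< i)

    concatMap⁻ : ∀ {A B : Set} (f : A → List B) xs {y} → y ∈ concatMap f xs → ∃[ x ] x ∈ xs × y ∈ f x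
    concatMap⁻ f xs y∈ = find (∈-concatMap⁻ f {xs} y∈)

    concatMap⁺ : ∀ {A B : Set} (f : A → List B) {xs x y} → x ∈ xs → y ∈ f x → y ∈ concatMap f xs
    concatMap⁺ f x∈ y∈ = ∈-concatMap⁺ f (lose x∈ y∈)

    pair-without : ∀ i {j k} → (j , k) ∈ pairs (allFin n without i) → i ≢ j × i ≢ k × j Fin.< k
    pair-without i p = let j∈ , k∈ = ∈-pairs⁻ (allFin n without i) p in
        ≡.≢-sym (proj₂ (∈-without⁻ (allFin n) j∈)) , ≡.≢-sym (proj₂ (∈-without⁻ (allFin n) k∈))
      , pairs-related (allFin n without i) (without-< i) p

  block-shape : ∀ κ {c} → c ∈ block κ → Shape κ c
  block-shape forward c∈ with ∈-map⁻ _ c∈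
  ... | (i , j) , p , ≡.refl = forward (pairs-related (allFin n) allFin-< p)
  block-shape backward c∈ with ∈-map⁻ _ c∈
  ... | (i , j) , p , ≡.refl = backward (pairs-related (allFin n) allFin-< p)
  block-shape peak c∈ with concatMap⁻ _ (allFin n) c∈
  ... | i , _ , q with ∈-map⁻ _ q
  ... | (j , k) , p , ≡.refl = let i≢j , i≢k , j<k = pair-without i p in peak i≢j i≢k j<k
  block-shape valley c∈ with concatMap⁻ _ (allFin n) c∈
  ... | i , _ , q with ∈-map⁻ _ q
  ... | (j , k) , p , ≡.refl = let i≢j , i≢k , j<k = pair-without i p in valley i≢j i≢k j<k
  block-shape cross c∈ with concatMap⁻ _ (pairs (allFin n)) c∈
  ... | (i , j) , ij∈ , q with ∈-map⁻ _ q
  ... | (k , l) , p , ≡.refl =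
    let k∈ , l∈ = ∈-pairs⁻ ((allFin n without i) without j) p
        k∈′ , k≢j = ∈-without⁻ (allFin n without i) k∈
        l∈′ , l≢j = ∈-without⁻ (allFin n without i) l∈
    in cross (pairs-related (allFin n) allFin-< ij∈)
             (pairs-related ((allFin n without i) without j) (without²-< i j) p)
         ( (≡.≢-sym (proj₂ (∈-without⁻ (allFin n) k∈′)) , ≡.≢-sym (proj₂ (∈-without⁻ (allFin n) l∈′)))
         , (≡.≢-sym k≢j , ≡.≢-sym l≢j))

  shape⇒∈block : ∀ {κ c} → Shape κ c → c ∈ block κ
  shape⇒∈block (forward i<j)  = ∈-map⁺ _ (<⇒pair allFin-< (∈-allFin _) (∈-allFin _) i<j)
  shape⇒∈block (backward j<i) = ∈-map⁺ _ (<⇒pair allFin-< (∈-allFin _) (∈-allFin _) j<i)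
  shape⇒∈block (peak {i} i≢j i≢k j<k) = concatMap⁺ _ (∈-allFin i) (∈-map⁺ _ (<⇒pair (without-< i)
    (∈-without⁺ (∈-allFin _) (≡.≢-sym i≢j)) (∈-without⁺ (∈-allFin _) (≡.≢-sym i≢k)) j<k))
  shape⇒∈block (valley {i} i≢j i≢k j<k) = concatMap⁺ _ (∈-allFin i) (∈-map⁺ _ (<⇒pair (without-< i)
    (∈-without⁺ (∈-allFin _) (≡.≢-sym i≢j)) (∈-without⁺ (∈-allFin _) (≡.≢-sym i≢k)) j<k))
  shape⇒∈block (cross {s} {t} {u} {w} s<u t<w ((s≢t , s≢w) , u≢t , u≢w)) =
    concatMap⁺ _ (<⇒pair allFin-< (∈-allFin s) (∈-allFin u) s<u) (∈-map⁺ _ (<⇒pair (without²-< s u)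
      (∈-without⁺ (∈-without⁺ (∈-allFin t) (≡.≢-sym s≢t)) (≡.≢-sym u≢t))
      (∈-without⁺ (∈-without⁺ (∈-allFin w) (≡.≢-sym s≢w)) (≡.≢-sym u≢w)) t<w))

  shape-reduced : ∀ {κ c} → Shape κ c → Reduced c
  shape-reduced (forward i<j)  = Fin.<⇒≢ i<j
  shape-reduced (backward j<i) = ≡.≢-sym (Fin.<⇒≢ j<i)
  shape-reduced (peak i≢j i≢k j<k) =
    ((i≢j , i≢k) , i≢j , i≢k) , Fin.≤-refl , ℕ.<⇒≤ j<k , λ (_ , j≡k) → Fin.<⇒≢ j<k j≡k
  shape-reduced (valley i≢j i≢k j<k) =
    ((≡.≢-sym i≢j , ≡.≢-sym i≢j) , ≡.≢-sym i≢k , ≡.≢-sym i≢k) , ℕ.<⇒≤ j<k , Fin.≤-refl , λ (j≡k , _) → Fin.<⇒≢ j<k j≡k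
  shape-reduced (cross s<u t<w disjoint) = disjoint , ℕ.<⇒≤ s<u , ℕ.<⇒≤ t<w , λ (s≡u , _) → Fin.<⇒≢ s<u s≡u

  reduced-shape : ∀ c → Reduced c → ∃[ κ ] Shape κ c
  reduced-shape (difference i j) i≢j with ℕ.≤-total (Fin.toℕ i) (Fin.toℕ j)
  ... | inj₁ i≤j = forward , forward (Fin.≤∧≢⇒< i≤j i≢j)
  ... | inj₂ j≤i = backward , backward (Fin.≤∧≢⇒< j≤i (≡.≢-sym i≢j))
  reduced-shape (quad s t u w) (disjoint@((s≢t , s≢w) , u≢t , u≢w) , s≤u , t≤w , not-double)
    with s Fin.≟ u | t Fin.≟ w
  ... | yes ≡.refl | yes ≡.refl = contradiction (≡.refl , ≡.refl) not-double
  ... | yes ≡.refl | no t≢w     = peak , peak s≢t s≢w (Fin.≤∧≢⇒< t≤w t≢w)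
  ... | no s≢u     | yes ≡.refl = valley , valley (≡.≢-sym s≢t) (≡.≢-sym u≢t) (Fin.≤∧≢⇒< s≤u s≢u)
  ... | no s≢u     | no t≢w     = cross , cross (Fin.≤∧≢⇒< s≤u s≢u) (Fin.≤∧≢⇒< t≤w t≢w) disjoint

  candidates-reduced : ∀ {c} → c ∈ candidates → Reduced c
  candidates-reduced c∈ with concatMap⁻ block kinds c∈
  ... | κ , _ , c∈κ = shape-reduced (block-shape κ c∈κ)

  reduced⇒candidate : ∀ {c} → Reduced c → c ∈ candidates
  reduced⇒candidate {c} red with reduced-shape c red
  ... | κ , shape = concatMap⁺ block (κ∈ κ) (shape⇒∈block shape)
    where
    κ∈ : ∀ κ → κ ∈ kinds
    κ∈ forward  = here ≡.refl
    κ∈ backward = there (here ≡.refl)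
    κ∈ peak     = there (there (here ≡.refl))
    κ∈ valley   = there (there (there (here ≡.refl)))
    κ∈ cross    = there (there (there (there (here ≡.refl))))

  private
    -- The key that separates the blocks in `unique-concatMap`; only its values on candidates with a
    -- `Shape` matter.
    kind : Candidate n → Kind
    kind (difference i j) with i Fin.<? j
    ... | yes _ = forward
    ... | no _  = backward
    kind (quad s t u w) with s Fin.≟ u | t Fin.≟ w
    ... | yes _ | _     = peak
    ... | no _  | yes _ = valley
    ... | no _  | no _  = cross

    shape-kind : ∀ {κ c} → Shape κ c → kind c ≡ κ
    shape-kind {c = difference i j} (forward i<j) with i Fin.<? j
    ... | yes _  = ≡.refl
    ... | no i≮j = contradiction i<j i≮j
    shape-kind {c = difference i j} (backward j<i) with i Fin.<? j
    ... | yes i<j = contradiction i<j (Fin.<-asym j<i)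
    ... | no _    = ≡.refl
    shape-kind {c = quad i j i k} (peak _ _ _) with i Fin.≟ i
    ... | yes _  = ≡.refl
    ... | no i≢i = contradiction ≡.refl i≢i
    shape-kind {c = quad j i k i} (valley _ _ j<k) with j Fin.≟ k | i Fin.≟ i
    ... | yes j≡k | _      = contradiction j≡k (Fin.<⇒≢ j<k)
    ... | no _    | yes _  = ≡.refl
    ... | no _    | no i≢i = contradiction ≡.refl i≢i
    shape-kind {c = quad s t u w} (cross s<u t<w _) with s Fin.≟ u | t Fin.≟ w
    ... | yes s≡u | _       = contradiction s≡u (Fin.<⇒≢ s<u)
    ... | no _    | yes t≡w = contradiction t≡w (Fin.<⇒≢ t<w)
    ... | no _    | no _    = ≡.refl

    first second : Candidate n → Fin n
    first (difference i j) = i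
    first (quad s t u w)   = s
    second (difference i j) = j
    second (quad s t u w)   = t

    unique-pairs-allFin : Unique (pairs (allFin n))
    unique-pairs-allFin = unique-pairs (Unique.allFin⁺ n)

    unique-without : ∀ i → Unique (allFin n without i)
    unique-without i = Unique.filter⁺ _ (Unique.allFin⁺ n)

  unique-block : ∀ κ → Unique (block κ)
  unique-block forward  = Unique.map⁺ (λ { ≡.refl → ≡.refl }) unique-pairs-allFin
  unique-block backward = Unique.map⁺ (λ { ≡.refl → ≡.refl }) unique-pairs-allFin
  unique-block peak = unique-concatMap _ first (Unique.allFin⁺ n)
    (λ i → Unique.map⁺ (λ { ≡.refl → ≡.refl }) (unique-pairs (unique-without i)))
    λ c∈ → case ∈-map⁻ _ c∈ of λ { (_ , _ , ≡.refl) → ≡.refl }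
  unique-block valley = unique-concatMap _ second (Unique.allFin⁺ n)
    (λ i → Unique.map⁺ (λ { ≡.refl → ≡.refl }) (unique-pairs (unique-without i)))
    λ c∈ → case ∈-map⁻ _ c∈ of λ { (_ , _ , ≡.refl) → ≡.refl }
  unique-block cross = unique-concatMap _ (λ c → first c , third c) unique-pairs-allFin
    (λ (i , j) → Unique.map⁺ (λ { ≡.refl → ≡.refl }) (unique-pairs (Unique.filter⁺ _ (unique-without i))))
    λ c∈ → case ∈-map⁻ _ c∈ of λ { (_ , _ , ≡.refl) → ≡.refl }
    where
    third : Candidate n → Fin n
    -- A filler value: the block `cross` consists of `quad`s.
    third (difference i j) = i
    third (quad s t u w)   = u

  unique-candidates : Unique candidates
  unique-candidates = unique-concatMap block kind unique-kinds unique-block (shape-kind ∘ block-shape _)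
    where
    unique-kinds : Unique kinds
    unique-kinds = ((λ ()) ∷ (λ ()) ∷ (λ ()) ∷ (λ ()) ∷ []) ∷ ((λ ()) ∷ (λ ()) ∷ (λ ()) ∷ [])
      ∷ ((λ ()) ∷ (λ ()) ∷ []) ∷ ((λ ()) ∷ []) ∷ [] ∷ []

  private
    length-allFin-without : ∀ i → length (allFin n without i) ≡ n ∸ 1
    length-allFin-without i = ≡.cong (_∸ 1) {x = suc (length (allFin n without i))} {y = n}
      (≡.trans (length-without (Unique.allFin⁺ n) (∈-allFin i)) (List.length-tabulate id))

  length-allFin-without² : ∀ {i j} → i ≢ j → length ((allFin n without i) without j) ≡ n ∸ 2
  length-allFin-without² {i} {j} i≢j = begin
    length ((allFin n without i) without j)
      ≡⟨ ≡.cong (_∸ 1) (length-without (unique-without i) (∈-without⁺ (∈-allFin j) (≡.≢-sym i≢j))) ⟩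
    length (allFin n without i) ∸ 1     ≡⟨ ≡.cong (_∸ 1) (length-allFin-without i) ⟩
    n ∸ 1 ∸ 1                           ≡⟨ ℕ.∸-+-assoc n 1 1 ⟩
    n ∸ 2                               ∎
    where open ≡.≡-Reasoning

  private
    length-pairs-allFin : length (pairs (allFin n)) ≡ n C 2
    length-pairs-allFin = ≡.trans (length-pairs (allFin n)) (≡.cong (_C 2) (List.length-tabulate {n = n} id))

  blockSize : Kind → ℕ
  blockSize forward  = n C 2
  blockSize backward = n C 2
  blockSize peak     = 3 ℕ.* (n C 3)
  blockSize valley   = 3 ℕ.* (n C 3)
  blockSize cross    = 6 ℕ.* (n C 4)

  length-block : ∀ κ → length (block κ) ≡ blockSize κ
  length-block forward  = ≡.trans (List.length-map _ (pairs (allFin n))) length-pairs-allFin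
  length-block backward = ≡.trans (List.length-map _ (pairs (allFin n))) length-pairs-allFin
  length-block peak = ≡.trans (length-concatMap (allFin n) _ {(n ∸ 1) C 2} (λ {i} _ →
      ≡.trans (List.length-map _ (pairs (allFin n without i)))
        (≡.trans (length-pairs (allFin n without i)) (≡.cong (_C 2) (length-allFin-without i)))))
    (≡.trans (≡.cong (ℕ._* ((n ∸ 1) C 2)) (List.length-tabulate {n = n} id)) (n*[n-1]C2 n))
  length-block valley = ≡.trans (length-concatMap (allFin n) _ {(n ∸ 1) C 2} (λ {i} _ →
      ≡.trans (List.length-map _ (pairs (allFin n without i)))
        (≡.trans (length-pairs (allFin n without i)) (≡.cong (_C 2) (length-allFin-without i)))))
    (≡.trans (≡.cong (ℕ._* ((n ∸ 1) C 2)) (List.length-tabulate {n = n} id)) (n*[n-1]C2 n))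
  length-block cross = ≡.trans (length-concatMap (pairs (allFin n)) _ {(n ∸ 2) C 2} each)
    (≡.trans (≡.cong (ℕ._* ((n ∸ 2) C 2)) length-pairs-allFin) (nC2*[n-2]C2 n))
    where
    each : ∀ {ij} → ij ∈ pairs (allFin n) →
      length (map (λ (k , l) → quad (proj₁ ij) k (proj₂ ij) l) (pairs ((allFin n without proj₁ ij) without proj₂ ij))) ≡ (n ∸ 2) C 2
    each {i , j} ij∈ = ≡.trans (List.length-map _ (pairs ((allFin n without i) without j)))
      (≡.trans (length-pairs ((allFin n without i) without j)) (≡.cong (_C 2)
        (length-allFin-without² (Fin.<⇒≢ (pairs-related (allFin n) allFin-< ij∈)))))

-- Sums of two vectors of the form eₛ - eₜ with s = t or st an arc

module _ {n : ℕ} (G : Graph n) where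

  -- The middle node k ranges over all nodes: k ≡ i and k ≡ j contribute nothing, as there are no
  -- loops. For s ≡ u or t ≡ w the two alternatives of a `quad` express the same condition.
  present : Candidate n → Bool
  present (difference i j) = adj G i j ∨ any (λ k → adj G i k ∧ adj G k j) (allFin n)
  present (quad s t u w)   = (adj G s t ∧ adj G u w) ∨ (adj G s w ∧ adj G u t)

  -- The set A of the overview; the case s ≡ t is the origin, which is written `s ⊖ s` for any node
  -- s.
  Root : LatticePoint n → Set
  Root v = ∃[ s ] ∃[ t ] (s ≡ t ⊎ T (adj G s t)) × v ≡ s ⊖ t

  private
    ∨⁻ : ∀ {x y} → T (x ∨ y) → T x ⊎ T y
    ∨⁻ = Equivalence.to Bool.T-∨
    ∧⁻ : ∀ {x y} → T (x ∧ y) → T x × T y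
    ∧⁻ = Equivalence.to Bool.T-∧
    ∨⁺ : ∀ {x y} → T x ⊎ T y → T (x ∨ y)
    ∨⁺ = Equivalence.from Bool.T-∨
    ∧⁺ : ∀ {x y} → T x × T y → T (x ∧ y)
    ∧⁺ = Equivalence.from Bool.T-∧

  present⇒sum : ∀ c → T (present c) → ∃[ v ] ∃[ w ] Root v × Root w × value c ≡ v +ᴸ w
  present⇒sum (difference i j) p with ∨⁻ p
  ... | inj₁ ij = i ⊖ j , i ⊖ i , (i , j , inj₂ ij , ≡.refl) , (i , i , inj₁ ≡.refl , ≡.refl)
                , ≡.sym (⟨⟩-refl i j i)
  ... | inj₂ q with find (Any.any⁻ _ (allFin n) q)
  ... | k , _ , r with ∧⁻ r
  ... | ik , kj = i ⊖ k , k ⊖ j , (i , k , inj₂ ik , ≡.refl) , (k , j , inj₂ kj , ≡.refl)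
                , ≡.sym (⟨⟩-cancel i k j)
  present⇒sum (quad s t u w) p with ∨⁻ p
  ... | inj₁ q = let st , uw = ∧⁻ q in
    s ⊖ t , u ⊖ w , (s , t , inj₂ st , ≡.refl) , (u , w , inj₂ uw , ≡.refl) , ≡.refl
  ... | inj₂ q = let sw , ut = ∧⁻ q in
    s ⊖ w , u ⊖ t , (s , w , inj₂ sw , ≡.refl) , (u , t , inj₂ ut , ≡.refl) , ⟨⟩-swap s t u w

  Represented : LatticePoint n → Set
  Represented z = ∃[ c ] Reduced c × T (present c) × value c ≡ z

  private
    adj-distinct : ∀ {s t} → T (adj G s t) → s ≢ t
    adj-distinct {s} st ≡.refl = ≡.subst T (adj-irrefl G s) st

    arc-represented : ∀ s t → T (adj G s t) → Represented (s ⊖ t)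
    arc-represented s t st = difference s t , adj-distinct st , ∨⁺ (inj₁ st) , ≡.refl

    path-represented : ∀ s t u → s ≢ u → T (adj G s t) → T (adj G t u) → Represented (s ⊖ u)
    path-represented s t u s≢u st tu = difference s u , s≢u
      , ∨⁺ (inj₂ (Any.any⁺ _ (lose (∈-allFin t) (∧⁺ (st , tu))))) , ≡.refl

    -- Sorting the heads and the tails leaves the matching intact if both or neither are exchanged.
    -- If exactly one pair is exchanged, the arcs st and uw satisfy the second alternative of
    -- `present`.
    quad-represented : ∀ s t u w → Disjoint s t u w → ¬ (s ≡ u × t ≡ w) →
      T (adj G s t) → T (adj G u w) → Represented ⟨ s - t + u - w ⟩
    quad-represented s t u w ((s≢t , s≢w) , u≢t , u≢w) not-double st uw
      with Fin.≤-total s u | Fin.≤-total t w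
    ... | inj₁ s≤u | inj₁ t≤w = quad s t u w , (((s≢t , s≢w) , u≢t , u≢w) , s≤u , t≤w , not-double)
          , ∨⁺ (inj₁ (∧⁺ (st , uw))) , ≡.refl
    ... | inj₁ s≤u | inj₂ w≤t = quad s w u t
          , (((s≢w , s≢t) , u≢w , u≢t) , s≤u , w≤t , λ (s≡u , w≡t) → not-double (s≡u , ≡.sym w≡t))
          , ∨⁺ {adj G s w ∧ adj G u t} (inj₂ (∧⁺ (st , uw))) , ⟨⟩-swap s w u t
    ... | inj₂ u≤s | inj₁ t≤w = quad u t s w
          , (((u≢t , u≢w) , s≢t , s≢w) , u≤s , t≤w , λ (u≡s , t≡w) → not-double (≡.sym u≡s , t≡w))
          , ∨⁺ {adj G u t ∧ adj G s w} (inj₂ (∧⁺ (uw , st))) , ≡.trans (⟨⟩-comm u t s w) (⟨⟩-swap s w u t)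
    ... | inj₂ u≤s | inj₂ w≤t = quad u w s t
          , (((u≢w , u≢t) , s≢w , s≢t) , u≤s , w≤t , λ (u≡s , w≡t) → not-double (≡.sym u≡s , ≡.sym w≡t))
          , ∨⁺ (inj₁ (∧⁺ (uw , st))) , ⟨⟩-comm u w s t

  -- A head that meets a tail is the middle node of a path and cancels. The hypothesis v ≢ w rules
  -- out 0 + 0 and doubles; the last one rules out opposite roots, where both ends cancel.
  sum⇒represented : ∀ {v w} → Root v → Root w → v ≢ w → (∀ s → v +ᴸ w ≢ s ⊖ s) → Represented (v +ᴸ w)
  sum⇒represented (s , t , inj₁ ≡.refl , ≡.refl) (u , w , inj₁ ≡.refl , ≡.refl) v≢w v+w≢0 =
    contradiction (⊖-self s u) v≢w
  sum⇒represented (s , t , inj₁ ≡.refl , ≡.refl) (u , w , inj₂ uw , ≡.refl) v≢w v+w≢0 =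
    ≡.subst Represented (≡.sym (≡.trans (⟨⟩-comm s s u w) (⟨⟩-refl u w s))) (arc-represented u w uw)
  sum⇒represented (s , t , inj₂ st , ≡.refl) (u , w , inj₁ ≡.refl , ≡.refl) v≢w v+w≢0 =
    ≡.subst Represented (≡.sym (⟨⟩-refl s t u)) (arc-represented s t st)
  sum⇒represented (s , t , inj₂ st , ≡.refl) (u , w , inj₂ uw , ≡.refl) v≢w v+w≢0
    with s Fin.≟ w | t Fin.≟ u
  ... | yes ≡.refl | _ = ≡.subst Represented (≡.sym eq)
        (path-represented u s t (λ { ≡.refl → v+w≢0 u eq }) uw st)
        where eq = ≡.trans (⟨⟩-comm s t u s) (⟨⟩-cancel u s t)
  ... | no s≢w | yes ≡.refl = ≡.subst Represented (≡.sym (⟨⟩-cancel s t w))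
        (path-represented s t w s≢w st uw)
  ... | no s≢w | no t≢u = quad-represented s t u w
        ((adj-distinct st , s≢w) , ≡.≢-sym t≢u , adj-distinct uw)
        (λ { (≡.refl , ≡.refl) → v≢w ≡.refl }) st uw

-- The symmetric edge polytope and the edges of its unimodular triangulations

allPairs-deduplicate : ∀ {a ℓ} {A : Set a} {R : A → A → Set ℓ} (R? : B.Decidable R) xs →
                       AllPairs (λ x y → ¬ R x y) (deduplicate R? xs)
allPairs-deduplicate R? []       = []
allPairs-deduplicate R? (x ∷ xs) =
  All.all-filter _ (deduplicate R? xs) ∷ AllPairs.filter⁺ _ (allPairs-deduplicate R? xs)

sumEdge : ∀ {n} → LatticePoint n × LatticePoint n → LatticePoint n
sumEdge (v , w) = v +ᴸ w

sumEdge-cong : ∀ {n} {x y : LatticePoint n × LatticePoint n} → SameEdge x y → sumEdge x ≡ sumEdge y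
sumEdge-cong (inj₁ (≡.refl , ≡.refl)) = ≡.refl
sumEdge-cong {x = v , w} (inj₂ (≡.refl , ≡.refl)) = +ᴸ-comm v w

-- The graph enters through `present` alone, so this is a sum of indicators over a list that depends
-- only on n.
edgeCount : ∀ {n} → Graph n → ℕ
edgeCount {n} G = length (filter (T? ∘ present G) (candidates n))

generator⁻ : ∀ {n} (G : Graph n) {v} → v ∈ generators G → ∃[ s ] ∃[ t ] T (adj G s t) × v ≡ s ⊖ t
generator⁻ {n} G v∈ with find (∈-concatMap⁻ _ {allFin n} v∈)
... | s , _ , q with find (∈-concatMap⁻ _ {allFin n} q)
... | t , _ , r with adj G s t in eq | r
... | true | here ≡.refl = s , t , ≡.subst T (≡.sym eq) _ , ≡.refl

generator⁺ : ∀ {n} (G : Graph n) s t → T (adj G s t) → s ⊖ t ∈ generators G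
generator⁺ G s t st = ∈-concatMap⁺ _ (lose (∈-allFin s) (∈-concatMap⁺ _ (lose (∈-allFin t) (self (adj G s t) st))))
  where
  self : ∀ x → T x → s ⊖ t ∈ (if x then (e s -ᴸ e t) ∷ [] else [])
  self true _ = here ≡.refl

module _ {n : ℕ} where

  lookup-⊖≤1 : ∀ (s t k : Fin n) → Vec.lookup (s ⊖ t) k ℤ.≤ + 1
  lookup-⊖≤1 s t k rewrite lookup-⊖ s t k with s Fin.≟ k | t Fin.≟ k
  ... | yes _ | yes _ = ℤ.+≤+ ℕ.z≤n
  ... | yes _ | no _  = ℤ.+≤+ (ℕ.s≤s ℕ.z≤n)
  ... | no _  | yes _ = ℤ.-≤+
  ... | no _  | no _  = ℤ.+≤+ ℕ.z≤n

  lookup-⊖-neg : ∀ (s t k : Fin n) → Vec.lookup (s ⊖ t) k ≡ ℤ.- Vec.lookup (t ⊖ s) k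
  lookup-⊖-neg s t k rewrite lookup-⊖ s t k | lookup-⊖ t s k with s Fin.≟ k | t Fin.≟ k
  ... | yes _ | yes _ = ≡.refl
  ... | yes _ | no _  = ≡.refl
  ... | no _  | yes _ = ≡.refl
  ... | no _  | no _  = ≡.refl

  lookup-⊖-self : ∀ (s k : Fin n) → Vec.lookup (s ⊖ s) k ≡ + 0
  lookup-⊖-self s k = ≡.trans (lookup-⊖ s s k) (ℤ.+-inverseʳ (if ⌊ s Fin.≟ k ⌋ then + 1 else + 0))

  ⊖-self-+ : ∀ (s : Fin n) → (s ⊖ s) +ᴸ (s ⊖ s) ≡ s ⊖ s
  ⊖-self-+ s = ⟨⟩-refl s s s

-- Lattice points of the symmetric edge polytope

module _ {c ℓ₁ ℓ₂} (F : OrderedField c ℓ₁ ℓ₂) where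
  open OrderedField F hiding (zero)
  open Over F
  open OrderedFieldProperties F
  open Solver
  open Sums F
  open Algebra.Properties.Semiring.Sum semiring
    using (sum-cong-≋; *-distribˡ-sum; *-distribʳ-sum; ∑-distrib-+)
  private
    module S = IsStrictTotalOrder isStrictTotalOrder
    module ≈-Reasoning = Relation.Binary.Reasoning.Setoid setoid

  sum-nonneg : ∀ {m} (g : Fin m → Carrier) → (∀ i → 0# ≤ g i) → 0# ≤ sum g
  sum-nonneg {zero}  g 0≤g = ≤-refl
  sum-nonneg {suc m} g 0≤g = +-nonneg (0≤g zero) (sum-nonneg (g ∘ suc) (0≤g ∘ suc))

  sum-positive : ∀ {m} (g : Fin m → Carrier) → (∀ i → 0# ≤ g i) → ∀ i → 0# < g i → 0# < sum g
  sum-positive g 0≤g zero    0<gi = +-pos-nonneg 0<gi (sum-nonneg (g ∘ suc) (0≤g ∘ suc))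
  sum-positive g 0≤g (suc i) 0<gi = +-nonneg-pos (0≤g zero) (sum-positive (g ∘ suc) (0≤g ∘ suc) i 0<gi)

  sum-active : ∀ {m} (g : Fin m → Carrier) → (∀ i → 0# ≤ g i) → ¬ sum g ≈ 0# → ∃[ i ] 0# < g i
  sum-active {zero} g 0≤g ≉0 = contradiction refl ≉0
  sum-active {suc m} g 0≤g ≉0 with 0≤g zero
  ... | inj₁ 0<g = zero , 0<g
  ... | inj₂ 0≈g with sum-active (g ∘ suc) (0≤g ∘ suc) (λ eq → ≉0 (trans (+-cong (sym 0≈g) eq) (+-identityʳ 0#)))
  ...   | i , 0<g = suc i , 0<g

  fromℤ-mono-≤ : ∀ {i j} → i ℤ.≤ j → fromℤ i ≤ fromℤ j
  fromℤ-mono-≤ {i} {j} i≤j = 0≤-⇒≤ (≤-respʳ (fromℤ-- j i) (nonneg (ℤ.i≤j⇒0≤j-i i≤j)))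
    where
    nonneg : ∀ {k} → + 0 ℤ.≤ k → 0# ≤ fromℤ k
    nonneg (ℤ.+≤+ {n = m} _) = fromℕ-nonneg m

  fromℤ-mono-< : ∀ {i j} → i ℤ.< j → fromℤ i < fromℤ j
  fromℤ-mono-< {i} {j} i<j with fromℤ-mono-≤ (ℤ.<⇒≤ i<j)
  ... | inj₁ lt = lt
  ... | inj₂ eq = contradiction (fromℤ-injective eq) (ℤ.<⇒≢ i<j)

  fromℤ-cancel-< : ∀ {i j} → fromℤ i < fromℤ j → i ℤ.< j
  fromℤ-cancel-< {i} {j} lt with i ℤ.<? j
  ... | yes i<j = i<j
  ... | no i≮j  = contradiction (fromℤ-mono-≤ (ℤ.≮⇒≥ i≮j)) (<⇒≱ lt)

  private
    slack : ∀ w f → w * (1# - f) ≈ w + - 1# * (w * f)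
    slack = solve 2 (λ w f → w :* (con (+ 1) :- f) := w :+ (:- con (+ 1)) :* (w :* f)) refl

    slack′ : ∀ z → 1# + - 1# * z ≈ 1# - z
    slack′ = solve 1 (λ z → con (+ 1) :+ (:- con (+ 1)) :* z := con (+ 1) :- z) refl

  -- The mean z is a positive integer, so at least 1. Hence the mean of the nonnegative slacks 1 - f
  -- i is at most 0, and no slack of positive weight can be positive.
  extremal-weights : ∀ {m} (w : Fin m → Carrier) (f : Fin m → ℤ) {z} →
    (∀ i → 0# ≤ w i) → sum w ≈ 1# → (∀ i → f i ℤ.≤ + 1) → + 0 ℤ.< z →
    sum (λ i → w i * fromℤ (f i)) ≈ fromℤ z → ∀ i → 0# < w i → f i ≡ + 1
  extremal-weights {m} w f {z} 0≤w total f≤1 0<z eq i 0<wi with f i ℤ.≟ + 1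
  ... | yes fi≡1 = fi≡1
  ... | no fi≢1 = contradiction 1-z≤0 (<⇒≱ 0<1-z)
    where
    g : Fin m → Carrier
    g j = w j * (1# - fromℤ (f j))
    one : fromℤ (+ 1) ≈ 1#
    one = +-identityʳ 1#
    0≤1-f : ∀ j → 0# ≤ 1# - fromℤ (f j)
    0≤1-f j = ≤⇒0≤- (≤-respʳ one (fromℤ-mono-≤ (f≤1 j)))
    0<gi : 0# < g i
    0<gi = *-positive 0<wi (<⇒0<- (S.<-respʳ-≈ one (fromℤ-mono-< (ℤ.≤∧≢⇒< (f≤1 i) fi≢1))))
    sum-g : sum g ≈ 1# - fromℤ z
    sum-g = begin
      sum g
        ≈⟨ sum-cong-≋ {m} (λ j → slack (w j) (fromℤ (f j))) ⟩
      sum (λ j → w j + - 1# * (w j * fromℤ (f j)))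
        ≈⟨ ∑-distrib-+ {m} w (λ j → - 1# * (w j * fromℤ (f j))) ⟩
      sum w + sum (λ j → - 1# * (w j * fromℤ (f j)))
        ≈⟨ +-cong total (trans (sym (*-distribˡ-sum {m} (- 1#) (λ j → w j * fromℤ (f j)))) (*-congˡ eq)) ⟩
      1# + - 1# * fromℤ z
        ≈⟨ slack′ (fromℤ z) ⟩
      1# - fromℤ z ∎
      where open ≈-Reasoning
    0<1-z : 0# < 1# - fromℤ z
    0<1-z = S.<-respʳ-≈ sum-g (sum-positive g (λ j → *-nonneg (0≤w j) (0≤1-f j)) i 0<gi)
    1-z≤0 : 1# - fromℤ z ≤ 0#
    1-z≤0 = ≤-respʳ (-‿inverseʳ _) (+-monoˡ-≤ (- fromℤ z) (≤-respˡ one (fromℤ-mono-≤ (ℤ.i<j⇒suc[i]≤j 0<z))))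

  private
    negate : ∀ u v → u * - v ≈ - 1# * (u * v)
    negate = solve 2 (λ u v → u :* (:- v) := (:- con (+ 1)) :* (u :* v)) refl

    negate′ : ∀ u → - 1# * u ≈ - u
    negate′ = solve 1 (λ u → (:- con (+ 1)) :* u := :- u) refl

  -- Exchanging heads and tails negates the combination, which turns statements about entries 1 into
  -- statements about entries -1.
  opposite-combination : ∀ {m n} (w : Fin m → Carrier) (a b : Fin m → Fin n) {k y} →
    sum (λ j → w j * fromℤ (Vec.lookup (a j ⊖ b j) k)) ≈ fromℤ y →
    sum (λ j → w j * fromℤ (Vec.lookup (b j ⊖ a j) k)) ≈ fromℤ (ℤ.- y)
  opposite-combination {m} w a b {k} {y} eq = begin
    sum (λ j → w j * fromℤ (Vec.lookup (b j ⊖ a j) k))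
      ≈⟨ sum-cong-≋ {m} (λ j → trans
           (*-congˡ (trans (reflexive (≡.cong fromℤ (lookup-⊖-neg (b j) (a j) k)))
                           (fromℤ-neg (Vec.lookup (a j ⊖ b j) k))))
           (negate (w j) (fromℤ (Vec.lookup (a j ⊖ b j) k)))) ⟩
    sum (λ j → - 1# * (w j * fromℤ (Vec.lookup (a j ⊖ b j) k)))
      ≈⟨ *-distribˡ-sum {m} (- 1#) (λ j → w j * fromℤ (Vec.lookup (a j ⊖ b j) k)) ⟨
    - 1# * sum (λ j → w j * fromℤ (Vec.lookup (a j ⊖ b j) k))
      ≈⟨ trans (*-congˡ eq) (negate′ (fromℤ y)) ⟩
    - fromℤ y
      ≈⟨ fromℤ-neg y ⟨
    fromℤ (ℤ.- y) ∎
    where open ≈-Reasoning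

  -- A convex combination of the vectors a j - b j with an integral positive
  -- coordinate s: every vector of positive weight has its entry +1 at s, hence also
  -- its entry -1 at a common position t.
  positive-coordinate : ∀ {m n} (w : Fin m → Carrier) (a b : Fin m → Fin n) (x : Fin n → ℤ) →
    (∀ i → 0# ≤ w i) → sum w ≈ 1# → (∀ i → a i ≢ b i) →
    (∀ k → sum (λ i → w i * fromℤ (Vec.lookup (a i ⊖ b i) k)) ≈ fromℤ (x k)) →
    ∀ s → + 0 ℤ.< x s → ∃[ i ] (∀ k → x k ≡ Vec.lookup (a i ⊖ b i) k)
  positive-coordinate {m} {n} w a b x 0≤w total a≢b comb s 0<xs = i , λ k → fromℤ-injective (begin
      fromℤ (x k)
        ≈⟨ comb k ⟨
      sum (λ j → w j * fromℤ (Vec.lookup (a j ⊖ b j) k))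
        ≈⟨ sum-cong-≋ {m} (λ j → same j k) ⟩
      sum (λ j → w j * fromℤ (Vec.lookup (a i ⊖ b i) k))
        ≈⟨ *-distribʳ-sum {m} (fromℤ (Vec.lookup (a i ⊖ b i) k)) w ⟨
      sum w * fromℤ (Vec.lookup (a i ⊖ b i) k)
        ≈⟨ trans (*-congʳ total) (*-identityˡ _) ⟩
      fromℤ (Vec.lookup (a i ⊖ b i) k) ∎)
    where
    open ≈-Reasoning
    active = sum-active w 0≤w (λ ≈0 → 0≉1 (trans (sym ≈0) total))
    i = proj₁ active
    t = b i
    a≡s : ∀ j → 0# < w j → a j ≡ s
    a≡s j 0<wj = ≡.sym (⊖-positive (a j) (b j) (≡.subst (+ 0 ℤ.<_) (≡.sym
      (extremal-weights w (λ j → Vec.lookup (a j ⊖ b j) s) 0≤w total (λ j → lookup-⊖≤1 (a j) (b j) s) 0<xs (comb s) j 0<wj))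
      (ℤ.+<+ (ℕ.s≤s ℕ.z≤n))))
    s≢t : s ≢ t
    s≢t s≡t = a≢b i (≡.trans (a≡s i (proj₂ active)) s≡t)
    -- Every vector of positive weight has its head at s, so none has a positive entry at t, and the
    -- i-th has entry -1 there. Hence x t < 0, and as x t is an integer the extremality argument
    -- applies again at t with heads and tails exchanged.
    g : Fin m → Carrier
    g j = w j * fromℤ (Vec.lookup (b j ⊖ a j) t)
    0≤g : ∀ j → 0# ≤ g j
    0≤g j with 0≤w j
    ... | inj₂ 0≈w = inj₂ (sym (trans (*-congʳ (sym 0≈w)) (zeroˡ _)))
    ... | inj₁ 0<w = *-nonneg (inj₁ 0<w) (fromℤ-mono-≤ (ℤ.≮⇒≥ λ neg →
            s≢t (≡.trans (≡.sym (a≡s j 0<w)) (≡.sym (⊖-negative (b j) (a j) neg)))))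
    0<gi : 0# < g i
    0<gi = *-positive (proj₂ active) (fromℤ-mono-< {+ 0} (≡.subst (+ 0 ℤ.<_)
      (≡.sym (lookup-⊖-head (≡.≢-sym (a≢b i)))) (ℤ.+<+ (ℕ.s≤s ℕ.z≤n))))
    sum-g : sum g ≈ fromℤ (ℤ.- x t)
    sum-g = opposite-combination w a b {t} {x t} (comb t)
    0<-xt : + 0 ℤ.< ℤ.- x t
    0<-xt = fromℤ-cancel-< (S.<-respʳ-≈ sum-g (sum-positive g 0≤g i 0<gi))
    b≡t : ∀ j → 0# < w j → b j ≡ t
    b≡t j 0<wj = ≡.sym (⊖-positive (b j) (a j) (≡.subst (+ 0 ℤ.<_) (≡.sym
      (extremal-weights w (λ j → Vec.lookup (b j ⊖ a j) t) 0≤w total (λ j → lookup-⊖≤1 (b j) (a j) t) 0<-xt sum-g j 0<wj))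
      (ℤ.+<+ (ℕ.s≤s ℕ.z≤n))))
    same : ∀ j k → w j * fromℤ (Vec.lookup (a j ⊖ b j) k) ≈ w j * fromℤ (Vec.lookup (a i ⊖ b i) k)
    same j k with 0≤w j
    ... | inj₁ 0<wj = reflexive (≡.cong₂ (λ u v → w j * fromℤ (Vec.lookup (u ⊖ v) k))
            (≡.trans (a≡s j 0<wj) (≡.sym (a≡s i (proj₂ active)))) (b≡t j 0<wj))
    ... | inj₂ 0≈wj = trans (*-congʳ (sym 0≈wj)) (trans (zeroˡ _) (sym (trans (*-congʳ (sym 0≈wj)) (zeroˡ _))))

  -- A nonzero integral x has a positive coordinate, or else -x has one; in the latter case the
  -- combination is read with heads and tails exchanged.
  lattice-point-of-combination : ∀ {m n} (w : Fin m → Carrier) (a b : Fin m → Fin n) (x : Fin n → ℤ) →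
    (∀ i → 0# ≤ w i) → sum w ≈ 1# → (∀ i → a i ≢ b i) →
    (∀ k → sum (λ i → w i * fromℤ (Vec.lookup (a i ⊖ b i) k)) ≈ fromℤ (x k)) →
    (∀ k → x k ≡ + 0) ⊎ (∃[ i ] (∀ k → x k ≡ Vec.lookup (a i ⊖ b i) k))
  lattice-point-of-combination {m} {n} w a b x 0≤w total a≢b comb
    with Fin.any? (λ k → + 0 ℤ.<? x k)
  ... | yes (s , 0<xs) = inj₂ (positive-coordinate w a b x 0≤w total a≢b comb s 0<xs)
  ... | no ¬pos with Fin.any? (λ k → + 0 ℤ.<? ℤ.- x k)
  ...   | yes (s , 0<-xs) = inj₂ (i , λ k → ≡.trans (≡.sym (ℤ.neg-involutive (x k)))
            (≡.trans (≡.cong ℤ.-_ (x≡ k)) (≡.sym (lookup-⊖-neg (a i) (b i) k))))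
    where
    opposite : ∀ k → sum (λ j → w j * fromℤ (Vec.lookup (b j ⊖ a j) k)) ≈ fromℤ (ℤ.- x k)
    opposite k = opposite-combination w a b {k} {x k} (comb k)
    found = positive-coordinate w b a (λ k → ℤ.- x k) 0≤w total (λ j → ≡.≢-sym (a≢b j)) opposite s 0<-xs
    i = proj₁ found
    x≡ = proj₂ found
  ...   | no ¬neg = inj₁ λ k → ℤ.≤-antisym (ℤ.≮⇒≥ (λ pos → ¬pos (k , pos)))
            (≡.subst (+ 0 ℤ.≤_) (ℤ.neg-involutive (x k)) (ℤ.neg-mono-≤ (ℤ.≮⇒≥ (λ neg → ¬neg (k , neg)))))

  module _ {n : ℕ} (G : Graph n) where

    private
      gens = generators G
      m = length gens
      gen : ∀ i → ∃[ s ] ∃[ t ] T (adj G s t) × List.lookup gens i ≡ s ⊖ t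
      gen i = generator⁻ G (∈-lookup i)

    -- A point of the polytope yields a generator and thus an arc. This provides a node for writing
    -- the origin as `s ⊖ s`, and an arc whose midpoint is the origin.
    conv-active : ∀ {x : Point n} → SymmetricEdgePolytope G x → Fin m
    conv-active (w , 0≤w , total , _) = proj₁ (sum-active w 0≤w (λ ≈0 → 0≉1 (trans (sym ≈0) total)))

    lattice-point-is-root : ∀ {x : LatticePoint n} → SymmetricEdgePolytope G (ι x) → Root G x
    lattice-point-is-root {x} x∈@(w , 0≤w , total , comb) = conclude
      (lattice-point-of-combination w a b (Vec.lookup x) 0≤w total a≢b comb′)
      where
      a b : Fin m → Fin n
      a i = proj₁ (gen i)
      b i = proj₁ (proj₂ (gen i))
      arc : ∀ i → T (adj G (a i) (b i))
      arc i = proj₁ (proj₂ (proj₂ (gen i)))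
      a≢b : ∀ i → a i ≢ b i
      a≢b i eq = ≡.subst T (≡.trans (≡.cong (adj G (a i)) (≡.sym eq)) (adj-irrefl G (a i))) (arc i)
      comb′ : ∀ k → sum (λ i → w i * fromℤ (Vec.lookup (a i ⊖ b i) k)) ≈ fromℤ (Vec.lookup x k)
      comb′ k = trans (sum-cong-≋ {m} (λ i → *-congˡ (reflexive
        (≡.cong (λ (v : LatticePoint n) → fromℤ (Vec.lookup v k)) (≡.sym (proj₂ (proj₂ (proj₂ (gen i))))))))) (comb k)
      conclude : (∀ k → Vec.lookup x k ≡ + 0) ⊎ (∃[ i ] (∀ k → Vec.lookup x k ≡ Vec.lookup (a i ⊖ b i) k)) → Root G x
      conclude (inj₁ x≡0) = s , s , inj₁ ≡.refl , lookup-injective (λ k → ≡.trans (x≡0 k) (≡.sym (lookup-⊖-self s k)))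
        where s = a (conv-active {ι x} x∈)
      conclude (inj₂ (i , x≡)) = a i , b i , inj₂ (arc i) , lookup-injective x≡

    polytope-midpoint : ∀ {x y z : Point n} → SymmetricEdgePolytope G x → SymmetricEdgePolytope G y →
      (∀ k → z k ≈ ½ F * (x k + y k)) → SymmetricEdgePolytope G z
    polytope-midpoint {x} {y} {z} (w , 0≤w , total , comb) (w′ , 0≤w′ , total′ , comb′) z≈ =
        (λ i → h * (w i + w′ i))
      , (λ i → *-nonneg (inj₁ (0<½ F)) (+-nonneg (0≤w i) (0≤w′ i)))
      , (begin
          sum (λ i → h * (w i + w′ i))    ≈⟨ *-distribˡ-sum {m} h (λ i → w i + w′ i) ⟨
          h * sum (λ i → w i + w′ i)      ≈⟨ *-congˡ (∑-distrib-+ {m} w w′) ⟩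
          h * (sum w + sum w′)            ≈⟨ *-congˡ (+-cong total total′) ⟩
          h * (1# + 1#)                   ≈⟨ trans (distribˡ h 1# 1#) (+-cong (*-identityʳ h) (*-identityʳ h)) ⟩
          h + h                           ≈⟨ 2½≈1 F ⟩
          1# ∎)
      , λ k → begin
          sum (λ i → h * (w i + w′ i) * v i k)
            ≈⟨ sum-cong-≋ {m} (λ i → trans (*-assoc h (w i + w′ i) (v i k)) (*-congˡ (distribʳ (v i k) (w i) (w′ i)))) ⟩
          sum (λ i → h * (w i * v i k + w′ i * v i k))
            ≈⟨ *-distribˡ-sum {m} h (λ i → w i * v i k + w′ i * v i k) ⟨
          h * sum (λ i → w i * v i k + w′ i * v i k)
            ≈⟨ *-congˡ (∑-distrib-+ {m} (λ i → w i * v i k) (λ i → w′ i * v i k)) ⟩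
          h * (sum (λ i → w i * v i k) + sum (λ i → w′ i * v i k))
            ≈⟨ *-congˡ (+-cong (comb k) (comb′ k)) ⟩
          h * (x k + y k)
            ≈⟨ z≈ k ⟨
          z k ∎
      where
      open ≈-Reasoning
      h = ½ F
      v = vertices gens

    arc∈polytope : ∀ s t → T (adj G s t) → SymmetricEdgePolytope G (ι (s ⊖ t))
    arc∈polytope s t st = w , 0≤w
      , trans (sum-cong-≋ {m} (λ j → sym (*-identityʳ (w j)))) (sum-δ {m} i (λ _ → 1#))
      , λ k → trans (sum-δ {m} i (λ j → vertices gens j k))
                (reflexive (≡.cong (λ (v : LatticePoint n) → ι v k) (≡.sym (Any.lookup-index st∈))))
      where
      st∈ = generator⁺ G s t st
      i = Any.index st∈
      w : Fin m → Carrier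
      w j = fromℤ (if ⌊ i Fin.≟ j ⌋ then + 1 else + 0)
      0≤w : ∀ j → 0# ≤ w j
      0≤w j with i Fin.≟ j
      ... | yes _ = fromℕ-nonneg 1
      ... | no _  = ≤-refl

    -- The point x witnesses that G has an arc; the origin is the midpoint of the two opposite
    -- generators of that arc.
    root∈polytope : ∀ {v x} → SymmetricEdgePolytope G x → Root G v → SymmetricEdgePolytope G (ι v)
    root∈polytope _ (s , t , inj₂ st , ≡.refl) = arc∈polytope s t st
    root∈polytope x∈ (u , _ , inj₁ ≡.refl , ≡.refl) =
      ≡.subst (λ v → SymmetricEdgePolytope G (ι v)) (⊖-self s u)
        (polytope-midpoint (arc∈polytope s t st) (arc∈polytope t s (≡.subst T (adj-sym G s t) st)) centre)
      where
      i = conv-active x∈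
      s = proj₁ (gen i)
      t = proj₁ (proj₂ (gen i))
      st = proj₁ (proj₂ (proj₂ (gen i)))
      centre : ∀ k → ι (s ⊖ s) k ≈ ½ F * (ι (s ⊖ t) k + ι (t ⊖ s) k)
      centre k = begin
        ι (s ⊖ s) k                              ≡⟨ ≡.cong fromℤ (lookup-⊖-self s k) ⟩
        0#                                       ≈⟨ zeroʳ (½ F) ⟨
        ½ F * 0#                                 ≈⟨ *-congˡ (-‿inverseʳ (ι (s ⊖ t) k)) ⟨
        ½ F * (ι (s ⊖ t) k - ι (s ⊖ t) k)        ≈⟨ *-congˡ (+-congˡ (fromℤ-neg (Vec.lookup (s ⊖ t) k))) ⟨
        ½ F * (ι (s ⊖ t) k + fromℤ (ℤ.- Vec.lookup (s ⊖ t) k))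
          ≡⟨ ≡.cong (λ z → ½ F * (ι (s ⊖ t) k + fromℤ z)) (lookup-⊖-neg t s k) ⟨
        ½ F * (ι (s ⊖ t) k + ι (t ⊖ s) k)        ∎
        where open ≈-Reasoning

    -- Edges of a unimodular triangulation as sums of roots

    module _ (Δ : UnimodularTriangulation (SymmetricEdgePolytope G)) where
      open UnimodularTriangulation Δ
      open IsTriangulation isTriangulation
      open UnimodularTriangulationProperties F {P = SymmetricEdgePolytope G} polytope-midpoint Δ

      private
        nonempty : ∃[ x ] SymmetricEdgePolytope G x
        -- Dimension d comes with d + 1 points, so with at least one.
        nonempty = let v , v∈ , _ = HasDimension.attained dimension in v zero , v∈ zero

        root∈P : ∀ {v} → Root G v → SymmetricEdgePolytope G (ι v)
        root∈P = root∈polytope (proj₂ nonempty)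

        edge⁻ : ∀ {v w} → (v , w) ∈ edges cells → ∃[ σ ] σ ∈ cells × v ∈ σ × w ∈ σ × v ≢ w
        edge⁻ vw∈ with find (∈-concatMap⁻ pairs {cells} (∈-deduplicate⁻ sameEdge? (concatMap pairs cells) vw∈))
        ... | σ , σ∈ , p = let v∈ , w∈ = ∈-pairs⁻ σ p in
          σ , σ∈ , v∈ , w∈ , pairs-related σ (unique σ∈) p

        -- Deduplication may retain (w , v) instead of (v , w); the sum is insensitive to this
        -- choice.
        edge⁺ : ∀ {σ v w} → σ ∈ cells → v ∈ σ → w ∈ σ → v ≢ w → v +ᴸ w ∈ map sumEdge (edges cells)
        edge⁺ {σ} {v} {w} σ∈ v∈ w∈ v≢w = Any.map⁺ (Any.map ≡.sym
          (Any.deduplicate⁺ sameEdge? (λ same eq → ≡.trans (sumEdge-cong same) eq) raw))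
          where
          raw : Any (λ x → sumEdge x ≡ v +ᴸ w) (concatMap pairs cells)
          raw with ∈-pairs⁺ v∈ w∈ v≢w
          ... | inj₁ p = lose (∈-concatMap⁺ pairs (lose σ∈ p)) ≡.refl
          ... | inj₂ p = lose (∈-concatMap⁺ pairs (lose σ∈ p)) (+ᴸ-comm w v)

        -- By `sum-determines-edge` equal sums mean the same edge, and deduplication leaves one
        -- representative of each.
        unique-sums : Unique (map sumEdge (edges cells))
        unique-sums = unique-map-on sumEdge
          (AllPairs.map (λ { ¬same ≡.refl → ¬same (inj₁ (≡.refl , ≡.refl)) }) distinct) injective
          where
          distinct : AllPairs (λ x y → ¬ SameEdge x y) (edges cells)
          distinct = allPairs-deduplicate sameEdge? (concatMap pairs cells)
          injective : ∀ {x y} → x ∈ edges cells → y ∈ edges cells → sumEdge x ≡ sumEdge y → x ≡ y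
          injective {x} {y} x∈ y∈ eq with edge⁻ x∈ | edge⁻ y∈
          ... | σ , σ∈ , v∈ , w∈ , _ | τ , τ∈ , v′∈ , w′∈ , _
            with ∈-AllPairs₂ distinct x∈ y∈
          ... | inj₁ x≡y = x≡y
          ... | inj₂ (inj₁ ¬xy) = contradiction (sum-determines-edge σ∈ τ∈ v∈ w∈ v′∈ w′∈ eq) ¬xy
          ... | inj₂ (inj₂ ¬yx) = contradiction (sum-determines-edge τ∈ σ∈ v′∈ w′∈ v∈ w∈ (≡.sym eq)) ¬yx

        presentCandidates : List (Candidate n)
        presentCandidates = filter (T? ∘ present G) (candidates n)

        presentCandidate⁻ : ∀ {c} → c ∈ presentCandidates → Reduced c × T (present G c)
        presentCandidate⁻ c∈ = let c∈′ , p = ∈-filter⁻ (T? ∘ present G) {xs = candidates n} c∈ in candidates-reduced n c∈′ , p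

        unique-values : Unique (map value presentCandidates)
        unique-values = unique-map-on value (Unique.filter⁺ _ (unique-candidates n))
          (λ {c} {d} c∈ d∈ → value-injective c d (proj₁ (presentCandidate⁻ c∈)) (proj₁ (presentCandidate⁻ d∈)))

        sum⇒value : ∀ {z} → z ∈ map sumEdge (edges cells) → z ∈ map value presentCandidates
        sum⇒value z∈ with ∈-map⁻ sumEdge z∈
        ... | (v , w) , vw∈ , ≡.refl with edge⁻ vw∈
        ... | σ , σ∈ , v∈ , w∈ , v≢w = conclude (sum⇒represented G {v} {w}
            (lattice-point-is-root {v} (vertex∈P {σ} {v} σ∈ v∈)) (lattice-point-is-root {w} (vertex∈P {σ} {w} σ∈ w∈)) v≢w nonzero)
          where
          -- The origin is a vertex of some cell, and 0 = 0 + 0.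
          nonzero : ∀ s → v +ᴸ w ≢ s ⊖ s
          nonzero s eq = collapse (lattice-point-is-vertex {s ⊖ s} (root∈P {s ⊖ s} (s , s , inj₁ ≡.refl , ≡.refl)))
            where
            equal : SameEdge (v , w) (s ⊖ s , s ⊖ s) → v ≡ w
            equal (inj₁ (v≡0 , w≡0)) = ≡.trans v≡0 (≡.sym w≡0)
            equal (inj₂ (v≡0 , w≡0)) = ≡.trans v≡0 (≡.sym w≡0)
            collapse : ∃[ τ ] τ ∈ cells × s ⊖ s ∈ τ → ⊥
            collapse (τ , τ∈ , 0∈) = v≢w (equal (sum-determines-edge {σ} {τ} {v} {w} {s ⊖ s} {s ⊖ s}
              σ∈ τ∈ v∈ w∈ 0∈ 0∈ (≡.trans eq (≡.sym (⊖-self-+ s)))))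
          conclude : Represented G (v +ᴸ w) → v +ᴸ w ∈ map value presentCandidates
          conclude (c , red , p , eq) = ≡.subst (_∈ map value presentCandidates) eq
            (∈-map⁺ value (∈-filter⁺ (T? ∘ present G) (reduced⇒candidate n red) p))

        -- The vertices v and w that a cell provides for a + b span an edge: if they coincided, the
        -- value of a reduced candidate would be a double.
        roots⇒sum : ∀ c → Reduced c → ∀ {a b} → Root G a → Root G b → value c ≡ a +ᴸ b →
                    value c ∈ map sumEdge (edges cells)
        roots⇒sum c red {a} {b} a-root b-root eq =
          conclude (sum-of-lattice-points {a} {b} (root∈P {a} a-root) (root∈P {b} b-root))
          where
          conclude : (∃[ σ ] σ ∈ cells × (∃[ v ] ∃[ w ] v ∈ σ × w ∈ σ × a +ᴸ b ≡ v +ᴸ w)) →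
                     value c ∈ map sumEdge (edges cells)
          conclude (σ , σ∈ , v , w , v∈ , w∈ , eq′) = ≡.subst (_∈ map sumEdge (edges cells))
            (≡.sym (≡.trans eq eq′)) (edge⁺ {σ} {v} {w} σ∈ v∈ w∈ v≢w)
            where
            v≢w : v ≢ w
            v≢w v≡w = reduced-not-double {c = c} red w
              (≡.trans eq (≡.trans eq′ (≡.cong (_+ᴸ w) v≡w)))

        value⇒sum : ∀ {z} → z ∈ map value presentCandidates → z ∈ map sumEdge (edges cells)
        value⇒sum z∈ =
          let c , c∈ , z≡ = ∈-map⁻ value {xs = presentCandidates} z∈
              red , p = presentCandidate⁻ c∈
              a , b , a-root , b-root , eq = present⇒sum G c p
          in ≡.subst (_∈ map sumEdge (edges cells)) (≡.sym z≡) (roots⇒sum c red a-root b-root eq)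

      numberOfEdges≡edgeCount : numberOfEdges ≡ edgeCount G
      numberOfEdges≡edgeCount = begin
        length (edges cells)                   ≡⟨ List.length-map sumEdge (edges cells) ⟨
        length (map sumEdge (edges cells))     ≡⟨ unique-set⇒length unique-sums unique-values sum⇒value value⇒sum ⟩
        length (map value presentCandidates)   ≡⟨ List.length-map value presentCandidates ⟩
        edgeCount G                            ∎
        where open ≡.≡-Reasoning

    edgeNumber≡edgeCount : ∀ {k} → EdgeNumber G k → k ≡ edgeCount G
    edgeNumber≡edgeCount (triangulated Δ) = numberOfEdges≡edgeCount Δ
    edgeNumber≡edgeCount (arcless no-arc) = ≡.cong length (≡.sym
      (List.filter-none (T? ∘ present G) {xs = candidates n} (All.tabulate λ {c} _ → absent c)))
      where
      absent : ∀ c → ¬ T (present G c)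
      absent (difference i j) p with Equivalence.to (Bool.T-∨ {adj G i j}) p
      ... | inj₁ ij = no-arc i j ij
      ... | inj₂ q with find (Any.any⁻ _ (allFin n) q)
      ...   | k , _ , r = no-arc i k (proj₁ (Equivalence.to Bool.T-∧ r))
      absent (quad s t u w) p with Equivalence.to (Bool.T-∨ {adj G s t ∧ adj G u w}) p
      ... | inj₁ q = no-arc s t (proj₁ (Equivalence.to Bool.T-∧ q))
      ... | inj₂ q = no-arc s w (proj₁ (Equivalence.to Bool.T-∧ q))

-- Random graphs

-- Overwrites the state of one arc, so that conditioning on the arc becomes an average over its two
-- states. There is no loop to set, so equal nodes leave the graph unchanged.
setArc : ∀ {n} → Fin n → Fin n → Bool → Graph n → Graph n
setArc zero    zero    x G       = G
setArc zero    (suc j) x (S ∷ G) = (S [ j ]≔ x) ∷ G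
setArc (suc i) zero    x (S ∷ G) = (S [ i ]≔ x) ∷ G
setArc (suc i) (suc j) x (S ∷ G) = S ∷ setArc i j x G

adj-setArc : ∀ {n} {i j : Fin n} x G → i ≢ j → adj (setArc i j x G) i j ≡ x
adj-setArc {i = zero}  {zero}  x G       i≢j = contradiction ≡.refl i≢j
adj-setArc {i = zero}  {suc j} x (S ∷ G) i≢j = Vec.lookup∘updateAt j S
adj-setArc {i = suc i} {zero}  x (S ∷ G) i≢j = Vec.lookup∘updateAt i S
adj-setArc {i = suc i} {suc j} x (S ∷ G) i≢j = adj-setArc x G (i≢j ∘ ≡.cong suc)

DistinctArcs : ∀ {n} → Fin n → Fin n → Fin n → Fin n → Set
DistinctArcs i j k l = ¬ (k ≡ i × l ≡ j) × ¬ (k ≡ j × l ≡ i)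

adj-setArc-other : ∀ {n} {i j k l : Fin n} x G → DistinctArcs i j k l →
                   adj (setArc i j x G) k l ≡ adj G k l
adj-setArc-other {i = zero}  {zero}  x G _ = ≡.refl
adj-setArc-other {i = zero}  {suc j} {zero}  {zero}  x (S ∷ G) _ = ≡.refl
adj-setArc-other {i = zero}  {suc j} {zero}  {suc l} x (S ∷ G) (d , _) =
  Vec.lookup∘updateAt′ l j (λ l≡j → d (≡.refl , ≡.cong suc l≡j)) S
adj-setArc-other {i = zero}  {suc j} {suc k} {zero}  x (S ∷ G) (_ , d) =
  Vec.lookup∘updateAt′ k j (λ k≡j → d (≡.cong suc k≡j , ≡.refl)) S
adj-setArc-other {i = zero}  {suc j} {suc k} {suc l} x (S ∷ G) _ = ≡.refl
adj-setArc-other {i = suc i} {zero}  {zero}  {zero}  x (S ∷ G) _ = ≡.refl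
adj-setArc-other {i = suc i} {zero}  {zero}  {suc l} x (S ∷ G) (_ , d) =
  Vec.lookup∘updateAt′ l i (λ l≡i → d (≡.refl , ≡.cong suc l≡i)) S
adj-setArc-other {i = suc i} {zero}  {suc k} {zero}  x (S ∷ G) (d , _) =
  Vec.lookup∘updateAt′ k i (λ k≡i → d (≡.cong suc k≡i , ≡.refl)) S
adj-setArc-other {i = suc i} {zero}  {suc k} {suc l} x (S ∷ G) _ = ≡.refl
adj-setArc-other {i = suc i} {suc j} {zero}  {zero}  x (S ∷ G) _ = ≡.refl
adj-setArc-other {i = suc i} {suc j} {zero}  {suc l} x (S ∷ G) _ = ≡.refl
adj-setArc-other {i = suc i} {suc j} {suc k} {zero}  x (S ∷ G) _ = ≡.refl
adj-setArc-other {i = suc i} {suc j} {suc k} {suc l} x (S ∷ G) (d , d′) =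
  adj-setArc-other x G ( (λ (k≡i , l≡j) → d (≡.cong suc k≡i , ≡.cong suc l≡j))
                       , (λ (k≡j , l≡i) → d′ (≡.cong suc k≡j , ≡.cong suc l≡i)))

pairs-map : ∀ {a b} {A : Set a} {B : Set b} (f : A → B) xs →
            pairs (map f xs) ≡ map (λ (x , y) → f x , f y) (pairs xs)
pairs-map f []       = ≡.refl
pairs-map f (x ∷ xs) = begin
  map (f x ,_) (map f xs) ++ pairs (map f xs)
    ≡⟨ ≡.cong₂ _++_ (≡.trans (≡.sym (List.map-∘ xs)) (List.map-∘ xs)) (pairs-map f xs) ⟩
  map f×f (map (x ,_) xs) ++ map f×f (pairs xs)
    ≡⟨ List.map-++ f×f (map (x ,_) xs) (pairs xs) ⟨
  map f×f (pairs (x ∷ xs)) ∎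
  where
  open ≡.≡-Reasoning
  f×f = λ (x , y) → f x , f y

allFin-suc : ∀ n → allFin (suc n) ≡ zero ∷ map suc (allFin n)
allFin-suc n = ≡.cong (zero ∷_) (≡.sym (List.map-tabulate id suc))

module RandomGraphs {c ℓ₁ ℓ₂} (F : OrderedField c ℓ₁ ℓ₂) (p : OrderedField.Carrier F) where
  open OrderedField F hiding (zero)
  open Over F
  open OrderedFieldProperties F
  open Solver
  open Sums F
  private
    module ≈-Reasoning = Relation.Binary.Reasoning.Setoid setoid
    q = 1# - p

  weight : Bool → Carrier
  weight x = if x then p else 1# - p

  indicator : Bool → Carrier
  indicator x = if x then 1# else 0#

  -- Recursive, so that conditioning on one arc can be proved by induction.
  𝔼ˢ : ∀ n → (Subset n → Carrier) → Carrier
  𝔼ˢ zero    f = f []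
  𝔼ˢ (suc n) f = p * 𝔼ˢ n (λ S → f (true ∷ S)) + q * 𝔼ˢ n (λ S → f (false ∷ S))

  𝔼ᴳ : ∀ n → (Graph n → Carrier) → Carrier
  𝔼ᴳ zero    f = f []
  𝔼ᴳ (suc n) f = 𝔼ˢ n (λ S → 𝔼ᴳ n (λ G → f (S ∷ G)))

  private
    mix-+ : ∀ a b c d → p * (a + b) + q * (c + d) ≈ (p * a + q * c) + (p * b + q * d)
    mix-+ = solve 5 (λ p a b c d → let q = con (+ 1) :- p in
      p :* (a :+ b) :+ q :* (c :+ d) := (p :* a :+ q :* c) :+ (p :* b :+ q :* d)) refl p

    mix-* : ∀ z a b → p * (z * a) + q * (z * b) ≈ z * (p * a + q * b)
    mix-* = solve 4 (λ p z a b → let q = con (+ 1) :- p in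
      p :* (z :* a) :+ q :* (z :* b) := z :* (p :* a :+ q :* b)) refl p

    mix-const : ∀ z → p * z + q * z ≈ z
    mix-const = solve 2 (λ p z → p :* z :+ (con (+ 1) :- p) :* z := z) refl p

    mix-swap : ∀ a b c d → p * (p * a + q * b) + q * (p * c + q * d) ≈ p * (p * a + q * c) + q * (p * b + q * d)
    mix-swap = solve 5 (λ p a b c d → let q = con (+ 1) :- p in
      p :* (p :* a :+ q :* b) :+ q :* (p :* c :+ q :* d) := p :* (p :* a :+ q :* c) :+ q :* (p :* b :+ q :* d)) refl p

  𝔼ˢ-cong : ∀ n {f g : Subset n → Carrier} → (∀ S → f S ≈ g S) → 𝔼ˢ n f ≈ 𝔼ˢ n g
  𝔼ˢ-cong zero    f≈g = f≈g []
  𝔼ˢ-cong (suc n) f≈g = +-cong (*-congˡ (𝔼ˢ-cong n (λ S → f≈g (true ∷ S))))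
                               (*-congˡ (𝔼ˢ-cong n (λ S → f≈g (false ∷ S))))

  𝔼ˢ-+ : ∀ n f g → 𝔼ˢ n (λ S → f S + g S) ≈ 𝔼ˢ n f + 𝔼ˢ n g
  𝔼ˢ-+ zero    f g = refl
  𝔼ˢ-+ (suc n) f g = trans (+-cong (*-congˡ (𝔼ˢ-+ n _ _)) (*-congˡ (𝔼ˢ-+ n _ _))) (mix-+ _ _ _ _)

  𝔼ˢ-* : ∀ n z f → 𝔼ˢ n (λ S → z * f S) ≈ z * 𝔼ˢ n f
  𝔼ˢ-* zero    z f = refl
  𝔼ˢ-* (suc n) z f = trans (+-cong (*-congˡ (𝔼ˢ-* n z _)) (*-congˡ (𝔼ˢ-* n z _))) (mix-* z _ _)

  𝔼ˢ-const : ∀ n z → 𝔼ˢ n (λ _ → z) ≈ z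
  𝔼ˢ-const zero    z = refl
  𝔼ˢ-const (suc n) z = trans (+-cong (*-congˡ (𝔼ˢ-const n z)) (*-congˡ (𝔼ˢ-const n z))) (mix-const z)

  -- At the outermost coin, overwriting makes both branches equal and averaging them changes
  -- nothing; at an inner coin, the two averages commute.
  𝔼ˢ-condition : ∀ {n} (j : Fin n) f →
    𝔼ˢ n f ≈ p * 𝔼ˢ n (λ S → f (S [ j ]≔ true)) + q * 𝔼ˢ n (λ S → f (S [ j ]≔ false))
  𝔼ˢ-condition {suc n} zero f = sym (+-cong (*-congˡ (mix-const _)) (*-congˡ (mix-const _)))
  𝔼ˢ-condition {suc n} (suc j) f = trans
    (+-cong (*-congˡ (𝔼ˢ-condition j (λ S → f (true ∷ S)))) (*-congˡ (𝔼ˢ-condition j (λ S → f (false ∷ S)))))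
    (mix-swap _ _ _ _)

  𝔼ᴳ-cong : ∀ n {f g : Graph n → Carrier} → (∀ G → f G ≈ g G) → 𝔼ᴳ n f ≈ 𝔼ᴳ n g
  𝔼ᴳ-cong zero    f≈g = f≈g []
  𝔼ᴳ-cong (suc n) f≈g = 𝔼ˢ-cong n (λ S → 𝔼ᴳ-cong n (λ G → f≈g (S ∷ G)))

  𝔼ᴳ-+ : ∀ n f g → 𝔼ᴳ n (λ G → f G + g G) ≈ 𝔼ᴳ n f + 𝔼ᴳ n g
  𝔼ᴳ-+ zero    f g = refl
  𝔼ᴳ-+ (suc n) f g = trans (𝔼ˢ-cong n (λ S → 𝔼ᴳ-+ n (λ G → f (S ∷ G)) (λ G → g (S ∷ G))))
    (𝔼ˢ-+ n (λ S → 𝔼ᴳ n (λ G → f (S ∷ G))) (λ S → 𝔼ᴳ n (λ G → g (S ∷ G))))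

  𝔼ᴳ-* : ∀ n z f → 𝔼ᴳ n (λ G → z * f G) ≈ z * 𝔼ᴳ n f
  𝔼ᴳ-* zero    z f = refl
  𝔼ᴳ-* (suc n) z f = trans (𝔼ˢ-cong n (λ S → 𝔼ᴳ-* n z (λ G → f (S ∷ G))))
    (𝔼ˢ-* n z (λ S → 𝔼ᴳ n (λ G → f (S ∷ G))))

  𝔼ᴳ-const : ∀ n z → 𝔼ᴳ n (λ _ → z) ≈ z
  𝔼ᴳ-const zero    z = refl
  𝔼ᴳ-const (suc n) z = trans (𝔼ˢ-cong n (λ S → 𝔼ᴳ-const n z)) (𝔼ˢ-const n z)

  𝔼ᴳ-sumOver : ∀ n {a} {A : Set a} (xs : List A) (f : A → Graph n → Carrier) →
    𝔼ᴳ n (λ G → sumOver xs (λ x → f x G)) ≈ sumOver xs (λ x → 𝔼ᴳ n (f x))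
  𝔼ᴳ-sumOver n []       f = 𝔼ᴳ-const n 0#
  𝔼ᴳ-sumOver n (x ∷ xs) f = trans (𝔼ᴳ-+ n (f x) (λ G → sumOver xs (λ x → f x G))) (+-congˡ (𝔼ᴳ-sumOver n xs f))

  𝔼ᴳ-condition : ∀ {n} (i j : Fin n) f → i ≢ j →
    𝔼ᴳ n f ≈ p * 𝔼ᴳ n (λ G → f (setArc i j true G)) + q * 𝔼ᴳ n (λ G → f (setArc i j false G))
  𝔼ᴳ-condition zero zero f i≢j = contradiction ≡.refl i≢j
  𝔼ᴳ-condition {suc n} zero (suc j) f i≢j = 𝔼ˢ-condition j (λ S → 𝔼ᴳ n (λ G → f (S ∷ G)))
  𝔼ᴳ-condition {suc n} (suc i) zero f i≢j = 𝔼ˢ-condition i (λ S → 𝔼ᴳ n (λ G → f (S ∷ G)))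
  𝔼ᴳ-condition {suc n} (suc i) (suc j) f i≢j = begin
    𝔼ˢ n (λ S → 𝔼ᴳ n (λ G → f (S ∷ G)))
      ≈⟨ 𝔼ˢ-cong n (λ S → 𝔼ᴳ-condition i j (λ G → f (S ∷ G)) (i≢j ∘ ≡.cong suc)) ⟩
    𝔼ˢ n (λ S → p * on true S + q * on false S)
      ≈⟨ 𝔼ˢ-+ n (λ S → p * on true S) (λ S → q * on false S) ⟩
    𝔼ˢ n (λ S → p * on true S) + 𝔼ˢ n (λ S → q * on false S)
      ≈⟨ +-cong (𝔼ˢ-* n p (on true)) (𝔼ˢ-* n q (on false)) ⟩
    p * 𝔼ˢ n (on true) + q * 𝔼ˢ n (on false) ∎
    where
    open ≈-Reasoning
    on : Bool → Subset n → Carrier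
    on x S = 𝔼ᴳ n (λ G → f (S ∷ setArc i j x G))

  -- Agreement of the recursive expectation with the weighted sum over all graphs

  module _ {a} {A : Set a} where

    productOver-cong : ∀ xs {f g : A → Carrier} → (∀ {x} → x ∈ xs → f x ≈ g x) →
                       productOver xs f ≈ productOver xs g
    productOver-cong []       f≈g = refl
    productOver-cong (x ∷ xs) f≈g = *-cong (f≈g (here ≡.refl)) (productOver-cong xs (f≈g ∘ there))

    productOver-++ : ∀ xs ys (f : A → Carrier) →
      productOver (xs ++ ys) f ≈ productOver xs f * productOver ys f
    productOver-++ []       ys f = sym (*-identityˡ _)
    productOver-++ (x ∷ xs) ys f = trans (*-congˡ (productOver-++ xs ys f)) (sym (*-assoc _ _ _))

  productOver-map : ∀ {a b} {A : Set a} {B : Set b} (g : A → B) xs (f : B → Carrier) →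
                    productOver (map g xs) f ≡ productOver xs (f ∘ g)
  productOver-map g []       f = ≡.refl
  productOver-map g (x ∷ xs) f = ≡.cong (_*_ (f (g x))) (productOver-map g xs f)

  sumOver-cartesianProduct : ∀ {a b d} {A : Set a} {B : Set b} {D : Set d} (g : A → B → D) xs ys (f : D → Carrier) →
    sumOver (cartesianProductWith g xs ys) f ≈ sumOver xs (λ x → sumOver ys (λ y → f (g x y)))
  sumOver-cartesianProduct g []       ys f = refl
  sumOver-cartesianProduct g (x ∷ xs) ys f = trans (sumOver-++ (map (g x) ys) (cartesianProductWith g xs ys) f)
    (+-cong (reflexive (sumOver-map (g x) ys f)) (sumOver-cartesianProduct g xs ys f))

  subsetProbability : ∀ {n} → Subset n → Carrier
  subsetProbability []      = 1#
  subsetProbability (x ∷ S) = weight x * subsetProbability S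

  sumOver-allSubsets : ∀ n f → sumOver (allSubsets n) (λ S → subsetProbability S * f S) ≈ 𝔼ˢ n f
  sumOver-allSubsets zero f = trans (+-identityʳ _) (*-identityˡ _)
  sumOver-allSubsets (suc n) f = begin
    sumOver (allSubsets (suc n)) (λ S → subsetProbability S * f S)
      ≈⟨ sumOver-cartesianProduct {A = Bool} _∷_ (inside ∷ outside ∷ []) (allSubsets n) (λ S → subsetProbability S * f S) ⟩
    half true + (half false + 0#)
      ≈⟨ +-cong (split true) (trans (+-identityʳ _) (split false)) ⟩
    𝔼ˢ (suc n) f ∎
    where
    open ≈-Reasoning
    half : Bool → Carrier
    half x = sumOver (allSubsets n) (λ S → weight x * subsetProbability S * f (x ∷ S))
    split : ∀ x → half x ≈ weight x * 𝔼ˢ n (λ S → f (x ∷ S))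
    split x = trans (sumOver-cong (allSubsets n) (λ {S} _ → *-assoc (weight x) (subsetProbability S) (f (x ∷ S))))
      (trans (sumOver-*ˡ (allSubsets n) (weight x) (λ S → subsetProbability S * f (x ∷ S)))
        (*-congˡ (sumOver-allSubsets n (λ S → f (x ∷ S)))))

  productOver-subset : ∀ {n} (S : Subset n) →
    productOver (allFin n) (λ j → weight (Vec.lookup S j)) ≈ subsetProbability S
  productOver-subset [] = refl
  productOver-subset {suc n} (x ∷ S) = begin
    productOver (allFin (suc n)) (λ j → weight (Vec.lookup (x ∷ S) j))
      ≡⟨ ≡.cong (λ xs → productOver xs (λ j → weight (Vec.lookup (x ∷ S) j))) (allFin-suc n) ⟩
    weight x * productOver (map suc (allFin n)) (λ j → weight (Vec.lookup (x ∷ S) j))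
      ≈⟨ *-congˡ (trans (reflexive (productOver-map suc (allFin n) (λ j → weight (Vec.lookup (x ∷ S) j)))) (productOver-subset S)) ⟩
    subsetProbability (x ∷ S) ∎
    where open ≈-Reasoning

  probability-∷ : ∀ {n} (S : Subset n) G →
    probability (suc n) p (S ∷ G) ≈ subsetProbability S * probability n p G
  probability-∷ {n} S G = begin
    productOver (pairs (allFin (suc n))) w
      ≡⟨ ≡.cong (λ xs → productOver (pairs xs) w) (allFin-suc n) ⟩
    productOver (map (zero ,_) (map suc (allFin n)) ++ pairs (map suc (allFin n))) w
      ≈⟨ productOver-++ (map (zero ,_) (map suc (allFin n))) (pairs (map suc (allFin n))) w ⟩
    productOver (map (zero ,_) (map suc (allFin n))) w * productOver (pairs (map suc (allFin n))) w
      ≈⟨ *-cong first second ⟩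
    subsetProbability S * probability n p G ∎
    where
    open ≈-Reasoning
    w : Fin (suc n) × Fin (suc n) → Carrier
    w (i , j) = weight (adj (S ∷ G) i j)
    first : productOver (map (zero ,_) (map suc (allFin n))) w ≈ subsetProbability S
    first = trans (reflexive (≡.trans (productOver-map (zero ,_) (map suc (allFin n)) w)
      (productOver-map suc (allFin n) (λ j → w (zero , j))))) (productOver-subset S)
    second : productOver (pairs (map suc (allFin n))) w ≈ probability n p G
    second = reflexive (≡.trans (≡.cong (λ xs → productOver xs w) (pairs-map suc (allFin n)))
      (productOver-map (λ (i , j) → suc i , suc j) (pairs (allFin n)) w))

  sumOver-allGraphs : ∀ n f → sumOver (allGraphs n) (λ G → probability n p G * f G) ≈ 𝔼ᴳ n f
  sumOver-allGraphs zero f = trans (+-identityʳ _) (*-identityˡ _)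
  sumOver-allGraphs (suc n) f = begin
    sumOver (allGraphs (suc n)) (λ G → probability (suc n) p G * f G)
      ≈⟨ sumOver-cartesianProduct _∷_ (allSubsets n) (allGraphs n) (λ G → probability (suc n) p G * f G) ⟩
    sumOver (allSubsets n) (λ S → sumOver (allGraphs n) (λ G → probability (suc n) p (S ∷ G) * f (S ∷ G)))
      ≈⟨ sumOver-cong (allSubsets n) (λ {S} _ → trans
           (sumOver-cong (allGraphs n) (λ {G} _ → trans (*-congʳ (probability-∷ S G)) (*-assoc _ _ _)))
           (trans (sumOver-*ˡ (allGraphs n) (subsetProbability S) (λ G → probability n p G * f (S ∷ G)))
             (*-congˡ (sumOver-allGraphs n (λ G → f (S ∷ G)))))) ⟩
    sumOver (allSubsets n) (λ S → subsetProbability S * 𝔼ᴳ n (λ G → f (S ∷ G)))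
      ≈⟨ sumOver-allSubsets n (λ S → 𝔼ᴳ n (λ G → f (S ∷ G))) ⟩
    𝔼ᴳ (suc n) f ∎
    where open ≈-Reasoning

  -- Independence and the probabilities of the candidates

  Independent : ∀ {n} → Fin n → Fin n → (Graph n → Carrier) → Set ℓ₁
  Independent i j R = ∀ x G → R (setArc i j x G) ≈ R G

  -- Indicator that at least one of the two arcs is missing. Complements are used throughout because
  -- a disjunction of events then becomes a product.
  absent-both : ∀ {n} → Graph n → Fin n → Fin n → Fin n → Fin n → Carrier
  absent-both G i j k l = 1# - indicator (adj G i j) * indicator (adj G k l)

  private
    one-step : ∀ r → p * ((1# - 1#) * r) + q * ((1# - 0#) * r) ≈ q * r
    one-step = solve 2 (λ p r → p :* ((con (+ 1) :- con (+ 1)) :* r)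
      :+ (con (+ 1) :- p) :* ((con (+ 1) :- con (+ 0)) :* r) := (con (+ 1) :- p) :* r) refl p

    two-step : ∀ r → p * (q * r) + q * r ≈ (1# - p ^ 2) * r
    two-step = solve 2 (λ p r → p :* ((con (+ 1) :- p) :* r) :+ (con (+ 1) :- p) :* r
      := (con (+ 1) :- p :^ 2) :* r) refl p

    unit : ∀ y r → (1# - 1# * y) * r ≈ (1# - y) * r
    unit = solve 2 (λ y r → (con (+ 1) :- con (+ 1) :* y) :* r := (con (+ 1) :- y) :* r) refl

    null : ∀ y r → (1# - 0# * y) * r ≈ r
    null = solve 2 (λ y r → (con (+ 1) :- con (+ 0) :* y) :* r := r) refl

  -- Conditioning on ij fixes the indicator. Resetting that arc leaves `R` unchanged on every graph,
  -- so its expectation is a common factor of both branches.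
  𝔼ᴳ-absent : ∀ {n} (i j : Fin n) R → i ≢ j → Independent i j R →
    𝔼ᴳ n (λ G → (1# - indicator (adj G i j)) * R G) ≈ q * 𝔼ᴳ n R
  𝔼ᴳ-absent {n} i j R i≢j ind = begin
    𝔼ᴳ n (λ G → (1# - indicator (adj G i j)) * R G)
      ≈⟨ 𝔼ᴳ-condition i j (λ G → (1# - indicator (adj G i j)) * R G) i≢j ⟩
    p * 𝔼ᴳ n (λ G → (1# - indicator (adj (setArc i j true G) i j)) * R (setArc i j true G)) +
    q * 𝔼ᴳ n (λ G → (1# - indicator (adj (setArc i j false G) i j)) * R (setArc i j false G))
      ≈⟨ +-cong (*-congˡ (on true)) (*-congˡ (on false)) ⟩
    p * ((1# - 1#) * 𝔼ᴳ n R) + q * ((1# - 0#) * 𝔼ᴳ n R)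
      ≈⟨ one-step (𝔼ᴳ n R) ⟩
    q * 𝔼ᴳ n R ∎
    where
    open ≈-Reasoning
    on : ∀ x → 𝔼ᴳ n (λ G → (1# - indicator (adj (setArc i j x G) i j)) * R (setArc i j x G)) ≈ (1# - indicator x) * 𝔼ᴳ n R
    on x = trans (𝔼ᴳ-cong n (λ G → *-cong (reflexive (≡.cong (λ y → 1# - indicator y) (adj-setArc x G i≢j))) (ind x G)))
      (𝔼ᴳ-* n (1# - indicator x) R)

  -- If ij is present, kl must be missing; if ij is missing, nothing more is asked. This gives p(1 -
  -- p) + (1 - p) = 1 - p².
  𝔼ᴳ-absent-both : ∀ {n} (i j k l : Fin n) R → i ≢ j → k ≢ l → DistinctArcs i j k l →
    Independent i j R → Independent k l R →
    𝔼ᴳ n (λ G → absent-both G i j k l * R G) ≈ (1# - p ^ 2) * 𝔼ᴳ n R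
  𝔼ᴳ-absent-both {n} i j k l R i≢j k≢l distinct ind ind′ = begin
    𝔼ᴳ n (λ G → absent-both G i j k l * R G)
      ≈⟨ 𝔼ᴳ-condition i j (λ G → absent-both G i j k l * R G) i≢j ⟩
    p * 𝔼ᴳ n (λ G → absent-both (setArc i j true G) i j k l * R (setArc i j true G)) +
    q * 𝔼ᴳ n (λ G → absent-both (setArc i j false G) i j k l * R (setArc i j false G))
      ≈⟨ +-cong (*-congˡ (trans (on true (λ y r → unit y r)) (𝔼ᴳ-absent k l R k≢l ind′)))
                (*-congˡ (on false (λ y r → null y r))) ⟩
    p * (q * 𝔼ᴳ n R) + q * 𝔼ᴳ n R
      ≈⟨ two-step (𝔼ᴳ n R) ⟩
    (1# - p ^ 2) * 𝔼ᴳ n R ∎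
    where
    open ≈-Reasoning
    on : ∀ x {h : Carrier → Carrier → Carrier} → (∀ y r → (1# - indicator x * y) * r ≈ h y r) →
      𝔼ᴳ n (λ G → absent-both (setArc i j x G) i j k l * R (setArc i j x G)) ≈ 𝔼ᴳ n (λ G → h (indicator (adj G k l)) (R G))
    on x h≈ = 𝔼ᴳ-cong n (λ G → trans (*-cong (reflexive (≡.cong₂ (λ y z → 1# - indicator y * indicator z)
      (adj-setArc x G i≢j) (adj-setArc-other x G distinct))) (ind x G)) (h≈ (indicator (adj G k l)) (R G)))

  independent-absent-both : ∀ {n} {i j k l s t : Fin n} → DistinctArcs s t i j → DistinctArcs s t k l →
    Independent s t (λ G → absent-both G i j k l)
  independent-absent-both d d′ x G = reflexive (≡.cong₂ (λ y z → 1# - indicator y * indicator z)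
    (adj-setArc-other x G d) (adj-setArc-other x G d′))

  independent-productOver : ∀ {n a} {A : Set a} {s t : Fin n} (xs : List A) (f : A → Graph n → Carrier) →
    (∀ {x} → x ∈ xs → Independent s t (f x)) → Independent s t (λ G → productOver xs (λ x → f x G))
  independent-productOver xs f ind x G = productOver-cong xs (λ x∈ → ind x∈ x G)

  -- The paths ikj for different k have no arc in common, so the factors split off one at a time.
  -- `R` leaves room for the further condition that ij is missing.
  𝔼ᴳ-no-path : ∀ {n} (i j : Fin n) ks R → i ≢ j → Unique ks → (∀ {k} → k ∈ ks → k ≢ i × k ≢ j) →
    (∀ {k} → k ∈ ks → Independent i k R × Independent k j R) →
    𝔼ᴳ n (λ G → productOver ks (λ k → absent-both G i k k j) * R G) ≈ (1# - p ^ 2) ^ length ks * 𝔼ᴳ n R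
  𝔼ᴳ-no-path {n} i j [] R _ _ _ _ = 𝔼ᴳ-* n 1# R
  𝔼ᴳ-no-path {n} i j (k ∷ ks) R i≢j (k∉ ∷ u) avoid ind = begin
    𝔼ᴳ n (λ G → absent-both G i k k j * productOver ks (λ k → absent-both G i k k j) * R G)
      ≈⟨ 𝔼ᴳ-cong n (λ G → *-assoc _ _ _) ⟩
    𝔼ᴳ n (λ G → absent-both G i k k j * (productOver ks (λ k → absent-both G i k k j) * R G))
      ≈⟨ 𝔼ᴳ-absent-both i k k j (λ G → productOver ks (λ k → absent-both G i k k j) * R G)
           (≡.≢-sym k≢i) k≢j ((λ (k≡i , _) → k≢i k≡i) , (λ (_ , j≡i) → i≢j (≡.sym j≡i)))
           (λ x G → *-cong (independent-productOver {s = i} {k} ks (λ k′ G → absent-both G i k′ k′ j)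
             (λ {k′} k′∈ → independent-absent-both {i = i} {k′} {k′} {j} {i} {k}
               ((λ (_ , k′≡k) → All.lookup k∉ k′∈ (≡.sym k′≡k)) , (λ (i≡k , _) → k≢i (≡.sym i≡k)))
               ((λ (k′≡i , _) → proj₁ (avoid (there k′∈)) k′≡i) , (λ (_ , j≡i) → i≢j (≡.sym j≡i)))) x G)
             (proj₁ (ind (here ≡.refl)) x G))
           (λ x G → *-cong (independent-productOver {s = k} {j} ks (λ k′ G → absent-both G i k′ k′ j)
             (λ {k′} k′∈ → independent-absent-both {i = i} {k′} {k′} {j} {k} {j}
               ((λ (i≡k , _) → k≢i (≡.sym i≡k)) , (λ (i≡j , _) → i≢j i≡j))
               ((λ (k′≡k , _) → All.lookup k∉ k′∈ (≡.sym k′≡k)) , (λ (_ , j≡k) → k≢j (≡.sym j≡k)))) x G)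
             (proj₂ (ind (here ≡.refl)) x G)) ⟩
    (1# - p ^ 2) * 𝔼ᴳ n (λ G → productOver ks (λ k → absent-both G i k k j) * R G)
      ≈⟨ *-congˡ (𝔼ᴳ-no-path i j ks R i≢j u (avoid ∘ there) (ind ∘ there)) ⟩
    (1# - p ^ 2) * ((1# - p ^ 2) ^ length ks * 𝔼ᴳ n R)
      ≈⟨ *-assoc _ _ _ ⟨
    (1# - p ^ 2) ^ length (k ∷ ks) * 𝔼ᴳ n R ∎
    where
    open ≈-Reasoning
    k≢i = proj₁ (avoid (here ≡.refl))
    k≢j = proj₂ (avoid (here ≡.refl))

  indicator-∧ : ∀ x y → indicator (x ∧ y) ≈ indicator x * indicator y
  indicator-∧ true  y = sym (*-identityˡ _)
  indicator-∧ false y = sym (zeroˡ _)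

  indicator-∨ : ∀ x y → indicator (x ∨ y) ≈ 1# - (1# - indicator x) * (1# - indicator y)
  indicator-∨ true  y = sym (true-case (indicator y))
    where
    true-case : ∀ y → 1# - (1# - 1#) * (1# - y) ≈ 1#
    true-case = solve 1 (λ y → con (+ 1) :- (con (+ 1) :- con (+ 1)) :* (con (+ 1) :- y) := con (+ 1)) refl
  indicator-∨ false y = sym (false-case (indicator y))
    where
    false-case : ∀ y → 1# - (1# - 0#) * (1# - y) ≈ y
    false-case = solve 1 (λ y → con (+ 1) :- (con (+ 1) :- con (+ 0)) :* (con (+ 1) :- y) := y) refl

  private
    complement² : ∀ x → 1# - (1# - x) ≈ x
    complement² = solve 1 (λ x → con (+ 1) :- (con (+ 1) :- x) := x) refl

    complement-0 : 1# - 0# ≈ 1#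
    complement-0 = solve 0 (con (+ 1) :- con (+ 0) := con (+ 1)) refl

    cong-complement : ∀ {x y} → x ≈ y → 1# - x ≈ 1# - y
    cong-complement x≈y = +-congˡ (-‿cong x≈y)

  indicator-any : ∀ {a} {A : Set a} (f : A → Bool) xs →
    1# - indicator (any f xs) ≈ productOver xs (λ x → 1# - indicator (f x))
  indicator-any f []       = complement-0
  indicator-any f (x ∷ xs) = begin
    1# - indicator (f x ∨ any f xs)
      ≈⟨ cong-complement (indicator-∨ (f x) (any f xs)) ⟩
    1# - (1# - (1# - indicator (f x)) * (1# - indicator (any f xs)))
      ≈⟨ complement² _ ⟩
    (1# - indicator (f x)) * (1# - indicator (any f xs))
      ≈⟨ *-congˡ (indicator-any f xs) ⟩
    productOver (x ∷ xs) (λ x → 1# - indicator (f x)) ∎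
    where open ≈-Reasoning

  productOver-without : ∀ {n} (xs : List (Fin n)) i {f : Fin n → Carrier} → f i ≈ 1# →
    productOver (xs without i) f ≈ productOver xs f
  productOver-without []       i fi≈1 = refl
  productOver-without (x ∷ xs) i {f} fi≈1 with x Fin.≟ i
  ... | yes ≡.refl = trans (productOver-without xs i fi≈1) (sym (trans (*-congʳ fi≈1) (*-identityˡ _)))
  ... | no _       = *-congˡ (productOver-without xs i fi≈1)

  𝔼ᴳ-complement : ∀ n f → 𝔼ᴳ n (λ G → 1# - f G) ≈ 1# - 𝔼ᴳ n f
  𝔼ᴳ-complement n f = begin
    𝔼ᴳ n (λ G → 1# - f G)                        ≈⟨ 𝔼ᴳ-cong n (λ G → +-congˡ (minus (f G))) ⟩
    𝔼ᴳ n (λ G → 1# + - 1# * f G)                 ≈⟨ 𝔼ᴳ-+ n (λ _ → 1#) (λ G → - 1# * f G) ⟩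
    𝔼ᴳ n (λ _ → 1#) + 𝔼ᴳ n (λ G → - 1# * f G)    ≈⟨ +-cong (𝔼ᴳ-const n 1#) (𝔼ᴳ-* n (- 1#) f) ⟩
    1# + - 1# * 𝔼ᴳ n f                           ≈⟨ +-congˡ (minus (𝔼ᴳ n f)) ⟨
    1# - 𝔼ᴳ n f                                  ∎
    where
    open ≈-Reasoning
    minus : ∀ x → - x ≈ - 1# * x
    minus = solve 1 (λ x → :- x := (:- con (+ 1)) :* x) refl

  -- In the complementary event ij is missing and, for each of the n - 2 other nodes k, at least one
  -- of ik and kj is missing. These conditions concern disjoint sets of arcs.
  𝔼ᴳ-difference : ∀ {n} {i j : Fin n} → i ≢ j →
    𝔼ᴳ n (λ G → indicator (present G (difference i j))) ≈ 1# - q * (1# - p ^ 2) ^ (n ∸ 2)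
  𝔼ᴳ-difference {n} {i} {j} i≢j = begin
    𝔼ᴳ n (λ G → indicator (present G (difference i j)))
      ≈⟨ 𝔼ᴳ-cong n pointwise ⟩
    𝔼ᴳ n (λ G → 1# - productOver ks (λ k → absent-both G i k k j) * R G)
      ≈⟨ 𝔼ᴳ-complement n (λ G → productOver ks (λ k → absent-both G i k k j) * R G) ⟩
    1# - 𝔼ᴳ n (λ G → productOver ks (λ k → absent-both G i k k j) * R G)
      ≈⟨ cong-complement (𝔼ᴳ-no-path i j ks R i≢j unique-ks avoid independent) ⟩
    1# - (1# - p ^ 2) ^ length ks * 𝔼ᴳ n R
      ≈⟨ cong-complement (*-cong (reflexive (≡.cong ((1# - p ^ 2) ^_) length-ks))
           (trans (𝔼ᴳ-absent i j (λ _ → 1#) i≢j (λ _ _ → refl)) (*-congˡ (𝔼ᴳ-const n 1#)))) ⟩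
    1# - (1# - p ^ 2) ^ (n ∸ 2) * (q * 1#)
      ≈⟨ cong-complement (trans (*-comm _ _) (*-congʳ (*-identityʳ q))) ⟩
    1# - q * (1# - p ^ 2) ^ (n ∸ 2) ∎
    where
    open ≈-Reasoning
    ks = (allFin n without i) without j
    R : Graph n → Carrier
    R G = (1# - indicator (adj G i j)) * 1#
    unique-ks : Unique ks
    unique-ks = Unique.filter⁺ _ (Unique.filter⁺ _ (Unique.allFin⁺ n))
    avoid : ∀ {k} → k ∈ ks → k ≢ i × k ≢ j
    avoid k∈ = let k∈′ , k≢j = ∈-without⁻ (allFin n without i) k∈
               in proj₂ (∈-without⁻ (allFin n) k∈′) , k≢j
    length-ks : length ks ≡ n ∸ 2
    length-ks = length-allFin-without² n i≢j
    independent : ∀ {k} → k ∈ ks → Independent i k R × Independent k j R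
    independent {k} k∈ =
        (λ x G → *-congʳ (reflexive (≡.cong (λ y → 1# - indicator y) (adj-setArc-other {i = i} {k} {i} {j} x G
          ((λ (_ , j≡k) → proj₂ (avoid k∈) (≡.sym j≡k)) , (λ (i≡k , _) → proj₁ (avoid k∈) (≡.sym i≡k)))))))
      , (λ x G → *-congʳ (reflexive (≡.cong (λ y → 1# - indicator y) (adj-setArc-other {i = k} {j} {i} {j} x G
          ((λ (i≡k , _) → proj₁ (avoid k∈) (≡.sym i≡k)) , (λ (i≡j , _) → i≢j i≡j))))))
    pointwise : ∀ G → indicator (present G (difference i j)) ≈ 1# - productOver ks (λ k → absent-both G i k k j) * R G
    pointwise G = begin
      indicator (adj G i j ∨ any (λ k → adj G i k ∧ adj G k j) (allFin n))
        ≈⟨ indicator-∨ (adj G i j) _ ⟩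
      1# - (1# - indicator (adj G i j)) * (1# - indicator (any (λ k → adj G i k ∧ adj G k j) (allFin n)))
        ≈⟨ cong-complement (*-congˡ (indicator-any (λ k → adj G i k ∧ adj G k j) (allFin n))) ⟩
      1# - (1# - indicator (adj G i j)) * productOver (allFin n) (λ k → 1# - indicator (adj G i k ∧ adj G k j))
        ≈⟨ cong-complement (*-congˡ (productOver-cong (allFin n) (λ {k} _ → cong-complement (indicator-∧ (adj G i k) (adj G k j))))) ⟩
      1# - (1# - indicator (adj G i j)) * productOver (allFin n) (λ k → absent-both G i k k j)
        -- The factors for k ≡ i and k ≡ j equal 1 because there are no loops, so the product may be
        -- restricted to `ks`.
        ≈⟨ cong-complement (*-cong (*-identityʳ _) (trans
             (productOver-without (allFin n without i) j at-j) (productOver-without (allFin n) i at-i))) ⟨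
      1# - R G * productOver ks (λ k → absent-both G i k k j)
        ≈⟨ cong-complement (*-comm _ _) ⟩
      1# - productOver ks (λ k → absent-both G i k k j) * R G ∎
      where
      at-i : absent-both G i i i j ≈ 1#
      at-i = trans (cong-complement (trans (*-congʳ (reflexive (≡.cong indicator (adj-irrefl G i)))) (zeroˡ _))) complement-0
      at-j : absent-both G i j j j ≈ 1#
      at-j = trans (cong-complement (trans (*-congˡ (reflexive (≡.cong indicator (adj-irrefl G j)))) (zeroʳ _))) complement-0

  -- The factor `1#` is the trivial `R` of `𝔼ᴳ-absent-both`.
  𝔼ᴳ-both : ∀ {n} (i j k l : Fin n) → i ≢ j → k ≢ l → DistinctArcs i j k l →
    𝔼ᴳ n (λ G → 1# - absent-both G i j k l * 1#) ≈ p ^ 2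
  𝔼ᴳ-both {n} i j k l i≢j k≢l distinct = trans (𝔼ᴳ-complement n (λ G → absent-both G i j k l * 1#))
    (trans (cong-complement (trans (𝔼ᴳ-absent-both i j k l (λ _ → 1#) i≢j k≢l distinct (λ _ _ → refl) (λ _ _ → refl))
      (trans (*-congˡ (𝔼ᴳ-const n 1#)) (*-identityʳ _)))) (complement² (p ^ 2)))

  private
    indicator-∧∨∧ : ∀ x y → indicator ((x ∧ y) ∨ (y ∧ x)) ≈ 1# - (1# - indicator x * indicator y) * 1#
    indicator-∧∨∧ x y = trans (reflexive (≡.cong indicator (idem x y)))
      (trans (indicator-∧ x y) (sym (trans (cong-complement (*-identityʳ _)) (complement² _))))
      where
      idem : ∀ x y → (x ∧ y) ∨ (y ∧ x) ≡ x ∧ y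
      idem true  true  = ≡.refl
      idem true  false = ≡.refl
      idem false true  = ≡.refl
      idem false false = ≡.refl

  -- With a common head both matchings use the same two arcs, so the two alternatives of `present`
  -- are one event.
  𝔼ᴳ-peak : ∀ {n} {i j k : Fin n} → i ≢ j → i ≢ k → j ≢ k →
    𝔼ᴳ n (λ G → indicator (present G (quad i j i k))) ≈ p ^ 2
  𝔼ᴳ-peak {n} {i} {j} {k} i≢j i≢k j≢k = trans
    (𝔼ᴳ-cong n (λ G → indicator-∧∨∧ (adj G i j) (adj G i k)))
    (𝔼ᴳ-both i j i k i≢j i≢k ((λ (_ , k≡j) → j≢k (≡.sym k≡j)) , (λ (i≡j , _) → i≢j i≡j)))

  𝔼ᴳ-valley : ∀ {n} {i j k : Fin n} → i ≢ j → i ≢ k → j ≢ k →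
    𝔼ᴳ n (λ G → indicator (present G (quad j i k i))) ≈ p ^ 2
  𝔼ᴳ-valley {n} {i} {j} {k} i≢j i≢k j≢k = trans (𝔼ᴳ-cong n (λ G → reflexive (≡.cong indicator (swap G)))) (𝔼ᴳ-peak i≢j i≢k j≢k)
    where
    swap : ∀ G → present G (quad j i k i) ≡ present G (quad i j i k)
    swap G rewrite adj-sym G j i | adj-sym G k i with adj G i j | adj G i k
    ... | true  | true  = ≡.refl
    ... | true  | false = ≡.refl
    ... | false | true  = ≡.refl
    ... | false | false = ≡.refl

  -- The arcs st, uw, sw and ut are distinct, so the two matchings are independent events of
  -- probability p², and 1 - (1 - p²)² = p²(2 - p²).
  𝔼ᴳ-cross : ∀ {n} {s t u w : Fin n} → s ≢ u → t ≢ w → Disjoint s t u w →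
    𝔼ᴳ n (λ G → indicator (present G (quad s t u w))) ≈ p ^ 2 * (fromℕ 2 - p ^ 2)
  𝔼ᴳ-cross {n} {s} {t} {u} {w} s≢u t≢w ((s≢t , s≢w) , u≢t , u≢w) = begin
    𝔼ᴳ n (λ G → indicator ((adj G s t ∧ adj G u w) ∨ (adj G s w ∧ adj G u t)))
      ≈⟨ 𝔼ᴳ-cong n (λ G → trans (indicator-∨ (adj G s t ∧ adj G u w) (adj G s w ∧ adj G u t))
           (cong-complement (*-cong (cong-complement (indicator-∧ (adj G s t) (adj G u w)))
             (trans (cong-complement (indicator-∧ (adj G s w) (adj G u t))) (sym (*-identityʳ _)))))) ⟩
    𝔼ᴳ n (λ G → 1# - absent-both G s t u w * (absent-both G s w u t * 1#))
      ≈⟨ 𝔼ᴳ-complement n (λ G → absent-both G s t u w * (absent-both G s w u t * 1#)) ⟩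
    1# - 𝔼ᴳ n (λ G → absent-both G s t u w * (absent-both G s w u t * 1#))
      ≈⟨ cong-complement (𝔼ᴳ-absent-both s t u w (λ G → absent-both G s w u t * 1#) s≢t u≢w
           ((λ (u≡s , _) → s≢u (≡.sym u≡s)) , (λ (u≡t , _) → u≢t u≡t))
           (λ x G → *-congʳ (independent-absent-both {i = s} {w} {u} {t} {s} {t}
             ((λ (_ , w≡t) → t≢w (≡.sym w≡t)) , (λ (s≡t , _) → s≢t s≡t))
             ((λ (u≡s , _) → s≢u (≡.sym u≡s)) , (λ (u≡t , _) → u≢t u≡t)) x G))
           (λ x G → *-congʳ (independent-absent-both {i = s} {w} {u} {t} {u} {w}
             ((λ (s≡u , _) → s≢u s≡u) , (λ (s≡w , _) → s≢w s≡w))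
             ((λ (_ , t≡w) → t≢w t≡w) , (λ (u≡w , _) → u≢w u≡w)) x G))) ⟩
    1# - (1# - p ^ 2) * 𝔼ᴳ n (λ G → absent-both G s w u t * 1#)
      ≈⟨ cong-complement (*-congˡ (trans (𝔼ᴳ-absent-both s w u t (λ _ → 1#) s≢w u≢t
           ((λ (u≡s , _) → s≢u (≡.sym u≡s)) , (λ (u≡w , _) → u≢w u≡w)) (λ _ _ → refl) (λ _ _ → refl))
           (*-congˡ (𝔼ᴳ-const n 1#)))) ⟩
    1# - (1# - p ^ 2) * ((1# - p ^ 2) * 1#)
      ≈⟨ solve 1 (λ a → con (+ 1) :- (con (+ 1) :- a) :* ((con (+ 1) :- a) :* con (+ 1)) := a :* (con (+ 2) :- a)) refl (p ^ 2) ⟩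
    p ^ 2 * (fromℕ 2 - p ^ 2) ∎
    where open ≈-Reasoning

  fromℕ-length-filter : ∀ {a} {A : Set a} (f : A → Bool) xs →
    fromℕ (length (filter (T? ∘ f) xs)) ≈ sumOver xs (indicator ∘ f)
  fromℕ-length-filter f []       = refl
  fromℕ-length-filter f (x ∷ xs) with f x
  ... | true  = +-congˡ (fromℕ-length-filter f xs)
  ... | false = trans (fromℕ-length-filter f xs) (sym (+-identityˡ _))

  presenceProbability : ℕ → Kind → Carrier
  presenceProbability n forward  = 1# - q * (1# - p ^ 2) ^ (n ∸ 2)
  presenceProbability n backward = 1# - q * (1# - p ^ 2) ^ (n ∸ 2)
  presenceProbability n peak     = p ^ 2
  presenceProbability n valley   = p ^ 2
  presenceProbability n cross    = p ^ 2 * (fromℕ 2 - p ^ 2)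

  𝔼ᴳ-present : ∀ {n κ c} → Shape n κ c → 𝔼ᴳ n (λ G → indicator (present G c)) ≈ presenceProbability n κ
  𝔼ᴳ-present (forward i<j)           = 𝔼ᴳ-difference (Fin.<⇒≢ i<j)
  𝔼ᴳ-present (backward j<i)          = 𝔼ᴳ-difference (≡.≢-sym (Fin.<⇒≢ j<i))
  𝔼ᴳ-present (peak i≢j i≢k j<k)      = 𝔼ᴳ-peak i≢j i≢k (Fin.<⇒≢ j<k)
  𝔼ᴳ-present (valley i≢j i≢k j<k)    = 𝔼ᴳ-valley i≢j i≢k (Fin.<⇒≢ j<k)
  𝔼ᴳ-present (cross s<u t<w disjoint) = 𝔼ᴳ-cross (Fin.<⇒≢ s<u) (Fin.<⇒≢ t<w) disjoint

  𝔼-edgeCount : ∀ n → 𝔼 n p edgeCount ≈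
      fromℕ 6 * fromℕ (n C 4) * p ^ 2 * (fromℕ 2 - p ^ 2)
    + fromℕ 6 * fromℕ (n C 3) * p ^ 2
    + fromℕ 2 * fromℕ (n C 2) * (1# - p) * (1# - (1# - p ^ 2) ^ (n ∸ 2))
    + fromℕ 2 * fromℕ (n C 2) * p
  𝔼-edgeCount n = begin
    𝔼 n p edgeCount
      ≈⟨ sumOver-cong (allGraphs n) (λ {G} _ → *-congˡ (fromℕ-length-filter (present G) (candidates n))) ⟩
    sumOver (allGraphs n) (λ G → probability n p G * sumOver (candidates n) (λ c → indicator (present G c)))
      ≈⟨ sumOver-allGraphs n (λ G → sumOver (candidates n) (λ c → indicator (present G c))) ⟩
    𝔼ᴳ n (λ G → sumOver (candidates n) (λ c → indicator (present G c)))
      ≈⟨ 𝔼ᴳ-sumOver n (candidates n) (λ c G → indicator (present G c)) ⟩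
    sumOver (candidates n) E
      ≈⟨ split kinds ⟩
    sumOver kinds (λ κ → fromℕ (blockSize n κ) * presenceProbability n κ)
      ≈⟨ +-congˡ (+-congˡ (+-cong (*-congʳ (fromℕ-* 3 (n C 3))) (+-cong (*-congʳ (fromℕ-* 3 (n C 3)))
           (+-congʳ (*-congʳ (fromℕ-* 6 (n C 4))))))) ⟩
    _ ≈⟨ collect (fromℕ (n C 2)) (fromℕ (n C 3)) (fromℕ (n C 4)) p ((1# - p ^ 2) ^ (n ∸ 2)) ⟩
    _ ∎
    where
    open ≈-Reasoning
    E : Candidate n → Carrier
    E c = 𝔼ᴳ n (λ G → indicator (present G c))
    split : ∀ κs → sumOver (concatMap (block n) κs) E ≈ sumOver κs (λ κ → fromℕ (blockSize n κ) * presenceProbability n κ)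
    split []       = refl
    split (κ ∷ κs) = trans (sumOver-++ (block n κ) (concatMap (block n) κs) E) (+-cong
      (trans (sumOver-const (block n κ) (λ c∈ → 𝔼ᴳ-present (block-shape n κ c∈)))
        (*-congʳ (reflexive (≡.cong fromℕ (length-block n κ)))))
      (split κs))
    -- The differences are split by 1 - (1 - p)x = (1 - p)(1 - x) + p: pairs joined only by a path
    -- of length two, and arcs.
    collect : ∀ c₂ c₃ c₄ p x →
      c₂ * (1# - (1# - p) * x) + (c₂ * (1# - (1# - p) * x) + (fromℕ 3 * c₃ * p ^ 2 + (fromℕ 3 * c₃ * p ^ 2
        + (fromℕ 6 * c₄ * (p ^ 2 * (fromℕ 2 - p ^ 2)) + 0#)))) ≈
      fromℕ 6 * c₄ * p ^ 2 * (fromℕ 2 - p ^ 2) + fromℕ 6 * c₃ * p ^ 2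
        + fromℕ 2 * c₂ * (1# - p) * (1# - x) + fromℕ 2 * c₂ * p
    collect = solve 5 (λ c₂ c₃ c₄ p x →
      c₂ :* (con (+ 1) :- (con (+ 1) :- p) :* x) :+ (c₂ :* (con (+ 1) :- (con (+ 1) :- p) :* x)
        :+ (con (+ 3) :* c₃ :* p :^ 2 :+ (con (+ 3) :* c₃ :* p :^ 2
        :+ (con (+ 6) :* c₄ :* (p :^ 2 :* (con (+ 2) :- p :^ 2)) :+ con (+ 0))))) :=
      con (+ 6) :* c₄ :* p :^ 2 :* (con (+ 2) :- p :^ 2) :+ con (+ 6) :* c₃ :* p :^ 2
        :+ con (+ 2) :* c₂ :* (con (+ 1) :- p) :* (con (+ 1) :- x) :+ con (+ 2) :* c₂ :* p) refl

-- Growth of the expectation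

nCk≤n^k : ∀ n k → n C k ℕ.≤ n ℕ.^ k
nCk≤n^k n       zero    = ℕ.≤-refl
nCk≤n^k zero    (suc k) = ℕ.z≤n
nCk≤n^k (suc m) (suc k) = begin
  suc m C suc k                 ≤⟨ ℕ.m≤m+n _ _ ⟩
  suc k ℕ.* (suc m C suc k)     ≡⟨ absorption m k ⟨
  suc m ℕ.* (m C k)             ≤⟨ ℕ.*-monoʳ-≤ (suc m) (ℕ.≤-trans (nCk≤n^k m k) (ℕ.^-monoˡ-≤ k (ℕ.n≤1+n m))) ⟩
  suc m ℕ.^ suc k               ∎
  where open ℕ.≤-Reasoning

-- From n = 6 on, each of n - 1, n - 2 and n - 3 is at least n / 2, so n⁴ is at most 8 n(n - 1)(n -
-- 2)(n - 3), which is 192 times n C 4. The factor 6 is split off to match the leading coefficient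
-- of the expectation.
n^4≤192*nC4 : ∀ n → 6 ℕ.≤ n → n ℕ.^ 4 ℕ.≤ 32 ℕ.* (6 ℕ.* (n C 4))
n^4≤192*nC4 n@(suc (suc (suc (suc (suc (suc m))))))
  (ℕ.s≤s (ℕ.s≤s (ℕ.s≤s (ℕ.s≤s (ℕ.s≤s (ℕ.s≤s _)))))) = begin
  n ℕ.^ 4
    ≤⟨ ℕ.*-monoʳ-≤ n (ℕ.*-mono-≤ (doubled 5 (ℕ.m≤m+n 6 4)) (ℕ.*-mono-≤ (doubled 4 (ℕ.m≤m+n 6 2)) (ℕ.*-mono-≤ (doubled 3 ℕ.≤-refl) (ℕ.≤-refl {1})))) ⟩
  n ℕ.* ((5 ℕ.+ m ℕ.+ (5 ℕ.+ m)) ℕ.* ((4 ℕ.+ m ℕ.+ (4 ℕ.+ m)) ℕ.* ((3 ℕ.+ m ℕ.+ (3 ℕ.+ m)) ℕ.* 1)))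
    ≡⟨ factor n (5 ℕ.+ m) (4 ℕ.+ m) (3 ℕ.+ m) ⟩
  8 ℕ.* (n ℕ.* ((5 ℕ.+ m) ℕ.* ((4 ℕ.+ m) ℕ.* (3 ℕ.+ m))))
    ≡⟨ ≡.cong (λ x → 8 ℕ.* (n ℕ.* ((5 ℕ.+ m) ℕ.* ((4 ℕ.+ m) ℕ.* x)))) (nC1≡n (3 ℕ.+ m)) ⟨
  8 ℕ.* (n ℕ.* ((5 ℕ.+ m) ℕ.* ((4 ℕ.+ m) ℕ.* ((3 ℕ.+ m) C 1))))
    ≡⟨ ≡.cong (λ x → 8 ℕ.* (n ℕ.* ((5 ℕ.+ m) ℕ.* x))) (absorption (3 ℕ.+ m) 1) ⟩
  8 ℕ.* (n ℕ.* ((5 ℕ.+ m) ℕ.* (2 ℕ.* ((4 ℕ.+ m) C 2))))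
    ≡⟨ shuffle₁ n (5 ℕ.+ m) ((4 ℕ.+ m) C 2) ⟩
  16 ℕ.* (n ℕ.* ((5 ℕ.+ m) ℕ.* ((4 ℕ.+ m) C 2)))
    ≡⟨ ≡.cong (λ x → 16 ℕ.* (n ℕ.* x)) (absorption (4 ℕ.+ m) 2) ⟩
  16 ℕ.* (n ℕ.* (3 ℕ.* ((5 ℕ.+ m) C 3)))
    ≡⟨ shuffle₂ n ((5 ℕ.+ m) C 3) ⟩
  48 ℕ.* (n ℕ.* ((5 ℕ.+ m) C 3))
    ≡⟨ ≡.cong (48 ℕ.*_) (absorption (5 ℕ.+ m) 3) ⟩
  48 ℕ.* (4 ℕ.* (n C 4))
    ≡⟨ shuffle₃ (n C 4) ⟩
  32 ℕ.* (6 ℕ.* (n C 4)) ∎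
  where
  open ℕ.≤-Reasoning
  doubled : ∀ k → 6 ℕ.≤ k ℕ.+ k → n ℕ.≤ k ℕ.+ m ℕ.+ (k ℕ.+ m)
  doubled k 6≤2k = ℕ.≤-trans (ℕ.+-mono-≤ 6≤2k (ℕ.m≤m+n m m)) (ℕ.≤-reflexive (rearrange k m))
    where
    rearrange : ∀ k m → k ℕ.+ k ℕ.+ (m ℕ.+ m) ≡ k ℕ.+ m ℕ.+ (k ℕ.+ m)
    rearrange = solve-∀
  factor : ∀ a b c d → a ℕ.* ((b ℕ.+ b) ℕ.* ((c ℕ.+ c) ℕ.* ((d ℕ.+ d) ℕ.* 1))) ≡ 8 ℕ.* (a ℕ.* (b ℕ.* (c ℕ.* d)))
  factor = solve-∀
  shuffle₁ : ∀ a b c → 8 ℕ.* (a ℕ.* (b ℕ.* (2 ℕ.* c))) ≡ 16 ℕ.* (a ℕ.* (b ℕ.* c))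
  shuffle₁ = solve-∀
  shuffle₂ : ∀ a b → 16 ℕ.* (a ℕ.* (3 ℕ.* b)) ≡ 48 ℕ.* (a ℕ.* b)
  shuffle₂ = solve-∀
  shuffle₃ : ∀ a → 48 ℕ.* (4 ℕ.* a) ≡ 32 ℕ.* (6 ℕ.* a)
  shuffle₃ = solve-∀

module _ {c ℓ₁ ℓ₂} (F : OrderedField c ℓ₁ ℓ₂) where
  open OrderedField F hiding (zero)
  open Over F
  open OrderedFieldProperties F
  open Solver
  private
    module S = IsStrictTotalOrder isStrictTotalOrder

  ^-nonneg : ∀ {a} → 0# ≤ a → ∀ m → 0# ≤ a ^ m
  ^-nonneg 0≤a zero    = inj₁ 0<1
  ^-nonneg 0≤a (suc m) = *-nonneg 0≤a (^-nonneg 0≤a m)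

  ^-≤1 : ∀ {a} → 0# ≤ a → a ≤ 1# → ∀ m → a ^ m ≤ 1#
  ^-≤1 0≤a a≤1 zero    = ≤-refl
  ^-≤1 0≤a a≤1 (suc m) = ≤-trans (*-monoʳ-≤ 0≤a (^-≤1 0≤a a≤1 m)) (≤-respˡ (sym (*-identityʳ _)) a≤1)

  -- Bernoulli's inequality, the union bound for m events of probability y: step m contributes y(1 -
  -- y)ᵐ, which is at most y.
  bernoulli : ∀ {y} → 0# ≤ y → y ≤ 1# → ∀ m → 1# - (1# - y) ^ m ≤ fromℕ m * y
  bernoulli {y} 0≤y y≤1 zero = inj₂ (solve 1 (λ y → con (+ 1) :- con (+ 1) := con (+ 0) :* y) refl y)
  bernoulli {y} 0≤y y≤1 (suc m) = ≤-respˡ (expand y a) (≤-respʳ (collect y (fromℕ m))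
    (+-mono-≤ (bernoulli 0≤y y≤1 m) (≤-respʳ (*-identityʳ y) (*-monoʳ-≤ 0≤y (^-≤1 (≤⇒0≤- y≤1) 1-y≤1 m)))))
    where
    a = (1# - y) ^ m
    1-y≤1 : 1# - y ≤ 1#
    1-y≤1 = 0≤-⇒≤ (≤-respʳ (solve 1 (λ y → y := con (+ 1) :- (con (+ 1) :- y)) refl y) 0≤y)
    expand : ∀ y a → 1# - a + y * a ≈ 1# - (1# - y) * a
    expand = solve 2 (λ y a → con (+ 1) :- a :+ y :* a := con (+ 1) :- (con (+ 1) :- y) :* a) refl
    collect : ∀ y m → m * y + y ≈ (1# + m) * y
    collect = solve 2 (λ y m → m :* y :+ y := (con (+ 1) :+ m) :* y) refl

  ∣∣-nonneg : ∀ {x} → 0# ≤ x → ∣ x ∣ ≡ x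
  ∣∣-nonneg {x} 0≤x with x <? 0#
  ... | yes x<0 = contradiction 0≤x (<⇒≱ x<0)
  ... | no _    = ≡.refl

  *-cancel-⁻¹ : ∀ {x} y → 0# < x → y * x * x ⁻¹ ≈ y
  *-cancel-⁻¹ {x} y 0<x = trans (*-assoc y x (x ⁻¹))
    (trans (*-congˡ (⁻¹-inverseʳ (λ x≈0 → S.irrefl (sym x≈0) 0<x))) (*-identityʳ y))

  sandwich : ∀ {a b : ℕ → Carrier} {D c} N → 0# < D →
    (∀ n → N ℕ.≤ n → 0# < b n × b n ≤ D * a n × a n ≤ c * b n) → a ≃ b
  sandwich {a} {b} {D} {c} N 0<D bounds =
      (N , λ n N≤n b≈0 → S.irrefl (sym b≈0) (proj₁ (bounds n N≤n)))
    , (D ⁻¹ , ⁻¹-positive 0<D , N , λ n N≤n → ≤-respʳ (reflexive (≡.sym (∣∣-nonneg (inj₁ (0<ratio n N≤n))))) (lower n N≤n))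
    , (c , N , λ n N≤n → ≤-respˡ (reflexive (≡.sym (∣∣-nonneg (inj₁ (0<ratio n N≤n))))) (upper n N≤n))
    where
    lower : ∀ n → N ℕ.≤ n → D ⁻¹ ≤ a n * b n ⁻¹
    lower n N≤n with bounds n N≤n
    ... | 0<b , b≤Ca , _ = ≤-respˡ (*-cancel-⁻¹ (D ⁻¹) 0<b) (≤-respʳ simplify
          (*-monoˡ-≤ (inj₁ (⁻¹-positive 0<b)) (*-monoʳ-≤ (inj₁ (⁻¹-positive 0<D)) b≤Ca)))
      where
      simplify : D ⁻¹ * (D * a n) * b n ⁻¹ ≈ a n * b n ⁻¹
      simplify = *-congʳ (trans (solve 3 (λ i c a → i :* (c :* a) := a :* c :* i) refl (D ⁻¹) D (a n)) (*-cancel-⁻¹ (a n) 0<D))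
    upper : ∀ n → N ℕ.≤ n → a n * b n ⁻¹ ≤ c
    upper n N≤n with bounds n N≤n
    ... | 0<b , _ , a≤cb = ≤-respʳ (*-cancel-⁻¹ c 0<b) (*-monoˡ-≤ (inj₁ (⁻¹-positive 0<b)) a≤cb)
    0<ratio : ∀ n → N ℕ.≤ n → 0# < a n * b n ⁻¹
    0<ratio n N≤n = <-≤-trans (⁻¹-positive 0<D) (lower n N≤n)

  expectedEdges : ℕ → Carrier → Carrier
  expectedEdges n p =
      fromℕ 6 * fromℕ (n C 4) * p ^ 2 * (fromℕ 2 - p ^ 2)
    + fromℕ 6 * fromℕ (n C 3) * p ^ 2
    + fromℕ 2 * fromℕ (n C 2) * (1# - p) * (1# - (1# - p ^ 2) ^ (n ∸ 2))
    + fromℕ 2 * fromℕ (n C 2) * p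

  module _ {n : ℕ} {p : Carrier} (6≤n : 6 ℕ.≤ n) (0<p : 0# < p) (p<1 : p < 1#) where

    private
      B = fromℕ n ^ 4 * p ^ 2
      y = p ^ 2
      power = (1# - y) ^ (n ∸ 2)
      0<y : 0# < y
      0<y = *-positive 0<p (S.<-respʳ-≈ (sym (*-identityʳ p)) 0<p)
      y≤1 : y ≤ 1#
      y≤1 = ^-≤1 (inj₁ 0<p) (inj₁ p<1) 2
      0≤1-p : 0# ≤ 1# - p
      0≤1-p = ≤⇒0≤- (inj₁ p<1)
      1-p≤1 : 1# - p ≤ 1#
      1-p≤1 = 0≤-⇒≤ (≤-respʳ (solve 1 (λ y → y := con (+ 1) :- (con (+ 1) :- y)) refl p) (inj₁ 0<p))
      1-y≤1 : 1# - y ≤ 1#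
      1-y≤1 = 0≤-⇒≤ (≤-respʳ (solve 1 (λ y → y := con (+ 1) :- (con (+ 1) :- y)) refl y) (inj₁ 0<y))
      0≤1-power : 0# ≤ 1# - power
      0≤1-power = ≤⇒0≤- (^-≤1 (≤⇒0≤- y≤1) 1-y≤1 (n ∸ 2))
      _*₀_ : ∀ {x y} → 0# ≤ x → 0# ≤ y → 0# ≤ x * y
      _*₀_ = *-nonneg
      infixl 7 _*₀_
      0≤ : ∀ m → 0# ≤ fromℕ m
      0≤ = fromℕ-nonneg
      scaled : ∀ {m} k → m ℕ.≤ k ℕ.* n ℕ.^ 4 → fromℕ m * y ≤ fromℕ k * B
      scaled {m} k m≤ = ≤-respʳ (trans (*-congʳ (trans (fromℕ-* k (n ℕ.^ 4)) (*-congˡ (fromℕ-^ n 4)))) (*-assoc _ _ _))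
        (*-monoˡ-≤ (inj₁ 0<y) (fromℕ-mono-≤ m≤))

    main-positive : 0# < B
    main-positive = *-positive (S.<-respʳ-≈ (fromℕ-^ n 4) (positive (ℕ.^-monoˡ-≤ 4 6≤n))) 0<y
      where
      positive : ∀ {m} → 6 ℕ.^ 4 ℕ.≤ m → 0# < fromℕ m
      positive {suc m} _ = fromℕ-positive m

    -- The first term is enough: 2 - p² is at least 1 and the other terms are nonnegative.
    main≤32*expectedEdges : B ≤ fromℕ 32 * expectedEdges n p
    main≤32*expectedEdges = ≤-trans
      (≤-respˡ (*-congʳ (fromℕ-^ n 4)) (*-monoˡ-≤ (inj₁ 0<y) (fromℕ-mono-≤ (n^4≤192*nC4 n 6≤n))))
      (≤-respˡ (sym (trans (*-congʳ (trans (fromℕ-* 32 (6 ℕ.* (n C 4))) (*-congˡ (fromℕ-* 6 (n C 4))))) (*-assoc _ _ _)))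
        (*-monoʳ-≤ (fromℕ-nonneg 32) leading))
      where
      t₁ t₂ t₃ t₄ : Carrier
      t₁ = fromℕ 6 * fromℕ (n C 4) * y * (fromℕ 2 - y)
      t₂ = fromℕ 6 * fromℕ (n C 3) * y
      t₃ = fromℕ 2 * fromℕ (n C 2) * (1# - p) * (1# - power)
      t₄ = fromℕ 2 * fromℕ (n C 2) * p
      1≤2-y : 1# ≤ fromℕ 2 - y
      1≤2-y = 0≤-⇒≤ (≤-respʳ (solve 1 (λ y → con (+ 1) :- y := con (+ 2) :- y :- con (+ 1)) refl y) (≤⇒0≤- y≤1))
      leading : fromℕ 6 * fromℕ (n C 4) * y ≤ t₁ + t₂ + t₃ + t₄
      leading = ≤-respˡ (solve 1 (λ x → x :* con (+ 1) :+ con (+ 0) :+ con (+ 0) :+ con (+ 0) := x) refl _)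
        (+-mono-≤ (+-mono-≤ (+-mono-≤
          (*-monoʳ-≤ (0≤ 6 *₀ 0≤ (n C 4) *₀ inj₁ 0<y) 1≤2-y)
          (0≤ 6 *₀ 0≤ (n C 3) *₀ inj₁ 0<y))
          (0≤ 2 *₀ 0≤ (n C 2) *₀ 0≤1-p *₀ 0≤1-power))
          (0≤ 2 *₀ 0≤ (n C 2) *₀ inj₁ 0<p))

    -- The first three terms contribute 12 + 6 + 2 = 20. The fourth is linear in p, and the bound b
    -- is what turns it into a multiple of p².
    expectedEdges≤main : ∀ {b} → 0# < b → b ≤ fromℕ n ^ 2 * p →
      expectedEdges n p ≤ (fromℕ 20 + fromℕ 2 * b ⁻¹) * B
    expectedEdges≤main {b} 0<b b≤ = ≤-respʳ (collect B (b ⁻¹))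
      (+-mono-≤ (+-mono-≤ (+-mono-≤ bound₁ bound₂) bound₃) bound₄)
      where
      collect : ∀ B i → fromℕ 12 * B + fromℕ 6 * B + fromℕ 2 * B + fromℕ 2 * i * B ≈ (fromℕ 20 + fromℕ 2 * i) * B
      collect = solve 2 (λ B i → con (+ 12) :* B :+ con (+ 6) :* B :+ con (+ 2) :* B :+ con (+ 2) :* i :* B
        := (con (+ 20) :+ con (+ 2) :* i) :* B) refl
      2-y≤2 : fromℕ 2 - y ≤ fromℕ 2
      2-y≤2 = 0≤-⇒≤ (≤-respʳ (solve 1 (λ y → y := con (+ 2) :- (con (+ 2) :- y)) refl y) (inj₁ 0<y))
      bound₁ : fromℕ 6 * fromℕ (n C 4) * y * (fromℕ 2 - y) ≤ fromℕ 12 * B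
      bound₁ = ≤-trans (*-monoʳ-≤ (0≤ 6 *₀ 0≤ (n C 4) *₀ inj₁ 0<y) 2-y≤2)
        (≤-respˡ (trans (*-congʳ (fromℕ-* 12 (n C 4)))
            (solve 2 (λ c y → con (+ 12) :* c :* y := con (+ 6) :* c :* y :* con (+ 2)) refl (fromℕ (n C 4)) y))
          (scaled 12 (ℕ.*-monoʳ-≤ 12 (nCk≤n^k n 4))))
      bound₂ : fromℕ 6 * fromℕ (n C 3) * y ≤ fromℕ 6 * B
      bound₂ = ≤-respˡ (*-congʳ (fromℕ-* 6 (n C 3))) (scaled 6 (ℕ.*-monoʳ-≤ 6 (ℕ.≤-trans (nCk≤n^k n 3) n^3≤n^4)))
        where
        n^3≤n^4 : n ℕ.^ 3 ℕ.≤ n ℕ.^ 4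
        n^3≤n^4 = ℕ.^-monoʳ-≤ n {{ℕ.>-nonZero (ℕ.≤-trans (ℕ.s≤s ℕ.z≤n) 6≤n)}} {3} {4} (ℕ.n≤1+n 3)
      -- The factor p² comes out of `1# - power` by Bernoulli's inequality, at the cost of a factor
      -- n - 2.
      bound₃ : fromℕ 2 * fromℕ (n C 2) * (1# - p) * (1# - power) ≤ fromℕ 2 * B
      bound₃ = ≤-trans
        (≤-trans (*-monoˡ-≤ 0≤1-power (≤-respʳ (*-identityʳ _) (*-monoʳ-≤ (0≤ 2 *₀ 0≤ (n C 2)) 1-p≤1)))
          (*-monoʳ-≤ (0≤ 2 *₀ 0≤ (n C 2)) (bernoulli (inj₁ 0<y) y≤1 (n ∸ 2))))
        (≤-respˡ (trans (*-congʳ (trans (fromℕ-* 2 ((n C 2) ℕ.* (n ∸ 2))) (*-congˡ (fromℕ-* (n C 2) (n ∸ 2)))))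
            (solve 3 (λ c m y → con (+ 2) :* (c :* m) :* y := con (+ 2) :* c :* (m :* y)) refl (fromℕ (n C 2)) (fromℕ (n ∸ 2)) y))
          (scaled 2 (ℕ.*-monoʳ-≤ 2 nC2*[n-2]≤n^4)))
        where
        nC2*[n-2]≤n^4 : (n C 2) ℕ.* (n ∸ 2) ℕ.≤ n ℕ.^ 4
        nC2*[n-2]≤n^4 = ℕ.≤-trans (ℕ.*-mono-≤ (nCk≤n^k n 2) (ℕ.≤-trans (ℕ.m∸n≤m n 2)
            (ℕ.m≤m*n n (n ℕ.* 1) {{ℕ.>-nonZero (ℕ.≤-trans (ℕ.s≤s ℕ.z≤n) (ℕ.≤-trans 6≤n (ℕ.≤-reflexive (≡.sym (ℕ.*-identityʳ n)))))}})))
          (ℕ.≤-reflexive (≡.sym (ℕ.^-distribˡ-+-* n 2 2)))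
      -- b ≤ n² p gives n² p ≤ b⁻¹ (n² p)².
      bound₄ : fromℕ 2 * fromℕ (n C 2) * p ≤ fromℕ 2 * b ⁻¹ * B
      bound₄ = ≤-trans
        (*-monoˡ-≤ (inj₁ 0<p) (*-monoʳ-≤ (0≤ 2) (≤-respʳ (fromℕ-^ n 2) (fromℕ-mono-≤ (nCk≤n^k n 2)))))
        (≤-respˡ (trans (solve 4 (λ b i u p → con (+ 2) :* (i :* (b :* (u :* p))) := con (+ 2) :* u :* p :* b :* i)
              refl b (b ⁻¹) (fromℕ n ^ 2) p) (*-cancel-⁻¹ _ 0<b))
          (≤-respʳ (solve 3 (λ i u p → con (+ 2) :* (i :* (u :^ 2 :* p :* (u :^ 2 :* p))) := con (+ 2) :* i :* (u :^ 4 :* p :^ 2))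
              refl (b ⁻¹) (fromℕ n) p)
            (*-monoʳ-≤ (0≤ 2) (*-monoʳ-≤ (inj₁ (⁻¹-positive 0<b))
              (*-monoˡ-≤ (^-nonneg (0≤ n) 2 *₀ inj₁ 0<p) b≤)))))

theorem4p1 : ∀ {c ℓ₁ ℓ₂} (F : OrderedField c ℓ₁ ℓ₂) →
    let open OrderedField F
        open Over F
    in
    (p : ℕ → Carrier) → (∀ n → 0# < p n × p n < 1#) →
    (K : ∀ n → Graph n → ℕ) → (∀ n (G : Graph n) → EdgeNumber G (K n G)) →
    (∀ n → 𝔼 n (p n) (K n) ≈
        fromℕ 6 * fromℕ (n C 4) * p n ^ 2 * (fromℕ 2 - p n ^ 2)
      + fromℕ 6 * fromℕ (n C 3) * p n ^ 2
      + fromℕ 2 * fromℕ (n C 2) * (1# - p n) * (1# - (1# - p n ^ 2) ^ (n ∸ 2))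
      + fromℕ 2 * fromℕ (n C 2) * p n)
    × (0<liminf (λ n → fromℕ n ^ 2 * p n) →
       (λ n → 𝔼 n (p n) (K n)) ≃ (λ n → fromℕ n ^ 4 * p n ^ 2))
theorem4p1 F p 0<p<1 K K-edges = formula , asymptotics
  where
  open OrderedField F hiding (zero)
  open Over F
  open OrderedFieldProperties F
  open Sums F
  formula : ∀ n → 𝔼 n (p n) (K n) ≈ expectedEdges F n (p n)
  formula n = trans
    (sumOver-cong (allGraphs n) (λ {G} _ → *-congˡ (reflexive (≡.cong fromℕ (edgeNumber≡edgeCount F G (K-edges n G))))))
    (RandomGraphs.𝔼-edgeCount F (p n) n)
  asymptotics : 0<liminf (λ n → fromℕ n ^ 2 * p n) →
    (λ n → 𝔼 n (p n) (K n)) ≃ (λ n → fromℕ n ^ 4 * p n ^ 2)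
  -- The 6 is the threshold of `n^4≤192*nC4` and N that of the lower bound on n² p;
  -- `fromℕ-positive 31` says that 32 is positive.
  asymptotics (b , 0<b , N , b≤) = sandwich F (6 ℕ.⊔ N) (fromℕ-positive 31) λ n N≤n →
    let 6≤n = ℕ.≤-trans (ℕ.m≤m⊔n 6 N) N≤n
        0<p , p<1 = 0<p<1 n
    in main-positive F 6≤n 0<p p<1
     , ≤-respʳ (*-congˡ (sym (formula n))) (main≤32*expectedEdges F 6≤n 0<p p<1)
     , ≤-respˡ (sym (formula n))
         (expectedEdges≤main F 6≤n 0<p p<1 0<b (b≤ n (ℕ.≤-trans (ℕ.m≤n⊔m 6 N) N≤n)))
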